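{- Let $n \ge 7$ be an integer. The following statements are equivalent: (a) there exists a 6-valent first-kind Frobenius circulant of the form $TL_n(a,b,1)$ of order $n$ such that the kernel of the underlying Frobenius group is cyclic; (b) $n \equiv 1 \pmod 6$ and the congruence $x^2 - x + 1 \equiv 0 \pmod n$ has a solution. Moreover, if one of these conditions holds, then: (c) every prime factor of $n$ is congruent to $1$ modulo $6$; (d) each solution $a$ of $x^2 - x + 1 \equiv 0 \pmod n$ gives rise to a 6-valent first-kind Frobenius circulant $TL_n(a,b,1)$ (with cyclic kernel), and conversely every 6-valent first-kind Frobenius circulant $TL_n(a,b,1)$ with cyclic kernel arises in this way from a solution $a$; in this case $b \equiv a-1 \pmod n$, and $TL_n(a,a-1,1)$ is a rotational, geometric, $(\mathbb{Z}_n \rtimes H)$-arc-transitive, first-kind $(\mathbb{Z}_n \rtimes H)$-Frobenius graph admitting $[a]$ and $-[a^2]$ (acting by multiplication) as complete rotations, where $H = \langle [a] \rangle = \{\pm[1], \pm[a], \pm[a^2]\} = \{\pm[1], \pm[a], \pm[a-1]\} \le \mathbb{Z}_n^*$; (e) there are exactly $2^{l-1}$ pairwise non-isomorphic 6-valent first-kind Frobenius circulants of order $n$ (with cyclic kernel), where $l$ is the number of distinct prime factors of $n$, and each of them is isomorphic to $TL_n(a,a-1,1)$ for some solution $a$ of $x^2 - x + 1 \equiv 0 \pmod n$.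
   Context: $[m]$ denotes the residue class of $m$ modulo $n$, $\mathbb{Z}_n^*$ the group of units of $\mathbb{Z}_n$, acting on $\mathbb{Z}_n$ by multiplication; $\mathbb{Z}_n \rtimes \mathbb{Z}_n^*$ acts on $\mathbb{Z}_n$ by $[x]^{([y],[m])} = [(x+y)m]$. For a group $K$ and an inverse-closed $S \subseteq K\setminus\{1\}$, the Cayley graph $\mathrm{Cay}(K,S)$ has vertex set $K$, with $x,y$ adjacent iff $xy^{ -1} \in S$. For integers $1 \le a,b,c \le n-1$ with $a,b,c,n-a,n-b,n-c$ pairwise distinct, $TL_n(a,b,c) = \mathrm{Cay}(\mathbb{Z}_n, \{\pm[a],\pm[b],\pm[c]\})$; it is geometric if $a'+b'+c' \equiv 0 \pmod n$ for some $a' \in \{a,n-a\}$, $b' \in \{b,n-b\}$, $c'\in\{c,n-c\}$. A complete rotation of $\mathrm{Cay}(K,S)$ is a group automorphism of $K$ fixing $S$ setwise and inducing a cyclic permutation of $S$; the Cayley graph is rotational if it admits one. A graph is $G$-arc-transitive if $G \le \mathrm{Aut}$ is transitive on ordered pairs of adjacent vertices. A transitive permutation group $G$ on a finite set $\Omega$ is a Frobenius group if it is not regular and only the identity fixes two points; then $G = K \rtimes H$ where the Frobenius kernel $K$ is a normal subgroup regular on $\Omega$ and $H$ is a point stabiliser; identifying $\Omega$ with $K$, $H$ acts on $K$ by conjugation. A first-kind $G$-Frobenius graph is $\mathrm{Cay}(K, a^H)$ where $a \in K$ satisfies $\langle a^H\rangle = K$ and either $|H|$ is even or $a$ is an involution.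 A 6-valent first-kind Frobenius circulant of order $n$ with cyclic kernel is a 6-valent first-kind $G$-Frobenius graph for some Frobenius group $G$ whose kernel is cyclic of order $n$ (viewed as $\mathrm{Cay}(\mathbb{Z}_n,S)$). -}

module Defs where

open import Level using (Level)
open import Data.Nat using (ℕ; zero; suc; _+_; _*_; _∸_; _^_; _≤_; _<_; NonZero)
open import Data.Nat.DivMod using (_mod_; _%_)
open import Data.Nat.Divisibility using (_∣_)
open import Data.Nat.Primality using (Prime)
open import Data.Fin using (Fin; toℕ)
open import Data.List using (List; []; _∷_; length; foldr)
open import Data.List.Relation.Unary.All using (All)
open import Data.List.Relation.Unary.Any using (Any)
open import Data.List.Relation.Unary.AllPairs using (AllPairs)
open import Data.List.Relation.Unary.Unique.Propositional using (Unique)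
open import Data.List.Membership.Propositional using (_∈_)
open import Data.Product using (Σ; ∃; ∃-syntax; _×_; _,_)
open import Data.Sum using (_⊎_)
open import Function using (_∘_; id; _⇔_)
open import Relation.Nullary using (¬_)
open import Relation.Binary.PropositionalEquality using (_≡_; _≢_; _≗_)

HasSize : {A : Set} → (A → Set) → (A → A → Set) → ℕ → Set
HasSize {A} P _≈_ m =
  Σ (List A) λ xs → length xs ≡ m × All P xs
    × AllPairs (λ x y → ¬ (x ≈ y)) xs × (∀ x → P x → Any (x ≈_) xs)

iter : {A : Set} → (A → A) → ℕ → A → A
iter f zero = id
iter f (suc i) = f ∘ iter f i

Perm : ℕ → Set
Perm n = Fin n → Fin n

PermSet : ℕ → Set₁
PermSet n = Perm n → Set

IsBij : {n : ℕ} → Perm n → Set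
IsBij f = (∀ x y → f x ≡ f y → x ≡ y) × (∀ y → ∃[ x ] f x ≡ y)

record IsPermGroup {n : ℕ} (G : PermSet n) : Set where
  field
    resp     : ∀ {g h} → g ≗ h → G g → G h
    has-id   : G id
    closed   : ∀ {g h} → G g → G h → G (g ∘ h)
    inverses : ∀ {g} → G g → ∃[ h ] (G h × (g ∘ h ≗ id) × (h ∘ g ≗ id))

record IsFrobenius {n : ℕ} (G : PermSet n) : Set where
  field
    group      : IsPermGroup G
    transitive : ∀ x y → ∃[ g ] (G g × g x ≡ y)
    notRegular : ∃[ g ] (G g × ¬ (g ≗ id) × ∃[ x ] (g x ≡ x))
    twoPoints  : ∀ g x y → G g → x ≢ y → g x ≡ x → g y ≡ y → g ≗ id

Kernel : {n : ℕ} → PermSet n → PermSet n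
Kernel G g = G g × (g ≗ id ⊎ (∀ x → g x ≢ x))

Stab : {n : ℕ} → PermSet n → Fin n → PermSet n
Stab G ω g = G g × g ω ≡ ω

-- c ∈ a^H  (c = h a h⁻¹, written c ∘ h ≗ h ∘ a)
Conj : {n : ℕ} → PermSet n → Perm n → PermSet n
Conj H a c = ∃[ h ] (H h × (c ∘ h ≗ h ∘ a))

EvenOrder : {n : ℕ} → PermSet n → Set
EvenOrder H = ∃[ m ] (HasSize H _≗_ m × 2 ∣ m)

Involution : {n : ℕ} → Perm n → Set
Involution a = ¬ (a ≗ id) × (a ∘ a ≗ id)

module _ (n : ℕ) ⦃ nz : NonZero n ⦄ where

  [_] : ℕ → Fin n
  [ m ] = m mod n

  _⊕_ : Fin n → Fin n → Fin n
  x ⊕ y = [ toℕ x + toℕ y ]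

  ⊖_ : Fin n → Fin n
  ⊖ x = [ n ∸ toℕ x ]

  _⊗_ : Fin n → Fin n → Fin n
  x ⊗ y = [ toℕ x * toℕ y ]

  powₙ : Fin n → ℕ → Fin n
  powₙ x zero = [ 1 ]
  powₙ x (suc i) = x ⊗ powₙ x i

  Sub : Set₁
  Sub = Fin n → Set

  _≐_ : Sub → Sub → Set
  S ≐ T = ∀ x → S x ⇔ T x

  Adj : Sub → Fin n → Fin n → Set
  Adj S x y = S (x ⊕ (⊖ y))

  Iso : Sub → Sub → Set
  Iso S T = ∃[ f ] (IsBij f × (∀ x y → Adj S x y ⇔ Adj T (f x) (f y)))

  IsSol : ℕ → Set
  IsSol x = (x * x + 1) % n ≡ x % n

  TLParams : ℕ → ℕ → ℕ → Set
  TLParams a b c =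
    1 ≤ a × a ≤ n ∸ 1 × 1 ≤ b × b ≤ n ∸ 1 × 1 ≤ c × c ≤ n ∸ 1 ×
    Unique (a ∷ (n ∸ a) ∷ b ∷ (n ∸ b) ∷ c ∷ (n ∸ c) ∷ [])

  TL : ℕ → ℕ → ℕ → Sub
  TL a b c x = x ≡ [ a ] ⊎ x ≡ ⊖ [ a ] ⊎ x ≡ [ b ] ⊎ x ≡ ⊖ [ b ] ⊎ x ≡ [ c ] ⊎ x ≡ ⊖ [ c ]

  Geometric : ℕ → ℕ → ℕ → Set
  Geometric a b c = ∃[ a' ] ∃[ b' ] ∃[ c' ]
    ((a' ≡ a ⊎ a' ≡ n ∸ a) × (b' ≡ b ⊎ b' ≡ n ∸ b) × (c' ≡ c ⊎ c' ≡ n ∸ c)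
      × (a' + b' + c') % n ≡ 0)

  IsGroupAut : Perm n → Set
  IsGroupAut f = IsBij f × (∀ x y → f (x ⊕ y) ≡ f x ⊕ f y)

  CompleteRotation : Sub → Perm n → Set
  CompleteRotation S f = IsGroupAut f × (∀ x → S x ⇔ S (f x))
    × ∃[ s ] (S s × (∀ x → S x → ∃[ i ] (iter f i s ≡ x)))

  Rotational : Sub → Set
  Rotational S = ∃[ f ] CompleteRotation S f

  ArcTransitive : PermSet n → Sub → Set
  ArcTransitive G S = (∀ g → G g → ∀ x y → Adj S x y ⇔ Adj S (g x) (g y))
    × (∀ x y x' y' → Adj S x y → Adj S x' y' → ∃[ g ] (G g × g x ≡ x' × g y ≡ y'))

  -- Cay(ℤ_n,S) is a first-kind G-Frobenius graph with cyclic kernel K of order n,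
  -- with K identified with ℤ_n via a generator κ (κ^i ↦ [i])
  record FirstKindFrobeniusGraph (G : PermSet n) (S : Sub) : Set where
    field
      frobenius : IsFrobenius G
      κ         : Perm n
      κ∈K       : Kernel G κ
      κ-gen     : ∀ g → Kernel G g → ∃[ i ] (g ≗ iter κ i)
      κ-order   : (iter κ n ≗ id) × (∀ i → 0 < i → i < n → ¬ (iter κ i ≗ id))
      ω         : Fin n
      a         : Perm n
      a∈K       : Kernel G a
      generates : ∀ g → Kernel G g →
                    ∃[ cs ] (All (Conj (Stab G ω) a) cs × (foldr (λ f h → f ∘ h) (λ x → x) cs ≗ g))
      firstKind : EvenOrder (Stab G ω) ⊎ Involution a
      conn      : ∀ x → S x ⇔ Conj (Stab G ω) a (iter κ (toℕ x))

  FrobCirc : Sub → Set₁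
  FrobCirc S = HasSize S _≡_ 6 × ∃[ G ] FirstKindFrobeniusGraph G S

  HGen : ℕ → Fin n → Set
  HGen a m = ∃[ i ] (m ≡ powₙ [ a ] i)

  Aff : ℕ → PermSet n
  Aff a g = ∃[ y ] ∃[ m ] (HGen a m × g ≗ (λ x → (x ⊕ y) ⊗ m))

  NumPrimeFactors : ℕ → Set
  NumPrimeFactors l = ∃[ ps ] (Unique ps × All Prime ps × All (_∣ n) ps
    × (∀ p → Prime p → p ∣ n → p ∈ ps) × length ps ≡ l)

  CondA : Set₁
  CondA = ∃[ a ] ∃[ b ] (TLParams a b 1 × FrobCirc (TL a b 1))

  CondB : Set
  CondB = n % 6 ≡ 1 × ∃[ x ] IsSol x

  CondC : Set
  CondC = ∀ p → Prime p → p ∣ n → p % 6 ≡ 1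

  SolProps : ℕ → Set₁
  SolProps a =
    TLParams a (a ∸ 1) 1 × FrobCirc (TL a (a ∸ 1) 1)
    × Rotational (TL a (a ∸ 1) 1)
    × Geometric a (a ∸ 1) 1
    × ArcTransitive (Aff a) (TL a (a ∸ 1) 1)
    × FirstKindFrobeniusGraph (Aff a) (TL a (a ∸ 1) 1)
    × CompleteRotation (TL a (a ∸ 1) 1) (λ x → x ⊗ [ a ])
    × CompleteRotation (TL a (a ∸ 1) 1) (λ x → x ⊗ (⊖ [ a * a ]))
    × (∀ m → HGen a m → ∃[ u ] (m ⊗ u ≡ [ 1 ]))
    × (∀ m → HGen a m ⇔ (m ≡ [ 1 ] ⊎ m ≡ ⊖ [ 1 ] ⊎ m ≡ [ a ] ⊎ m ≡ ⊖ [ a ]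
                          ⊎ m ≡ [ a * a ] ⊎ m ≡ ⊖ [ a * a ]))
    × (∀ m → HGen a m ⇔ (m ≡ [ 1 ] ⊎ m ≡ ⊖ [ 1 ] ⊎ m ≡ [ a ] ⊎ m ≡ ⊖ [ a ]
                          ⊎ m ≡ [ a ∸ 1 ] ⊎ m ≡ ⊖ [ a ∸ 1 ]))

  CondD : Set₁
  CondD =
    (∀ a → a < n → IsSol a → SolProps a)
    × (∀ a b → TLParams a b 1 → FrobCirc (TL a b 1) →
         ∃[ a' ] (a' < n × IsSol a' × (TL a b 1 ≐ TL a' (a' ∸ 1) 1)))

  CondE : Set₁
  CondE = ∀ l → NumPrimeFactors l →
    ∃[ Ss ] (length Ss ≡ 2 ^ (l ∸ 1) × All FrobCirc Ss
      × AllPairs (λ S T → ¬ Iso S T) Ss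
      × (∀ S → FrobCirc S → Any (Iso S) Ss)
      × (∀ S → FrobCirc S → ∃[ a ] (a < n × IsSol a × Iso S (TL a (a ∸ 1) 1))))

-- The point stabiliser of the Frobenius group acts on the kernel ℤ/n as a group U of six
-- units in which u - 1 is regular for u ≠ 1, and the connection set is s U with s a unit.
-- Every u in U satisfies u⁶ = 1, and regularity lets one cancel in u⁶ - 1 =
-- (u - 1)(u + 1)(u² + u + 1)(u² - u + 1); counting roots gives -1 ∈ U and some α ∈ U with
-- α² - α + 1 = 0, so U = {±1, ±α, ±α²}.  Conversely, the differences u - 1 of such a set are
-- images of Eisenstein integers whose norm divides 12, hence units when n ≡ 1 mod 6.
-- Multiplication by -α has order 3 and only the fixed point 0, so m ≡ 1 mod 3 whenever
-- 3 ∤ m and α² - α + 1 ≡ 0 mod m.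
-- For n ≥ 10 the neighbours of a vertex induce exactly a hexagon, so an isomorphism is
-- determined by the images of two consecutive neighbours; propagating along the cycle of
-- vertices 0, 1, 2, … shows that it is affine and that the two solutions agree up to α ↦ 1 - α.
-- The solutions are α + e (1 - 2α) with e idempotent, conjugation being e ↦ 1 - e, and the
-- idempotents correspond to the sets of primes dividing n.
module Submission where

open import Defs
open import Data.Empty using (⊥-elim)
open import Data.Fin using (Fin; zero; suc; toℕ; fromℕ<; #_)
import Data.Fin.Properties as Finₚ
open import Data.Integer as ℤ using (ℤ; +_; -[1+_]; _+_; _*_; _-_; -_; ∣_∣; 0ℤ; 1ℤ; -1ℤ)
import Data.Integer.DivMod as ℤD
import Data.Integer.Properties as ℤₚ
open import Data.Integer.Tactic.RingSolver using (solve-∀)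
open import Data.List using (List; []; _∷_; _++_; length; tabulate; map; replicate; foldr)
open import Data.List.Membership.Propositional using (_∈_; _∉_; lose)
open import Data.List.Membership.Propositional.Properties using (∈-∃++; ∈-tabulate⁺; ∈-tabulate⁻; ∈-map⁺; ∈-map⁻; ∈-++⁺ˡ; ∈-++⁺ʳ)
open import Data.List.Membership.Propositional.Properties.WithK using (unique∧set⇒bag)
open import Data.List.Properties using (length-map; length-tabulate; length-++)
open import Data.List.Relation.Binary.BagAndSetEquality using (∼bag⇒↭)
open import Data.List.Relation.Binary.Permutation.Propositional as ↭ using (_↭_; ↭-sym; ↭-trans; ↭-prep; ↭⇒↭ₛ)
open import Data.List.Relation.Binary.Permutation.Propositional.Properties using (∈-resp-↭; ↭-length; shift)
import Data.List.Relation.Binary.Permutation.Setoid.Properties as ↭ₛ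
open import Data.List.Relation.Unary.All as All using (All; []; _∷_)
import Data.List.Relation.Unary.All.Properties as Allₚ
open import Data.List.Relation.Unary.AllPairs as AllPairs using (AllPairs; []; _∷_)
import Data.List.Relation.Unary.AllPairs.Properties as AllPairsₚ
open import Data.List.Relation.Unary.Any using (Any; here; there)
import Data.List.Relation.Unary.Any.Properties as Anyₚ
import Data.List.Relation.Unary.Unique.DecPropositional as DecUnique
open import Data.List.Relation.Unary.Unique.Propositional using (Unique)
import Data.List.Relation.Unary.Unique.Propositional.Properties as Uniqueₚ
open import Data.Nat as ℕ using (ℕ; zero; suc; _≤_; NonZero; s≤s; z≤n)
open import Data.Nat.Coprimality using (Coprime; coprime-divisor)
import Data.Nat.Divisibility as ℕ∣
import Data.Nat.DivMod as ℕD
open import Data.Nat.DivMod using (_%_; _mod_)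
open import Data.Nat.Primality using (Prime; prime?; euclidsLemma; prime⇒nonZero; prime⇒irreducible; ¬prime[1])
open import Data.Nat.Primality.Factorisation using (factorise; PrimeFactorisation)
import Data.Nat.Properties as ℕₚ
open import Data.Product using (∃-syntax; _×_; _,_; proj₁; proj₂)
open import Data.Product.Properties using (≡-dec)
open import Data.Sum as Sum using (_⊎_; inj₁; inj₂)
open import Function using (_∘_; id; _⇔_; mk⇔; Equivalence)
open import Relation.Binary.Bundles using (Setoid)
open import Relation.Binary.PropositionalEquality using (_≡_; _≢_; _≗_; refl; sym; trans; cong; cong₂; subst; setoid; module ≡-Reasoning)
import Relation.Binary.Reasoning.Setoid
open import Relation.Binary.Structures using (IsEquivalence)
open import Relation.Nullary using (¬_; Dec; yes; no; contradiction)
open import Relation.Nullary.Decidable using (from-yes; _×-dec_; _⊎-dec_; _→-dec_)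

-- For composite n the ring ℤ/n has zero divisors, so a polynomial may have more roots than its
-- degree; a factor of u⁶ - 1 is therefore cancelled only when it is a difference of two elements of
-- U, where regularity applies. Residues are lifted to ℤ, so that a congruence is proved by an
-- explicit linear combination of known congruences, checked as a ring identity. Evaluating
-- Eisenstein integers at α turns facts about the six units into finite tables, and the size of a
-- norm decides which of them survive reduction modulo n. Below 10 only n = 7 remains; there the
-- graph is complete and every bijection is an isomorphism, so the primality of 7 replaces rigidity.
-- In the count one prime p of n is set aside: from each pair e, 1 - e the member not divisible by p
-- is kept, which accounts for the exponent l - 1.

sq+1 : ∀ a → + (a ℕ.* a ℕ.+ 1) ≡ + a * + a + 1ℤ
sq+1 a = cong (_+ 1ℤ) (ℤₚ.pos-* a a)

-- Congruence modulo n on the integers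

module Residues (n : ℕ) ⦃ nz : NonZero n ⦄ where

  infix 4 _≈_
  record _≈_ (x y : ℤ) : Set where
    constructor modulo
    field
      quot : ℤ
      eq   : x - y ≡ quot * + n

  ≡⇒≈ : ∀ {x y} → x ≡ y → x ≈ y
  ≡⇒≈ {x} refl = modulo 0ℤ (ℤₚ.+-inverseʳ x)

  ≈-refl : ∀ {x} → x ≈ x
  ≈-refl = ≡⇒≈ refl

  -- With its variants this is the certificate format for congruences: the cofactors are given by
  -- hand, and what remains is a polynomial identity over ℤ for the ring solver.
  comb₁ : ∀ {x y l r} c → l ≈ r → x - y ≡ c * (l - r) → x ≈ y
  comb₁ {x} {y} {l} {r} c (modulo q eq) e = modulo (c * q) (begin
    x - y         ≡⟨ e ⟩
    c * (l - r)   ≡⟨ cong (c *_) eq ⟩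
    c * (q * + n) ≡⟨ ℤₚ.*-assoc c q (+ n) ⟨
    c * q * + n   ∎)
    where open ≡-Reasoning

  comb₂ : ∀ {x y l r l′ r′} c c′ → l ≈ r → l′ ≈ r′ →
          x - y ≡ c * (l - r) + c′ * (l′ - r′) → x ≈ y
  comb₂ {x} {y} {l} {r} {l′} {r′} c c′ (modulo q eq) (modulo q′ eq′) e =
    modulo (c * q + c′ * q′) (begin
    x - y                             ≡⟨ e ⟩
    c * (l - r) + c′ * (l′ - r′)      ≡⟨ cong₂ (λ u v → c * u + c′ * v) eq eq′ ⟩
    c * (q * + n) + c′ * (q′ * + n)   ≡⟨ lemma c q c′ q′ (+ n) ⟩
    (c * q + c′ * q′) * + n           ∎)
    where
      open ≡-Reasoning
      lemma : ∀ c q c′ q′ n → c * (q * n) + c′ * (q′ * n) ≡ (c * q + c′ * q′) * n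
      lemma = solve-∀

  comb₃ : ∀ {x y l r l′ r′ l″ r″} c c′ c″ → l ≈ r → l′ ≈ r′ → l″ ≈ r″ →
          x - y ≡ c * (l - r) + c′ * (l′ - r′) + c″ * (l″ - r″) → x ≈ y
  comb₃ {l = l} {r} {l′} {r′} {l″} {r″} c c′ c″ p p′ p″ e =
    comb₂ 1ℤ c″ (comb₂ {x = c * (l - r) + c′ * (l′ - r′)} {y = 0ℤ} c c′ p p′ (ℤₚ.+-identityʳ _)) p″
      (trans e (lemma (c * (l - r) + c′ * (l′ - r′)) (c″ * (l″ - r″))))
    where
      lemma : ∀ a b → a + b ≡ 1ℤ * (a - 0ℤ) + b
      lemma = solve-∀

  ≈-sym : ∀ {x y} → x ≈ y → y ≈ x
  ≈-sym {x} {y} p = comb₁ (- 1ℤ) p (lemma x y)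
    where
      lemma : ∀ x y → y - x ≡ - 1ℤ * (x - y)
      lemma = solve-∀

  ≈-trans : ∀ {x y z} → x ≈ y → y ≈ z → x ≈ z
  ≈-trans {x} {y} {z} p q = comb₂ 1ℤ 1ℤ p q (lemma x y z)
    where
      lemma : ∀ x y z → x - z ≡ 1ℤ * (x - y) + 1ℤ * (y - z)
      lemma = solve-∀

  ≈-isEquivalence : IsEquivalence _≈_
  ≈-isEquivalence = record { refl = ≈-refl ; sym = ≈-sym ; trans = ≈-trans }

  ≈-setoid : Setoid _ _
  ≈-setoid = record { isEquivalence = ≈-isEquivalence }

  module ≈-Reasoning = Relation.Binary.Reasoning.Setoid ≈-setoid

  +-cong : ∀ {x y u v} → x ≈ y → u ≈ v → x + u ≈ y + v
  +-cong {x} {y} {u} {v} p q = comb₂ 1ℤ 1ℤ p q (lemma x y u v)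
    where
      lemma : ∀ x y u v → x + u - (y + v) ≡ 1ℤ * (x - y) + 1ℤ * (u - v)
      lemma = solve-∀

  *-cong : ∀ {x y u v} → x ≈ y → u ≈ v → x * u ≈ y * v
  *-cong {x} {y} {u} {v} p q = comb₂ u y p q (lemma x y u v)
    where
      lemma : ∀ x y u v → x * u - y * v ≡ u * (x - y) + y * (u - v)
      lemma = solve-∀

  neg-cong : ∀ {x y} → x ≈ y → - x ≈ - y
  neg-cong {x} {y} p = comb₁ (- 1ℤ) p (lemma x y)
    where
      lemma : ∀ x y → - x - - y ≡ - 1ℤ * (x - y)
      lemma = solve-∀

  +-congˡ : ∀ x {u v} → u ≈ v → x + u ≈ x + v
  +-congˡ x = +-cong (≈-refl {x})

  *-congˡ : ∀ x {u v} → u ≈ v → x * u ≈ x * v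
  *-congˡ x = *-cong (≈-refl {x})

  *-congʳ : ∀ x {u v} → u ≈ v → u * x ≈ v * x
  *-congʳ x p = *-cong p (≈-refl {x})

  ≈⇒∣ : ∀ {x y} → x ≈ y → n ℕ∣.∣ ∣ x - y ∣
  ≈⇒∣ {x} {y} (modulo q eq) = ℕ∣.divides ∣ q ∣ (trans (cong ∣_∣ eq) (ℤₚ.abs-* q (+ n)))

  ∣⇒≈ : ∀ {x y} → n ℕ∣.∣ ∣ x - y ∣ → x ≈ y
  ∣⇒≈ {x} {y} (ℕ∣.divides k eq) with x - y in xy≡
  ... | + m      = modulo (+ k) (trans xy≡ (trans (cong +_ eq) (ℤₚ.pos-* k n)))
  ... | -[1+ m ] = modulo (- (+ k)) (trans xy≡ (trans (cong (λ z → - (+ z)) eq)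
                     (trans (cong -_ (ℤₚ.pos-* k n)) (ℤₚ.neg-distribˡ-* (+ k) (+ n)))))

  ≈0⇒∣ : ∀ {m} → + m ≈ 0ℤ → n ℕ∣.∣ m
  ≈0⇒∣ {m} p = subst (n ℕ∣.∣_) (cong ∣_∣ (ℤₚ.+-identityʳ (+ m))) (≈⇒∣ p)

  ∣⇒≈0 : ∀ {m} → n ℕ∣.∣ m → + m ≈ 0ℤ
  ∣⇒≈0 {m} p = ∣⇒≈ (subst (n ℕ∣.∣_) (sym (cong ∣_∣ (ℤₚ.+-identityʳ (+ m)))) p)

  n≈0 : + n ≈ 0ℤ
  n≈0 = ∣⇒≈0 ℕ∣.∣-refl

  %-≈ : ∀ m → + (m % n) ≈ + m
  %-≈ m = ≈-sym (modulo (+ (m ℕD./ n)) (begin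
    + m - + (m % n)                                       ≡⟨ cong (λ z → + z - + (m % n)) (ℕD.m≡m%n+[m/n]*n m n) ⟩
    + (m % n ℕ.+ (m ℕD./ n) ℕ.* n) - + (m % n)            ≡⟨ cong (λ z → + (m % n) + z - + (m % n)) (ℤₚ.pos-* (m ℕD./ n) n) ⟩
    + (m % n) + + (m ℕD./ n) * + n - + (m % n)            ≡⟨ lemma (+ (m % n)) (+ (m ℕD./ n) * + n) ⟩
    + (m ℕD./ n) * + n                                    ∎))
    where
      open ≡-Reasoning
      lemma : ∀ a b → a + b - a ≡ b
      lemma = solve-∀

  small-≈⇒≡ : ∀ {a b} → a ℕ.< n → b ℕ.< n → + a ≈ + b → a ≡ b
  small-≈⇒≡ {a} {b} a<n b<n p = ℤₚ.+-injective (ℤₚ.i-j≡0⇒i≡j (+ a) (+ b)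
      (ℤₚ.∣i∣≡0⇒i≡0 (multiple-below ∣a-b∣<n (≈⇒∣ p))))
    where
      ∣a-b∣<n : ∣ + a - + b ∣ ℕ.< n
      ∣a-b∣<n = ℕₚ.≤-<-trans
        (subst (λ z → ∣ z ∣ ℕ.≤ a ℕ.⊔ b) (sym (ℤₚ.m-n≡m⊖n a b)) (ℤₚ.∣m⊝n∣≤m⊔n a b))
        (ℕₚ.⊔-pres-<m a<n b<n)
      multiple-below : ∀ {m} → m ℕ.< n → n ℕ∣.∣ m → m ≡ 0
      multiple-below {zero}  _   _   = refl
      multiple-below {suc m} m<n n∣m = contradiction n∣m (ℕ∣.>⇒∤ m<n)

  %⇒≈ : ∀ {a b} → a % n ≡ b % n → + a ≈ + b
  %⇒≈ {a} {b} e = ≈-trans (≈-sym (%-≈ a)) (≈-trans (≡⇒≈ (cong +_ e)) (%-≈ b))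

  ≈⇒% : ∀ {a b} → + a ≈ + b → a % n ≡ b % n
  ≈⇒% {a} {b} p = small-≈⇒≡ (ℕD.m%n<n a n) (ℕD.m%n<n b n)
    (≈-trans (%-≈ a) (≈-trans p (≈-sym (%-≈ b))))

  ι : Fin n → ℤ
  ι x = + toℕ x

  ι-injective : ∀ {x y} → ι x ≈ ι y → x ≡ y
  ι-injective {x} {y} p = Finₚ.toℕ-injective (small-≈⇒≡ (Finₚ.toℕ<n x) (Finₚ.toℕ<n y) p)

  ι-cong : ∀ {x y} → x ≡ y → ι x ≈ ι y
  ι-cong e = ≡⇒≈ (cong ι e)

  abstract
    -- Opaque on purpose: later proofs use it only through `ι-ρ`, and integer division is never
    -- unfolded during type checking.
    ρ : ℤ → Fin n
    ρ z = fromℕ< (ℤD.n%ℕd<d z n)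

    ι-ρ : ∀ z → ι (ρ z) ≈ z
    ι-ρ z = ≈-sym (modulo (z ℤD./ℕ n) (begin
      z - ι (ρ z)                         ≡⟨ cong (λ m → z - + m) (Finₚ.toℕ-fromℕ< (ℤD.n%ℕd<d z n)) ⟩
      z - + (z ℤD.%ℕ n)                   ≡⟨ cong (_- + (z ℤD.%ℕ n)) (ℤD.a≡a%ℕn+[a/ℕn]*n z n) ⟩
      + (z ℤD.%ℕ n) + (z ℤD./ℕ n) * + n - + (z ℤD.%ℕ n)  ≡⟨ lemma (+ (z ℤD.%ℕ n)) ((z ℤD./ℕ n) * + n) ⟩
      (z ℤD./ℕ n) * + n                   ∎))
      where
        open ≡-Reasoning
        lemma : ∀ a b → a + b - a ≡ b
        lemma = solve-∀

  ρ-cong : ∀ {y z} → y ≈ z → ρ y ≡ ρ z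
  ρ-cong {y} {z} p = ι-injective (≈-trans (ι-ρ y) (≈-trans p (≈-sym (ι-ρ z))))

  ρ-ι : ∀ x → ρ (ι x) ≡ x
  ρ-ι x = ι-injective (ι-ρ (ι x))

  ι-mod : ∀ m → ι (m mod n) ≈ + m
  ι-mod m = ≈-trans (≡⇒≈ (cong +_ (Finₚ.toℕ-fromℕ< (ℕD.m%n<n m n)))) (%-≈ m)

  ≈⇒≡mod : ∀ {x m} → ι x ≈ + m → x ≡ [_] n m
  ≈⇒≡mod {x} {m} p = ι-injective (≈-trans p (≈-sym (ι-mod m)))

  ι-⊕ : ∀ x y → ι (_⊕_ n x y) ≈ ι x + ι y
  ι-⊕ x y = ι-mod _

  ι-⊗ : ∀ x y → ι (_⊗_ n x y) ≈ ι x * ι y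
  ι-⊗ x y = ≈-trans (ι-mod _) (≡⇒≈ (ℤₚ.pos-* (toℕ x) (toℕ y)))

  pos-∸ : ∀ {m k} → k ℕ.≤ m → + (m ℕ.∸ k) ≡ + m - + k
  pos-∸ {m} {k} k≤m = trans (sym (ℤₚ.⊖-≥ k≤m)) (sym (ℤₚ.m-n≡m⊖n m k))

  n∸-≈ : ∀ {k} → k ℕ.≤ n → + (n ℕ.∸ k) ≈ - + k
  n∸-≈ {k} k≤n = ≈-trans (≡⇒≈ (pos-∸ k≤n)) (comb₁ 1ℤ n≈0 (lemma (+ n) (+ k)))
    where
      lemma : ∀ a b → a - b - - b ≡ 1ℤ * (a - 0ℤ)
      lemma = solve-∀

  ι-⊖ : ∀ x → ι (⊖_ n x) ≈ - ι x
  ι-⊖ x = ≈-trans (ι-mod _) (n∸-≈ (ℕₚ.<⇒≤ (Finₚ.toℕ<n x)))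

  ι-diff : ∀ x y → ι (_⊕_ n x (⊖_ n y)) ≈ ι x - ι y
  ι-diff x y = ≈-trans (ι-⊕ x (⊖_ n y)) (+-congˡ (ι x) (ι-⊖ y))

  cancel : ∀ {u v x y} → u * v ≈ 1ℤ → u * x ≈ u * y → x ≈ y
  cancel {u} {v} {x} {y} uv p = comb₂ v (y - x) p uv (lemma u v x y)
    where
      lemma : ∀ u v x y → x - y ≡ v * (u * x - u * y) + (y - x) * (u * v - 1ℤ)
      lemma = solve-∀

  infix 4 _≉_
  _≉_ : ℤ → ℤ → Set
  x ≉ y = ¬ (x ≈ y)

  IsRoot : ℤ → Set
  IsRoot x = x * x - x + 1ℤ ≈ 0ℤ

  IsSol⇒IsRoot : ∀ {a} → IsSol n a → IsRoot (+ a)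
  IsSol⇒IsRoot {a} s = comb₁ 1ℤ (≈-trans (≡⇒≈ (sym (sq+1 a))) (%⇒≈ s)) (lemma (+ a))
    where
      lemma : ∀ a → a * a - a + 1ℤ - 0ℤ ≡ 1ℤ * (a * a + 1ℤ - a)
      lemma = solve-∀

  IsRoot⇒IsSol : ∀ {a} → IsRoot (+ a) → IsSol n a
  IsRoot⇒IsSol {a} r = ≈⇒% (≈-trans (≡⇒≈ (sq+1 a)) (comb₁ 1ℤ r (lemma (+ a))))
    where
      lemma : ∀ a → a * a + 1ℤ - a ≡ 1ℤ * (a * a - a + 1ℤ - 0ℤ)
      lemma = solve-∀

  IsRoot-resp : ∀ {x y} → x ≈ y → IsRoot x → IsRoot y
  IsRoot-resp {x} {y} p r = comb₂ (1ℤ - x - y) 1ℤ p r (lemma x y)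
    where
      lemma : ∀ x y → y * y - y + 1ℤ - 0ℤ ≡ (1ℤ - x - y) * (x - y) + 1ℤ * (x * x - x + 1ℤ - 0ℤ)
      lemma = solve-∀

  1-IsRoot : ∀ {x} → IsRoot x → IsRoot (1ℤ - x)
  1-IsRoot {x} r = comb₁ 1ℤ r (lemma x)
    where
      lemma : ∀ x → (1ℤ - x) * (1ℤ - x) - (1ℤ - x) + 1ℤ - 0ℤ ≡ 1ℤ * (x * x - x + 1ℤ - 0ℤ)
      lemma = solve-∀

-- Eisenstein integers and tables for their six units

-- (c , d) stands for c + d ω with ω² = ω - 1.
Eisenstein : Set
Eisenstein = ℤ × ℤ

norm : Eisenstein → ℤ
norm (c , d) = c * c + c * d + d * d

conjugate : Eisenstein → Eisenstein
conjugate (c , d) = c + d , - d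

infixl 7 _·_
_·_ : Eisenstein → Eisenstein → Eisenstein
(c , d) · (c′ , d′) = c * c′ - d * d′ , c * d′ + d * c′ + d * d′

infixl 6 _∖_
_∖_ : Eisenstein → Eisenstein → Eisenstein
(c , d) ∖ (c′ , d′) = c - c′ , d - d′

-- unit k is ω ^ k.
unit : Fin 6 → Eisenstein
unit zero                              = 1ℤ , 0ℤ
unit (suc zero)                        = 0ℤ , 1ℤ
unit (suc (suc zero))                  = -1ℤ , 1ℤ
unit (suc (suc (suc zero)))            = -1ℤ , 0ℤ
unit (suc (suc (suc (suc zero))))      = 0ℤ , -1ℤ
unit (suc (suc (suc (suc (suc zero))))) = 1ℤ , -1ℤ

_≟ᴱ_ : (p q : Eisenstein) → Dec (p ≡ q)
_≟ᴱ_ = ≡-dec ℤ._≟_ ℤ._≟_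

abstract
  unit-·-table : ∀ i j → ∃[ k ] unit i · unit j ≡ unit k
  unit-·-table = from-yes (Finₚ.all? λ i → Finₚ.all? λ j → Finₚ.any? λ k → (unit i · unit j) ≟ᴱ unit k)

abstract
  unit-inverse-table : ∀ i → ∃[ j ] unit i · unit j ≡ unit zero
  unit-inverse-table = from-yes (Finₚ.all? λ i → Finₚ.any? λ j → (unit i · unit j) ≟ᴱ unit zero)

abstract
  unit-conjugate-table : ∀ i → ∃[ j ] conjugate (unit i) ≡ unit j
  unit-conjugate-table = from-yes (Finₚ.all? λ i → Finₚ.any? λ j → conjugate (unit i) ≟ᴱ unit j)

-- For b ≤ n these bounds prevent n from dividing the norm, so that p cannot vanish at a root modulo
-- n.
Within : ℕ → Eisenstein → Set
Within b p = 1 ℕ.≤ ∣ norm p ∣ × ∣ norm p ∣ ℕ.< b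

within? : ∀ b p → Dec (Within b p)
within? b p = (1 ℕ.≤? ∣ norm p ∣) ×-dec (∣ norm p ∣ ℕ.<? b)

abstract
  unit-∖-table : ∀ i j → i ≡ j ⊎ Within 7 (unit i ∖ unit j)
  unit-∖-table = from-yes (Finₚ.all? λ i → Finₚ.all? λ j → (i Finₚ.≟ j) ⊎-dec within? 7 (unit i ∖ unit j))

abstract
  -- The norms of ω ^ k - 1 for k = 1, ..., 5 are 1, 3, 4, 3, 1, with least common multiple 12; the
  -- cofactor is thus at most 12.
  unit-1-norm-table : ∀ i → i ≡ zero ⊎ ∃[ m ] norm (unit i ∖ unit zero) * + toℕ {13} m ≡ + 12
  unit-1-norm-table = from-yes (Finₚ.all? λ i → (i Finₚ.≟ zero) ⊎-dec
    Finₚ.any? λ m → (norm (unit i ∖ unit zero) * + toℕ {13} m) ℤ.≟ + 12)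

abstract
  -- The largest norm is 9, attained by -1 - 1 - 1 = -3; hence the bound 10. The exceptional i are
  -- those for which ω ^ i - 1 is itself a unit.
  hexagon-table : ∀ i j → Within 10 ((unit i ∖ unit zero) ∖ unit j) ⊎ (i ≡ # 1 ⊎ i ≡ # 5)
  hexagon-table = from-yes (Finₚ.all? λ i → Finₚ.all? λ j →
    within? 10 ((unit i ∖ unit zero) ∖ unit j) ⊎-dec ((i Finₚ.≟ # 1) ⊎-dec (i Finₚ.≟ # 5)))

ev : ℤ → Eisenstein → ℤ
ev α (c , d) = c + d * α

ev-∖ : ∀ α p q → ev α (p ∖ q) ≡ ev α p - ev α q
ev-∖ α (c , d) (c′ , d′) = lemma α c d c′ d′
  where
    lemma : ∀ α c d c′ d′ → c - c′ + (d - d′) * α ≡ c + d * α - (c′ + d′ * α)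
    lemma = solve-∀

ev-conjugate : ∀ α p → ev (1ℤ - α) p ≡ ev α (conjugate p)
ev-conjugate α (c , d) = lemma α c d
  where
    lemma : ∀ α c d → c + d * (1ℤ - α) ≡ c + d + - d * α
    lemma = solve-∀

ev-1 : ∀ α → 1ℤ ≡ ev α (unit (# 0))
ev-1 = lemma
  where
    lemma : ∀ α → 1ℤ ≡ 1ℤ + 0ℤ * α
    lemma = solve-∀

ev-α : ∀ α → α ≡ ev α (unit (# 1))
ev-α = lemma
  where
    lemma : ∀ α → α ≡ 0ℤ + 1ℤ * α
    lemma = solve-∀

ev-α-1 : ∀ α → α - 1ℤ ≡ ev α (unit (# 2))
ev-α-1 = lemma
  where
    lemma : ∀ α → α - 1ℤ ≡ -1ℤ + 1ℤ * α
    lemma = solve-∀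

ev--1 : ∀ α → - 1ℤ ≡ ev α (unit (# 3))
ev--1 = lemma
  where
    lemma : ∀ α → -1ℤ ≡ -1ℤ + 0ℤ * α
    lemma = solve-∀

ev--α : ∀ α → - α ≡ ev α (unit (# 4))
ev--α = lemma
  where
    lemma : ∀ α → - α ≡ 0ℤ + -1ℤ * α
    lemma = solve-∀

ev-1-α : ∀ α → - (α - 1ℤ) ≡ ev α (unit (# 5))
ev-1-α = lemma
  where
    lemma : ∀ α → - (α - 1ℤ) ≡ 1ℤ + -1ℤ * α
    lemma = solve-∀

-- The six units at a root of x² - x + 1 modulo n

module Units (n : ℕ) ⦃ nz : NonZero n ⦄ where
  open Residues n

  -- Naming an element by its exponent in `Fin 6` turns products, inverses and conjugates into table
  -- lookups.
  Six : ℤ → ℤ → Set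
  Six α z = ∃[ k ] z ≈ ev α (unit k)

  Six-unit : ∀ α k → Six α (ev α (unit k))
  Six-unit α k = k , ≈-refl

  Six-resp : ∀ {α y z} → y ≈ z → Six α y → Six α z
  Six-resp p (k , e) = k , ≈-trans (≈-sym p) e

  ev-cong : ∀ {α β} p → α ≈ β → ev α p ≈ ev β p
  ev-cong (c , d) e = +-congˡ c (*-congˡ d e)

  Six-cong : ∀ {α β z} → α ≈ β → Six α z → Six β z
  Six-cong e (k , p) = k , ≈-trans p (ev-cong (unit k) e)

  -- Conjugation permutes the units, so α and 1 - α span the same six residues; this is why
  -- conjugate solutions give the same graph.
  Six-conjugate : ∀ {α z} → Six (1ℤ - α) z → Six α z
  Six-conjugate {α} (k , e) = let j , c = unit-conjugate-table k in
    j , ≈-trans e (≡⇒≈ (trans (ev-conjugate α (unit k)) (cong (ev α) c)))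

  Six-unconjugate : ∀ {α z} → Six α z → Six (1ℤ - α) z
  Six-unconjugate {α} s = Six-conjugate (Six-cong (≡⇒≈ (lemma α)) s)
    where
      lemma : ∀ α → α ≡ 1ℤ - (1ℤ - α)
      lemma = solve-∀

  Six-1 : ∀ {α} → Six α 1ℤ
  Six-1 {α} = # 0 , ≡⇒≈ (ev-1 α)

  Six-α : ∀ {α} → Six α α
  Six-α {α} = # 1 , ≡⇒≈ (ev-α α)

  Six--1 : ∀ {α} → Six α -1ℤ
  Six--1 {α} = # 3 , ≡⇒≈ (ev--1 α)

  module Root {α : ℤ} (root : IsRoot α) where

    -- Replacing ω² by ω - 1 costs a multiple of α² - α + 1, namely d d′ times it: evaluation at a
    -- root is a ring homomorphism.
    ev-· : ∀ p q → ev α p * ev α q ≈ ev α (p · q)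
    ev-· (c , d) (c′ , d′) = comb₁ (d * d′) root (lemma α c d c′ d′)
      where
        lemma : ∀ α c d c′ d′ → (c + d * α) * (c′ + d′ * α) - (c * c′ - d * d′ + (c * d′ + d * c′ + d * d′) * α)
              ≡ d * d′ * (α * α - α + 1ℤ - 0ℤ)
        lemma = solve-∀

    ev-norm : ∀ p → ev α p * ev α (conjugate p) ≈ norm p
    ev-norm (c , d) = comb₁ (- (d * d)) root (lemma α c d)
      where
        lemma : ∀ α c d → (c + d * α) * (c + d + - d * α) - (c * c + c * d + d * d)
              ≡ - (d * d) * (α * α - α + 1ℤ - 0ℤ)
        lemma = solve-∀

    Six-* : ∀ {y z} → Six α y → Six α z → Six α (y * z)
    Six-* (i , e) (j , f) = let k , t = unit-·-table i j in
      k , ≈-trans (*-cong e f) (≈-trans (ev-· (unit i) (unit j)) (≡⇒≈ (cong (ev α) t)))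

    Six-neg : ∀ {z} → Six α z → Six α (- z)
    Six-neg {z} s = Six-resp (≡⇒≈ (ℤₚ.-1*i≡-i z)) (Six-* Six--1 s)

    abstract
      Six-inverse : ∀ {z} → Six α z → ∃[ w ] Six α w × z * w ≈ 1ℤ
      Six-inverse (i , e) = let j , t = unit-inverse-table i in
        ev α (unit j) , Six-unit α j ,
        ≈-trans (*-congʳ _ e) (≈-trans (ev-· (unit i) (unit j)) (≈-trans (≡⇒≈ (cong (ev α) t)) (≈-sym (proj₂ (Six-1 {α})))))

    -- If p vanished at α, so would its product with its conjugate, and n would divide a non-zero
    -- norm smaller than n.
    ev≉0 : ∀ {b} → b ℕ.≤ n → ∀ p → Within b p → ev α p ≉ 0ℤ
    ev≉0 b≤n p (1≤N , N<b) e = ℕ∣.>⇒∤ ⦃ ℕ.>-nonZero 1≤N ⦄ (ℕₚ.<-≤-trans N<b b≤n)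
      (subst (n ℕ∣.∣_) (cong ∣_∣ (ℤₚ.+-identityʳ (norm p)))
        (≈⇒∣ (≈-trans (≈-sym (ev-norm p)) (*-congʳ (ev α (conjugate p)) e))))

    unit-injective : 7 ℕ.≤ n → ∀ i j → ev α (unit i) ≈ ev α (unit j) → i ≡ j
    unit-injective 7≤n i j e with unit-∖-table i j
    ... | inj₁ i≡j = i≡j
    ... | inj₂ w   = contradiction
      (≈-trans (≡⇒≈ (ev-∖ α (unit i) (unit j))) (comb₁ 1ℤ e (lemma (ev α (unit i)) (ev α (unit j)))))
      (ev≉0 7≤n (unit i ∖ unit j) w)
      where
        lemma : ∀ x y → x - y - 0ℤ ≡ 1ℤ * (x - y)
        lemma = solve-∀

    Six-^ : ∀ {z} → Six α z → ∀ i → Six α (z ℤ.^ i)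
    Six-^ s zero    = Six-1
    Six-^ s (suc i) = Six-* s (Six-^ s i)

    -- `unit k` is the remainder of x ^ k on division by x² - x + 1; the coefficients given to
    -- `comb₁` are the quotients up to sign.
    unit≈^ : ∀ k → ev α (unit k) ≈ α ℤ.^ toℕ k
    unit≈^ zero = ≡⇒≈ (sym (ev-1 α))
    unit≈^ (suc zero) = ≡⇒≈ (lemma α)
      where
        lemma : ∀ α → 0ℤ + 1ℤ * α ≡ α * 1ℤ
        lemma = solve-∀
    unit≈^ (suc (suc zero)) = comb₁ -1ℤ root (lemma α)
      where
        lemma : ∀ α → -1ℤ + 1ℤ * α - α * (α * 1ℤ) ≡ -1ℤ * (α * α - α + 1ℤ - 0ℤ)
        lemma = solve-∀
    unit≈^ (suc (suc (suc zero))) = comb₁ (- α - 1ℤ) root (lemma α)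
      where
        lemma : ∀ α → -1ℤ + 0ℤ * α - α * (α * (α * 1ℤ)) ≡ (- α - 1ℤ) * (α * α - α + 1ℤ - 0ℤ)
        lemma = solve-∀
    unit≈^ (suc (suc (suc (suc zero)))) = comb₁ (- (α * α) - α) root (lemma α)
      where
        lemma : ∀ α → 0ℤ + -1ℤ * α - α * (α * (α * (α * 1ℤ))) ≡ (- (α * α) - α) * (α * α - α + 1ℤ - 0ℤ)
        lemma = solve-∀
    unit≈^ (suc (suc (suc (suc (suc zero))))) = comb₁ (1ℤ - α * (α * α) - α * α) root (lemma α)
      where
        lemma : ∀ α → 1ℤ + -1ℤ * α - α * (α * (α * (α * (α * 1ℤ)))) ≡ (1ℤ - α * (α * α) - α * α) * (α * α - α + 1ℤ - 0ℤ)
        lemma = solve-∀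

    Six-1-invertible : ∀ {t} → + 12 * t ≈ 1ℤ → ∀ {z} → Six α z → z ≈ 1ℤ ⊎ ∃[ w ] (z - 1ℤ) * w ≈ 1ℤ
    Six-1-invertible {t} 12t {z} (k , e) with unit-1-norm-table k
    ... | inj₁ refl    = inj₁ (≈-trans e (≈-sym (proj₂ (Six-1 {α}))))
    -- Here δ δ̄ is the norm, the norm times μ is 12, and t inverts 12.
    ... | inj₂ (m , N) = inj₂ (δ̄ * (μ * t) , (begin
      (z - 1ℤ) * (δ̄ * (μ * t))      ≈⟨ *-congʳ (δ̄ * (μ * t)) z-1≈δ ⟩
      δ * (δ̄ * (μ * t))             ≡⟨ ℤₚ.*-assoc δ δ̄ (μ * t) ⟨
      δ * δ̄ * (μ * t)               ≈⟨ *-congʳ (μ * t) (ev-norm p) ⟩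
      norm p * (μ * t)              ≡⟨ ℤₚ.*-assoc (norm p) μ t ⟨
      norm p * μ * t                ≡⟨ cong (_* t) N ⟩
      + 12 * t                      ≈⟨ 12t ⟩
      1ℤ                            ∎))
      where
        open ≈-Reasoning
        p = unit k ∖ unit zero
        μ = + toℕ m
        δ = ev α p
        δ̄ = ev α (conjugate p)
        z-1≈δ : z - 1ℤ ≈ δ
        z-1≈δ = ≈-trans (+-cong e (neg-cong (proj₂ (Six-1 {α})))) (≡⇒≈ (sym (ev-∖ α (unit k) (unit zero))))

    -- In graph terms z is a common neighbour of the adjacent vertices 0 and 1, and there are no
    -- more than two of these.
    hexagon₁ : 10 ℕ.≤ n → ∀ {z} → Six α z → Six α (z - 1ℤ) → z ≈ α ⊎ z ≈ 1ℤ - α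
    hexagon₁ 10≤n {z} (i , e) (j , f) with hexagon-table i j
    ... | inj₂ (inj₁ refl) = inj₁ (≈-trans e (≡⇒≈ (sym (ev-α α))))
    ... | inj₂ (inj₂ refl) = inj₂ (≈-trans e (≡⇒≈ (lemma₅ α)))
      where
        lemma₅ : ∀ α → 1ℤ + -1ℤ * α ≡ 1ℤ - α
        lemma₅ = solve-∀
    ... | inj₁ w = contradiction
      (≈-trans (≡⇒≈ (trans (ev-∖ α (unit i ∖ unit zero) (unit j)) (cong (_- ev α (unit j)) (ev-∖ α (unit i) (unit zero)))))
        (comb₃ {x = ev α (unit i) - ev α (unit zero) - ev α (unit j)} -1ℤ 1ℤ 1ℤ e f (proj₂ (Six-1 {α}))
          (lemma z (ev α (unit i)) (ev α (unit zero)) (ev α (unit j)))))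
      (ev≉0 10≤n ((unit i ∖ unit zero) ∖ unit j) w)
      where
        lemma : ∀ z x o y → x - o - y - 0ℤ ≡ -1ℤ * (z - x) + 1ℤ * (z - 1ℤ - y) + 1ℤ * (1ℤ - o)
        lemma = solve-∀

    -- Multiplication by the inverse of u, which preserves adjacency, moves the edge from 0 to u
    -- onto the edge from 0 to 1.
    hexagon : 10 ℕ.≤ n → ∀ {u z} → Six α u → Six α z → Six α (z - u) → z ≈ u * α ⊎ z ≈ u * (1ℤ - α)
    hexagon 10≤n {u} {z} su sz s =
      let w , sw , uw = Six-inverse su
          scaled = hexagon₁ 10≤n (Six-* sw sz) (Six-resp (comb₁ -1ℤ uw (shifted w z u)) (Six-* sw s))
      in Sum.map (unscale w uw) (unscale w uw) scaled
      where
        shifted : ∀ w z u → w * (z - u) - (w * z - 1ℤ) ≡ -1ℤ * (u * w - 1ℤ)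
        shifted = solve-∀
        lemma : ∀ w z u y → z - u * y ≡ - z * (u * w - 1ℤ) + u * (w * z - y)
        lemma = solve-∀
        unscale : ∀ w → u * w ≈ 1ℤ → ∀ {y} → w * z ≈ y → z ≈ u * y
        unscale w uw {y} e = comb₂ (- z) u uw e (lemma w z u y)

  module _ {a : ℕ} (1≤a : 1 ℕ.≤ a) (root : IsRoot (+ a)) where
    private
      α = + a
      +a∸1 : + (a ℕ.∸ 1) ≡ α - 1ℤ
      +a∸1 = pos-∸ 1≤a

    TL⇒Six : ∀ {x} → TL n a (a ℕ.∸ 1) 1 x → Six α (ι x)
    TL⇒Six (inj₁ refl) = # 1 , ≈-trans (ι-mod a) (≡⇒≈ (ev-α α))
    TL⇒Six (inj₂ (inj₁ refl)) = # 4 , ≈-trans (ι-⊖ _) (≈-trans (neg-cong (ι-mod a)) (≡⇒≈ (ev--α α)))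
    TL⇒Six (inj₂ (inj₂ (inj₁ refl))) = # 2 , ≈-trans (ι-mod _) (≡⇒≈ (trans +a∸1 (ev-α-1 α)))
    TL⇒Six (inj₂ (inj₂ (inj₂ (inj₁ refl)))) = # 5 , ≈-trans (ι-⊖ _)
      (≈-trans (neg-cong (ι-mod _)) (≡⇒≈ (trans (cong -_ +a∸1) (ev-1-α α))))
    TL⇒Six (inj₂ (inj₂ (inj₂ (inj₂ (inj₁ refl))))) = # 0 , ≈-trans (ι-mod 1) (≡⇒≈ (ev-1 α))
    TL⇒Six (inj₂ (inj₂ (inj₂ (inj₂ (inj₂ refl))))) = # 3 , ≈-trans (ι-⊖ _) (≈-trans (neg-cong (ι-mod 1)) (≡⇒≈ (ev--1 α)))

    Six⇒TL : ∀ {x} → Six α (ι x) → TL n a (a ℕ.∸ 1) 1 x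
    Six⇒TL (k , e) = case-k k e
      where
        by-≈ : ∀ {x m z} → ι x ≈ z → + m ≡ z → x ≡ [_] n m
        by-≈ e eq = ≈⇒≡mod (≈-trans e (≡⇒≈ (sym eq)))
        by-≈- : ∀ {x m z} → ι x ≈ z → - + m ≡ z → x ≡ ⊖_ n ([_] n m)
        by-≈- {m = m} e eq = ι-injective (≈-trans e
          (≈-trans (≡⇒≈ (sym eq)) (≈-trans (neg-cong (≈-sym (ι-mod m))) (≈-sym (ι-⊖ _)))))
        case-k : ∀ {x} k → ι x ≈ ev α (unit k) → TL n a (a ℕ.∸ 1) 1 x
        case-k zero e = inj₂ (inj₂ (inj₂ (inj₂ (inj₁ (by-≈ e (ev-1 α))))))
        case-k (suc zero) e = inj₁ (by-≈ e (ev-α α))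
        case-k (suc (suc zero)) e = inj₂ (inj₂ (inj₁ (by-≈ e (trans +a∸1 (ev-α-1 α)))))
        case-k (suc (suc (suc zero))) e = inj₂ (inj₂ (inj₂ (inj₂ (inj₂ (by-≈- e (ev--1 α))))))
        case-k (suc (suc (suc (suc zero)))) e = inj₂ (inj₁ (by-≈- e (ev--α α)))
        case-k (suc (suc (suc (suc (suc zero))))) e = inj₂ (inj₂ (inj₂ (inj₁ (by-≈- e (trans (cong -_ +a∸1) (ev-1-α α))))))

-- Orbits of length three and the residue of n modulo 6

module _ {A : Set} where

  Unique-resp-↭ : ∀ {xs ys : List A} → xs ↭ ys → Unique xs → Unique ys
  Unique-resp-↭ p = ↭ₛ.Unique-resp-↭ (setoid A) (↭⇒↭ₛ p)

  extract : ∀ {x : A} {xs} → x ∈ xs → ∃[ ys ] xs ↭ x ∷ ys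
  extract {x} x∈xs with ∈-∃++ x∈xs
  ... | ys , zs , refl = ys ++ zs , shift x ys zs

  unique-head : ∀ {x : A} {xs} → Unique (x ∷ xs) → x ∉ xs
  unique-head = Uniqueₚ.Unique[x∷xs]⇒x∉xs

  ∈-tail : ∀ {x y : A} {xs} → x ∈ y ∷ xs → x ≢ y → x ∈ xs
  ∈-tail (here x≡y)  x≢y = contradiction x≡y x≢y
  ∈-tail (there x∈xs) _  = x∈xs

  module _ (f : A → A) where

    -- Since f³ is the identity and no point is fixed, every orbit has exactly three elements; the
    -- orbits are removed one at a time.
    order3⇒3∣length : ∀ xs → Unique xs → (∀ {x} → x ∈ xs → f x ∈ xs) →
      (∀ {x} → x ∈ xs → f (f (f x)) ≡ x) → (∀ {x} → x ∈ xs → f x ≢ x) → 3 ℕ∣.∣ length xs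
    order3⇒3∣length xs = go (length xs) xs ℕₚ.≤-refl
      where
        -- What is left after removing an orbit is a rearranged sublist, not a structural one, so
        -- the recursion runs on a bound b for the length.
        go : ∀ b xs → length xs ℕ.≤ b → Unique xs → (∀ {x} → x ∈ xs → f x ∈ xs) →
          (∀ {x} → x ∈ xs → f (f (f x)) ≡ x) → (∀ {x} → x ∈ xs → f x ≢ x) → 3 ℕ∣.∣ length xs
        go _ [] _ _ _ _ _ = 3 ℕ∣.∣0
        go (suc b) (x ∷ ys) (s≤s len) u closed cube free =
          subst (3 ℕ∣.∣_) (sym len≡) (ℕ∣.∣m∣n⇒∣m+n (ℕ∣.∣-refl {3}) (go b ws ws≤b u-ws closed′ (cube ∘ ws⊆) (free ∘ ws⊆)))
          where
            x∈ = here {x = x} {xs = ys} refl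
            fx∈ys = ∈-tail (closed x∈) (free x∈)
            zs = proj₁ (extract fx∈ys)
            ys↭ = proj₂ (extract fx∈ys)
            ffx≢x : f (f x) ≢ x
            ffx≢x e = free x∈ (trans (sym (cong f e)) (cube x∈))
            ffx∈zs = ∈-tail (∈-resp-↭ ys↭ (∈-tail (closed (closed x∈)) ffx≢x)) (free (closed x∈))
            ws = proj₁ (extract ffx∈zs)
            zs↭ = proj₂ (extract ffx∈zs)
            all↭ : x ∷ ys ↭ x ∷ f x ∷ f (f x) ∷ ws
            all↭ = ↭-prep x (↭-trans ys↭ (↭-prep (f x) zs↭))
            u′ : Unique (x ∷ f x ∷ f (f x) ∷ ws)
            u′ = Unique-resp-↭ all↭ u
            u-ws : Unique ws
            u-ws with u′
            ... | _ ∷ _ ∷ _ ∷ v = v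
            fx∉ws : f x ∉ ws
            fx∉ws with u′
            ... | _ ∷ v = unique-head v ∘ there
            ffx∉ws : f (f x) ∉ ws
            ffx∉ws with u′
            ... | _ ∷ _ ∷ v = unique-head v
            ws⊆ : ∀ {y} → y ∈ ws → y ∈ x ∷ ys
            ws⊆ = ∈-resp-↭ (↭-sym all↭) ∘ there ∘ there ∘ there
            -- Applying f twice more to f y returns y; if f y lay in the removed orbit, y would lie
            -- there too.
            closed′ : ∀ {y} → y ∈ ws → f y ∈ ws
            closed′ {y} y∈ = ∈-tail (∈-tail (∈-tail (∈-resp-↭ all↭ (closed (ws⊆ y∈))) fy≢x) fy≢fx) fy≢ffx
              where
                fy≢x : f y ≢ x
                fy≢x e = ffx∉ws (subst (_∈ ws) (trans (sym (cube (ws⊆ y∈))) (cong (f ∘ f) e)) y∈)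
                back : f y ≡ f x → y ≡ x
                back e = trans (sym (cube (ws⊆ y∈))) (trans (cong (f ∘ f) e) (cube x∈))
                fy≢fx : f y ≢ f x
                fy≢fx e = unique-head u′ (there (there (subst (_∈ ws) (back e) y∈)))
                fy≢ffx : f y ≢ f (f x)
                fy≢ffx e = fx∉ws (subst (_∈ ws) (trans (sym (cube (ws⊆ y∈)))
                  (trans (cong (f ∘ f) e) (cube (closed x∈)))) y∈)
            len≡ : length (x ∷ ys) ≡ 3 ℕ.+ length ws
            len≡ = ↭-length all↭
            ws≤b : length ws ℕ.≤ b
            ws≤b = ℕₚ.≤-trans (ℕₚ.m≤n+m (length ws) 2) (ℕₚ.≤-trans (ℕₚ.≤-reflexive (sym (ℕₚ.suc-injective len≡))) len)

coarsen : ∀ {d n} ⦃ _ : NonZero d ⦄ ⦃ _ : NonZero n ⦄ {x y} → d ℕ∣.∣ n →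
  Residues._≈_ n x y → Residues._≈_ d x y
coarsen {d} {n} d∣n p = Residues.∣⇒≈ d (ℕ∣.∣-trans d∣n (Residues.≈⇒∣ n p))

-- The number x² - x is always even, so x² - x + 1 takes the value 1 at both residues modulo 2.
root⇒odd : ∀ {n} ⦃ _ : NonZero n ⦄ {α} → Residues.IsRoot n α → ¬ 2 ℕ∣.∣ n
root⇒odd {n} {α} root 2∣n = no-root (ρ α) (IsRoot-resp (≈-sym (ι-ρ α)) (coarsen 2∣n root))
  where
    open Residues 2
    1≉0 : 1ℤ ≉ 0ℤ
    1≉0 p = ℕ∣.>⇒∤ (s≤s (s≤s z≤n)) (≈0⇒∣ p)
    no-root : ∀ x → ¬ IsRoot (ι x)
    no-root zero       = 1≉0
    no-root (suc zero) = 1≉0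

module _ (n : ℕ) ⦃ nz : NonZero n ⦄ where
  open Residues n

  3∤⇒3-invertible : ¬ 3 ℕ∣.∣ n → ∃[ t ] + 3 * t ≈ 1ℤ
  3∤⇒3-invertible 3∤n with n % 3 in r | ℕD.m%n<n n 3 | n≡
    where
      n≡ : + n ≡ + (n % 3) + + (n ℕD./ 3) * + 3
      n≡ = trans (cong +_ (ℕD.m≡m%n+[m/n]*n n 3)) (cong (λ z → + (n % 3) + z) (ℤₚ.pos-* (n ℕD./ 3) 3))
  ... | 0 | _ | _  = contradiction (ℕ∣.m%n≡0⇒n∣m n 3 r) 3∤n
  -- With q = n / 3, the equation n = 1 + 3 q makes -q an inverse of 3; in the next case n = 2 + 3 q
  -- gives 3 (q + 1) = n + 1.
  ... | 1 | _ | n≡ = - + (n ℕD./ 3) , comb₁ -1ℤ n≈0 (trans (lemma (+ (n ℕD./ 3))) (cong (λ z → -1ℤ * (z - 0ℤ)) (sym n≡)))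
    where
      lemma : ∀ q → + 3 * - q - 1ℤ ≡ -1ℤ * (1ℤ + q * + 3 - 0ℤ)
      lemma = solve-∀
  ... | 2 | _ | n≡ = + (n ℕD./ 3) + 1ℤ , comb₁ 1ℤ n≈0 (trans (lemma (+ (n ℕD./ 3))) (cong (λ z → 1ℤ * (z - 0ℤ)) (sym n≡)))
    where
      lemma : ∀ q → + 3 * (q + 1ℤ) - 1ℤ ≡ 1ℤ * (+ 2 + q * + 3 - 0ℤ)
      lemma = solve-∀
  ... | suc (suc (suc _)) | s≤s (s≤s (s≤s ())) | _

-- Multiplication by -α permutes the non-zero residues, has order 3 and, since
-- (α + 1)(α - 2) = -3, no fixed point.
root⇒3∣pred : ∀ k {α t} → Residues.IsRoot (suc k) α → Residues._≈_ (suc k) (+ 3 * t) 1ℤ → 3 ℕ∣.∣ k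
root⇒3∣pred k {α} {t} root 3t =
  subst (3 ℕ∣.∣_) (length-tabulate suc) (order3⇒3∣length f (tabulate suc)
    (Uniqueₚ.tabulate⁺ Finₚ.suc-injective) (nonzero⇒∈ ∘ f≢0 ∘ ∈⇒nonzero) (λ {x} _ → fff≡ x) (λ x∈ → fx≢x (∈⇒nonzero x∈)))
  where
    open Residues (suc k)
    f : Fin (suc k) → Fin (suc k)
    f x = ρ (- α * ι x)
    ∈⇒nonzero : ∀ {x} → x ∈ tabulate suc → x ≢ zero
    ∈⇒nonzero x∈ refl with ∈-tabulate⁻ x∈
    ... | _ , ()
    nonzero⇒∈ : ∀ {x} → x ≢ zero → x ∈ tabulate suc
    nonzero⇒∈ {zero}  x≢0 = contradiction refl x≢0
    nonzero⇒∈ {suc i} _   = ∈-tabulate⁺ i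
    fff≡ : ∀ x → f (f (f x)) ≡ x
    fff≡ x = ι-injective (≈-trans (ι-ρ (- α * ι (f (f x))))
      (≈-trans (*-congˡ (- α) (≈-trans (ι-ρ (- α * ι (f x))) (*-congˡ (- α) (ι-ρ (- α * ι x)))))
        (comb₁ (- (α + 1ℤ) * ι x) root (lemma α (ι x)))))
      where
        lemma : ∀ α x → - α * (- α * (- α * x)) - x ≡ - (α + 1ℤ) * x * (α * α - α + 1ℤ - 0ℤ)
        lemma = solve-∀
    fx≢x : ∀ {x} → x ≢ zero → f x ≢ x
    fx≢x {x} x≢0 e = x≢0 (ι-injective (comb₃ (- ι x) (t * ι x) ((α - + 2) * t) 3t root
      (≈-trans (≈-sym (ι-ρ (- α * ι x))) (ι-cong e)) (lemma α t (ι x))))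
      where
        lemma : ∀ α t x → x - 0ℤ ≡ - x * (+ 3 * t - 1ℤ) + t * x * (α * α - α + 1ℤ - 0ℤ) + (α - + 2) * t * (- α * x - x)
        lemma = solve-∀
    f≢0 : ∀ {x} → x ≢ zero → f x ≢ zero
    f≢0 {x} x≢0 e = x≢0 (ι-injective (comb₂ (ι x) (α - 1ℤ) root (≈-trans (≈-sym (ι-ρ (- α * ι x))) (ι-cong e)) (lemma α (ι x))))
      where
        lemma : ∀ α x → x - 0ℤ ≡ x * (α * α - α + 1ℤ - 0ℤ) + (α - 1ℤ) * (- α * x - 0ℤ)
        lemma = solve-∀

abstract
  %6-table : ∀ (r : Fin 6) → toℕ r % 3 ≡ 1 → toℕ r % 2 ≡ 1 → toℕ r ≡ 1
  %6-table = from-yes (Finₚ.all? λ (r : Fin 6) → (toℕ r % 3 ℕₚ.≟ 1) →-dec ((toℕ r % 2 ℕₚ.≟ 1) →-dec (toℕ r ℕₚ.≟ 1)))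

%6≡1 : ∀ {n} → n % 3 ≡ 1 → ¬ 2 ℕ∣.∣ n → n % 6 ≡ 1
%6≡1 {n} n%3 2∤n = trans (sym r≡) (%6-table r
    (trans (cong (_% 3) r≡) (trans (ℕD.m∣n⇒o%n%m≡o%m 3 6 n (ℕ∣.divides 2 refl)) n%3))
    (trans (cong (_% 2) r≡) (trans (ℕD.m∣n⇒o%n%m≡o%m 2 6 n (ℕ∣.divides 3 refl)) n%2)))
  where
    r = fromℕ< (ℕD.m%n<n n 6)
    r≡ : toℕ r ≡ n % 6
    r≡ = Finₚ.toℕ-fromℕ< (ℕD.m%n<n n 6)
    n%2 : n % 2 ≡ 1
    n%2 with n % 2 in e | ℕD.m%n<n n 2
    ... | 0 | _ = contradiction (ℕ∣.m%n≡0⇒n∣m n 2 e) 2∤n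
    ... | 1 | _ = refl
    ... | suc (suc _) | s≤s (s≤s ())

-- No lower bound on the modulus is imposed, because this is applied both to n and to the prime
-- factors of n.
root⇒%6≡1 : ∀ n ⦃ _ : NonZero n ⦄ {α} → Residues.IsRoot n α → ¬ 3 ℕ∣.∣ n → n % 6 ≡ 1
root⇒%6≡1 n@(suc k) {α} root 3∤n = %6≡1 {n} (∣pred⇒%3≡1 (root⇒3∣pred k {α} root (proj₂ (3∤⇒3-invertible n 3∤n)))) (root⇒odd {n} {α} root)
  where
    ∣pred⇒%3≡1 : 3 ℕ∣.∣ k → suc k % 3 ≡ 1
    ∣pred⇒%3≡1 (ℕ∣.divides q k≡) = trans (cong (λ m → suc m % 3) k≡) (ℕD.[m+kn]%n≡m%n 1 q 3)

%6≡1⇒3∤ : ∀ {n} → n % 6 ≡ 1 → ¬ 3 ℕ∣.∣ n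
%6≡1⇒3∤ {n} n%6 3∣n = contradiction (trans (sym (ℕ∣.n∣m⇒m%n≡0 n 3 3∣n))
  (trans (sym (ℕD.m∣n⇒o%n%m≡o%m 3 6 n (ℕ∣.divides 2 refl))) (cong (_% 3) n%6))) λ()

module Invertible12 (n : ℕ) ⦃ nz : NonZero n ⦄ (n%6≡1 : n % 6 ≡ 1) where
  open Residues n

  private
    q = + (n ℕD./ 6)
    n≡ : + n ≡ 1ℤ + q * + 6
    n≡ = trans (cong +_ (ℕD.m≡m%n+[m/n]*n n 6))
      (trans (cong (λ r → + r + + (n ℕD./ 6 ℕ.* 6)) n%6≡1) (cong (λ z → 1ℤ + z) (ℤₚ.pos-* (n ℕD./ 6) 6)))

  6q≈-1 : 1ℤ + q * + 6 ≈ 0ℤ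
  6q≈-1 = ≈-trans (≡⇒≈ (sym n≡)) n≈0

  abstract
    12-invertible : ∃[ t ] + 12 * t ≈ 1ℤ
    -- From 6 q ≈ -1 follows 36 q² ≈ 1, and 36 q² = 12 · 3 q².
    12-invertible = + 3 * q * q , comb₁ (q * + 6 - 1ℤ) 6q≈-1 (lemma q)
      where
        lemma : ∀ q → + 12 * (+ 3 * q * q) - 1ℤ ≡ (q * + 6 - 1ℤ) * (1ℤ + q * + 6 - 0ℤ)
        lemma = solve-∀

  3-invertible : ∃[ t ] + 3 * t ≈ 1ℤ
  3-invertible = let t , e = 12-invertible in + 4 * t , comb₁ 1ℤ e (lemma t)
    where
      lemma : ∀ t → + 3 * (+ 4 * t) - 1ℤ ≡ 1ℤ * (+ 12 * t - 1ℤ)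
      lemma = solve-∀

-- The affine Frobenius group attached to a solution

module Affine (n : ℕ) ⦃ nz : NonZero n ⦄ (7≤n : 7 ℕ.≤ n) (n%6≡1 : n % 6 ≡ 1)
  (a : ℕ) (a<n : a ℕ.< n) (sol : IsSol n a) where
  open Residues n
  open Units n
  open Equivalence

  α : ℤ
  α = + a

  root : IsRoot α
  root = IsSol⇒IsRoot sol

  module R = Root {α} root
  module R̄ = Root {1ℤ - α} (1-IsRoot {α} root)

  unit-injective : ∀ {i j} → ev α (unit i) ≈ ev α (unit j) → i ≡ j
  unit-injective {i} {j} = R.unit-injective 7≤n i j

  open Invertible12 n n%6≡1

  1≉0 : 1ℤ ≉ 0ℤ
  1≉0 p = ℕ∣.>⇒∤ (ℕₚ.<-≤-trans (s≤s (s≤s z≤n)) 7≤n) (≈0⇒∣ p)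

  1≉-1 : 1ℤ ≉ -1ℤ
  1≉-1 p = contradiction (unit-injective (≈-trans (≡⇒≈ (sym (ev-1 α))) (≈-trans p (≡⇒≈ (ev--1 α))))) 0≢3
    where
      0≢3 : zero {5} ≢ suc (suc (suc zero))
      0≢3 ()

  1≤a : 1 ℕ.≤ a
  1≤a = ℕₚ.n≢0⇒n>0 λ { refl → 1≉0 root }

  1≤a∸1 : 1 ℕ.≤ a ℕ.∸ 1
  1≤a∸1 = ℕₚ.m<n⇒0<n∸m (ℕₚ.≤∧≢⇒< 1≤a λ { refl → 1≉0 root })

  S : Sub n
  S = TL n a (a ℕ.∸ 1) 1

  S⇔Six : ∀ {x} → S x ⇔ Six α (ι x)
  S⇔Six = mk⇔ (TL⇒Six {a} 1≤a root) (Six⇒TL {a} 1≤a root)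

  abstract
    Six-1-invertible : ∀ {μ} → Six α μ → μ ≈ 1ℤ ⊎ ∃[ w ] (μ - 1ℤ) * w ≈ 1ℤ
    Six-1-invertible = R.Six-1-invertible (proj₂ 12-invertible)

  HGen⇒Six : ∀ {m} → HGen n a m → Six α (ι m)
  HGen⇒Six (i , refl) = Six-pow i
    where
      Six-pow : ∀ i → Six α (ι (powₙ n ([_] n a) i))
      Six-pow zero    = Six-resp (≈-sym (ι-mod 1)) Six-1
      Six-pow (suc i) = Six-resp (≈-sym (ι-⊗ ([_] n a) (powₙ n ([_] n a) i))) (R.Six-* (Six-resp (≈-sym (ι-mod a)) Six-α) (Six-pow i))

  ι-pow : ∀ i → ι (powₙ n ([_] n a) i) ≈ α ℤ.^ i
  ι-pow zero    = ι-mod 1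
  ι-pow (suc i) = ≈-trans (ι-⊗ ([_] n a) (powₙ n ([_] n a) i)) (*-cong (ι-mod a) (ι-pow i))

  Six⇒HGen : ∀ {m} → Six α (ι m) → HGen n a m
  Six⇒HGen (k , e) = toℕ k , ι-injective (≈-trans e (≈-trans (R.unit≈^ k) (≈-sym (ι-pow (toℕ k)))))

  affine : ℤ → ℤ → Perm n
  affine y μ x = ρ ((ι x + y) * μ)

  IsAffine : Perm n → Set
  IsAffine g = ∃[ y ] ∃[ μ ] Six α μ × (∀ x → ι (g x) ≈ (ι x + y) * μ)

  abstract
    Aff⇒IsAffine : ∀ {g} → Aff n a g → IsAffine g
    Aff⇒IsAffine (y , m , hm , g≗) = ι y , ι m , HGen⇒Six hm ,
      λ x → ≈-trans (ι-cong (g≗ x)) (≈-trans (ι-⊗ (_⊕_ n x y) m) (*-congʳ (ι m) (ι-⊕ x y)))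

  abstract
    IsAffine⇒Aff : ∀ {g} → IsAffine g → Aff n a g
    IsAffine⇒Aff (y , μ , sμ , g≈) = ρ y , ρ μ , Six⇒HGen (Six-resp (≈-sym (ι-ρ μ)) sμ) ,
      λ x → ι-injective (≈-trans (g≈ x) (≈-sym (≈-trans (ι-⊗ (_⊕_ n x (ρ y)) (ρ μ))
        (*-cong (≈-trans (ι-⊕ x (ρ y)) (+-congˡ (ι x) (ι-ρ y))) (ι-ρ μ)))))

  affine∈Aff : ∀ y {μ} → Six α μ → Aff n a (affine y μ)
  affine∈Aff y {μ} s = IsAffine⇒Aff (y , μ , s , λ x → ι-ρ ((ι x + y) * μ))

  Aff-isPermGroup : IsPermGroup (Aff n a)
  Aff-isPermGroup = record
    { resp     = λ { g≗h (y , m , hm , e) → y , m , hm , λ x → trans (sym (g≗h x)) (e x) }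
    ; has-id   = IsAffine⇒Aff (0ℤ , 1ℤ , Six-1 , λ x → ≡⇒≈ (id-lemma (ι x)))
    ; closed   = λ {g} {h} ag ah → closed g h (Aff⇒IsAffine ag) (Aff⇒IsAffine ah)
    ; inverses = λ {g} ag → inverses g (Aff⇒IsAffine ag)
    }
    where
      id-lemma : ∀ x → x ≡ (x + 0ℤ) * 1ℤ
      id-lemma = solve-∀
      closed : ∀ g h → IsAffine g → IsAffine h → Aff n a (g ∘ h)
      closed g h (y , μ , s , g≈) (y′ , μ′ , s′ , h≈) =
        let w , _ , μ′w = R.Six-inverse s′ in
        -- Translation precedes multiplication, so the outer translation y has to be pulled back
        -- through the inner multiplier μ′, whose inverse is w.
        IsAffine⇒Aff (y′ + y * w , μ′ * μ , R.Six-* s′ s ,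
          λ x → ≈-trans (g≈ (h x)) (comb₂ μ (- (y * μ)) (h≈ x) μ′w (lemma (ι x) (ι (h x)) y μ y′ μ′ w)))
        where
          lemma : ∀ x hx y μ y′ μ′ w → (hx + y) * μ - (x + (y′ + y * w)) * (μ′ * μ)
            ≡ μ * (hx - (x + y′) * μ′) + - (y * μ) * (μ′ * w - 1ℤ)
          lemma = solve-∀
      inverses : ∀ g → IsAffine g → ∃[ h ] (Aff n a h × (g ∘ h ≗ id) × (h ∘ g ≗ id))
      inverses g (y , μ , s , g≈) = let w , sw , μw = R.Six-inverse s in
        -- The inverse x ↦ x w - y, brought into the form (x - y μ) w.
        affine (- (y * μ)) w , affine∈Aff (- (y * μ)) sw ,
        (λ x → ι-injective (≈-trans (g≈ _) (comb₂ μ (ι x - y * μ) (ι-ρ ((ι x - y * μ) * w)) μw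
          (lemma₁ (ι x) (ι (affine (- (y * μ)) w x)) y μ w)))) ,
        (λ x → ι-injective (≈-trans (ι-ρ ((ι (g x) - y * μ) * w)) (comb₂ w (ι x) (g≈ x) μw
          (lemma₂ (ι x) (ι (g x)) y μ w))))
        where
          lemma₁ : ∀ x hx y μ w → (hx + y) * μ - x ≡ μ * (hx - (x - y * μ) * w) + (x - y * μ) * (μ * w - 1ℤ)
          lemma₁ = solve-∀
          lemma₂ : ∀ x gx y μ w → (gx - y * μ) * w - x ≡ w * (gx - (x + y) * μ) + x * (μ * w - 1ℤ)
          lemma₂ = solve-∀

  translation : ℤ → Perm n
  translation y x = ρ (ι x + y)

  translation-IsAffine : ∀ y → IsAffine (translation y)
  translation-IsAffine y = y , 1ℤ , Six-1 , λ x → ≈-trans (ι-ρ (ι x + y)) (≡⇒≈ (sym (ℤₚ.*-identityʳ (ι x + y))))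

  Aff-isFrobenius : IsFrobenius (Aff n a)
  Aff-isFrobenius = record
    { group      = Aff-isPermGroup
    ; transitive = λ x y → translation (ι y - ι x) , IsAffine⇒Aff (translation-IsAffine (ι y - ι x)) ,
                     ι-injective (≈-trans (ι-ρ _) (≡⇒≈ (x+y-x (ι x) (ι y))))
    -- Negation fixes 0 and is not the identity, since 1 and -1 are distinct.
    ; notRegular = affine 0ℤ -1ℤ , affine∈Aff 0ℤ Six--1 , negation≢id , ρ 0ℤ ,
                     ι-injective (≈-trans (ι-ρ _) (comb₁ (- + 2) (ι-ρ 0ℤ) (negation-0 (ι (ρ 0ℤ)))))
    ; twoPoints  = λ g x y ag → twoPoints g x y (Aff⇒IsAffine ag)
    }
    where
      x+y-x : ∀ x y → x + (y - x) ≡ y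
      x+y-x = solve-∀
      negation-0 : ∀ z → (z + 0ℤ) * -1ℤ - z ≡ - + 2 * (z - 0ℤ)
      negation-0 = solve-∀
      negation≢id : ¬ (affine 0ℤ -1ℤ ≗ id)
      negation≢id e = 1≉-1 (comb₂ 1ℤ -1ℤ (≈-trans (≈-sym (ι-ρ 1ℤ)) (≈-trans (ι-cong (sym (e (ρ 1ℤ)))) (ι-ρ _)))
          (ι-ρ 1ℤ) (lemma (ι (ρ 1ℤ))))
        where
          lemma : ∀ z → 1ℤ - -1ℤ ≡ 1ℤ * (1ℤ - (z + 0ℤ) * -1ℤ) + -1ℤ * (z - 1ℤ)
          lemma = solve-∀
      -- Subtracting the two fixed-point equations gives (μ - 1)(x - y) ≈ 0, and μ - 1 is a unit
      -- unless μ ≈ 1; in that case the one fixed point x already forces the identity.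
      twoPoints : ∀ g x y → IsAffine g → x ≢ y → g x ≡ x → g y ≡ y → g ≗ id
      twoPoints g x y (b , μ , s , g≈) x≢y gx≡x gy≡y z = by-cases (Six-1-invertible s)
       where
       by-cases : μ ≈ 1ℤ ⊎ ∃[ w ] (μ - 1ℤ) * w ≈ 1ℤ → g z ≡ z
       by-cases (inj₁ μ≈1) = ι-injective (≈-trans (g≈ z) (comb₂ 1ℤ (ι z - ι x) (≈-trans (≈-sym (g≈ x)) (ι-cong gx≡x)) μ≈1
              (lemma (ι x) (ι z) b μ)))
         where
           lemma : ∀ x z b μ → (z + b) * μ - z ≡ 1ℤ * ((x + b) * μ - x) + (z - x) * (μ - 1ℤ)
           lemma = solve-∀
       by-cases (inj₂ (w , μ-1)) = ⊥-elim (x≢y (ι-injective {x} {y} (comb₃ w (- w) (ι y - ι x)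
              (≈-trans (≈-sym (g≈ x)) (ι-cong gx≡x)) (≈-trans (≈-sym (g≈ y)) (ι-cong gy≡y)) μ-1
              (lemma (ι x) (ι y) b μ w))))
         where
           lemma : ∀ x y b μ w → x - y ≡ w * ((x + b) * μ - x) + - w * ((y + b) * μ - y) + (y - x) * ((μ - 1ℤ) * w - 1ℤ)
           lemma = solve-∀

  -- If μ differs from 1, then μ - 1 is invertible and -y μ / (μ - 1) solves (x + y) μ ≈ x; a
  -- fixed-point-free map therefore has μ ≈ 1.
  Kernel⇒translation : ∀ {g} → Kernel (Aff n a) g → ∃[ y ] (∀ x → ι (g x) ≈ ι x + y)
  Kernel⇒translation {g} (_ , inj₁ g≗id) = 0ℤ , λ x → ≈-trans (ι-cong (g≗id x)) (≡⇒≈ (sym (ℤₚ.+-identityʳ (ι x))))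
  Kernel⇒translation {g} (ag , inj₂ free) = from-affine (Aff⇒IsAffine ag)
    where
      lemma₁ : ∀ x y μ → (x + y) * μ - (x + y) ≡ (x + y) * (μ - 1ℤ)
      lemma₁ = solve-∀
      lemma₂ : ∀ x y μ w → (x + y) * μ - x ≡ (μ - 1ℤ) * (x - - (y * μ * w)) + - (y * μ) * ((μ - 1ℤ) * w - 1ℤ)
      lemma₂ = solve-∀
      from-affine : IsAffine g → ∃[ y ] (∀ x → ι (g x) ≈ ι x + y)
      from-affine (y , μ , s , g≈) = by-cases (Six-1-invertible s)
        where
          by-cases : μ ≈ 1ℤ ⊎ ∃[ w ] (μ - 1ℤ) * w ≈ 1ℤ → ∃[ y ] (∀ x → ι (g x) ≈ ι x + y)
          by-cases (inj₁ μ≈1) = y , λ x → ≈-trans (g≈ x) (comb₁ (ι x + y) μ≈1 (lemma₁ (ι x) y μ))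
          by-cases (inj₂ (w , μ-1)) = ⊥-elim (free fixed (ι-injective {g fixed} {fixed} (≈-trans (g≈ fixed)
              (comb₂ (μ - 1ℤ) (- (y * μ)) (ι-ρ (- (y * μ * w))) μ-1 (lemma₂ (ι fixed) y μ w)))))
            where
              fixed = ρ (- (y * μ * w))

  κ : Perm n
  κ = translation 1ℤ

  ι-iter-κ : ∀ i x → ι (iter κ i x) ≈ ι x + + i
  ι-iter-κ zero    x = ≡⇒≈ (sym (ℤₚ.+-identityʳ (ι x)))
  ι-iter-κ (suc i) x = ≈-trans (ι-ρ _) (comb₁ 1ℤ (ι-iter-κ i x) (lemma (ι (iter κ i x)) (ι x) (+ i)))
    where
      lemma : ∀ k x i → k + 1ℤ - (x + (1ℤ + i)) ≡ 1ℤ * (k - (x + i))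
      lemma = solve-∀

  κ∈Kernel : Kernel (Aff n a) κ
  κ∈Kernel = IsAffine⇒Aff (translation-IsAffine 1ℤ) ,
      inj₂ λ x e → 1≉0 (comb₁ 1ℤ (≈-trans (≈-sym (ι-ρ (ι x + 1ℤ))) (ι-cong e)) (lemma (ι x)))
    where
      lemma : ∀ x → 1ℤ - 0ℤ ≡ 1ℤ * (x + 1ℤ - x)
      lemma = solve-∀

  κ-generates : ∀ g → Kernel (Aff n a) g → ∃[ i ] (g ≗ iter κ i)
  κ-generates g k = let y , g≈ = Kernel⇒translation k in
    toℕ (ρ y) , λ x → ι-injective (≈-trans (g≈ x) (≈-sym (≈-trans (ι-iter-κ (toℕ (ρ y)) x) (+-congˡ (ι x) (ι-ρ y)))))

  ω : Fin n
  ω = ρ 0ℤ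

  Stab⇒linear : ∀ {g} → Stab (Aff n a) ω g → ∃[ μ ] Six α μ × (∀ x → ι (g x) ≈ ι x * μ)
  Stab⇒linear {g} (ag , gω≡ω) = from-affine (Aff⇒IsAffine ag)
    where
      lemma : ∀ x y μ o → (x + y) * μ - x * μ ≡ 1ℤ * ((o + y) * μ - o) + (1ℤ - μ) * (o - 0ℤ)
      lemma = solve-∀
      from-affine : IsAffine g → ∃[ μ ] Six α μ × (∀ x → ι (g x) ≈ ι x * μ)
      from-affine (y , μ , s , g≈) = μ , s , λ x → ≈-trans (g≈ x)
        (comb₂ 1ℤ (1ℤ - μ) (≈-trans (≈-sym (g≈ ω)) (ι-cong gω≡ω)) (ι-ρ 0ℤ) (lemma (ι x) y μ (ι ω)))

  linear : ℤ → Perm n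
  linear = affine 0ℤ

  ι-linear : ∀ μ x → ι (linear μ x) ≈ ι x * μ
  ι-linear μ x = ≈-trans (ι-ρ _) (≡⇒≈ (cong (_* μ) (ℤₚ.+-identityʳ (ι x))))

  linear∈Stab : ∀ {μ} → Six α μ → Stab (Aff n a) ω (linear μ)
  linear∈Stab {μ} s = affine∈Aff 0ℤ s , ι-injective (≈-trans (ι-linear μ ω)
      (comb₁ (μ - 1ℤ) (ι-ρ 0ℤ) (lemma (ι ω) μ)))
    where
      lemma : ∀ o μ → o * μ - o ≡ (μ - 1ℤ) * (o - 0ℤ)
      lemma = solve-∀

  Stab-evenOrder : EvenOrder (Stab (Aff n a) ω)
  Stab-evenOrder = 6 , (tabulate elements , refl , Allₚ.tabulate⁺ {f = elements} (λ k → linear∈Stab (Six-unit α k)) ,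
      AllPairsₚ.tabulate⁺ {f = elements} distinct , complete) , ℕ∣.divides 3 refl
    where
      elements : Fin 6 → Perm n
      elements k = linear (ev α (unit k))
      distinct : ∀ {i j} → i ≢ j → ¬ (elements i ≗ elements j)
      distinct {i} {j} i≢j e = i≢j (unit-injective (≈-trans (≈-sym (at-1 i)) (≈-trans (ι-cong (e (ρ 1ℤ))) (at-1 j))))
        where
          at-1 : ∀ k → ι (elements k (ρ 1ℤ)) ≈ ev α (unit k)
          at-1 k = ≈-trans (ι-linear (ev α (unit k)) (ρ 1ℤ))
            (≈-trans (*-congʳ (ev α (unit k)) (ι-ρ 1ℤ)) (≡⇒≈ (ℤₚ.*-identityˡ (ev α (unit k)))))
      complete : ∀ g → Stab (Aff n a) ω g → _
      complete g st = let μ , (k , e) , g≈ = Stab⇒linear st in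
        Anyₚ.tabulate⁺ {f = elements} k λ x → ι-injective (≈-trans (g≈ x) (≈-trans (*-congˡ (ι x) e) (≈-sym (ι-linear (ev α (unit k)) x))))

  -- Conjugating translation by 1 with multiplication by μ gives translation by μ, so the conjugates
  -- of κ are exactly the translations by the six units.
  S-conjugates : ∀ x → S x ⇔ Conj (Stab (Aff n a) ω) κ (iter κ (toℕ x))
  S-conjugates x = mk⇔ there′ back
    where
      there′ : S x → Conj (Stab (Aff n a) ω) κ (iter κ (toℕ x))
      there′ s = linear (ι x) , linear∈Stab (to S⇔Six s) , λ z → ι-injective
        (≈-trans (ι-iter-κ (toℕ x) (linear (ι x) z)) (≈-trans (+-cong (ι-linear (ι x) z) (≈-refl {ι x}))
          (≈-sym (≈-trans (ι-linear (ι x) (κ z)) (comb₁ (ι x) (ι-ρ (ι z + 1ℤ)) (lemma (ι x) (ι z) (ι (κ z))))))))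
        where
          lemma : ∀ x z kz → kz * x - (z * x + x) ≡ x * (kz - (z + 1ℤ))
          lemma = solve-∀
      back : Conj (Stab (Aff n a) ω) κ (iter κ (toℕ x)) → S x
      back (h , st , e) = from-linear (Stab⇒linear st)
        where
          lemma : ∀ x μ o ko → μ - x ≡ -1ℤ * (o * μ + x - ko * μ) + - μ * (ko - (o + 1ℤ))
          lemma = solve-∀
          from-linear : (∃[ μ ] Six α μ × (∀ z → ι (h z) ≈ ι z * μ)) → S x
          from-linear (μ , s , h≈) = from S⇔Six (Six-resp (comb₂ -1ℤ (- μ) commute (ι-ρ (ι ω + 1ℤ))
              (lemma (ι x) μ (ι ω) (ι (κ ω)))) s)
            where
              commute : ι ω * μ + ι x ≈ ι (κ ω) * μ
              commute = ≈-trans (+-cong (≈-sym (h≈ ω)) (≈-refl {ι x})) (≈-trans (≈-sym (ι-iter-κ (toℕ x) (h ω)))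
                (≈-trans (ι-cong (e ω)) (h≈ (κ ω))))

  graph : FirstKindFrobeniusGraph n (Aff n a) S
  graph = record
    { frobenius = Aff-isFrobenius
    ; κ         = κ
    ; κ∈K       = κ∈Kernel
    ; κ-gen     = κ-generates
    ; κ-order   = (λ x → ι-injective (≈-trans (ι-iter-κ n x) (comb₁ 1ℤ n≈0 (lemma₁ (ι x) (+ n))))) ,
                  λ i 0<i i<n e → ℕ∣.>⇒∤ ⦃ ℕ.>-nonZero 0<i ⦄ i<n
                    (≈0⇒∣ (comb₁ 1ℤ (≈-trans (≈-sym (ι-iter-κ i ω)) (ι-cong (e ω))) (lemma₂ (ι ω) (+ i))))
    ; ω         = ω
    ; a         = κ
    ; a∈K       = κ∈Kernel
    -- The identity conjugates κ to itself, so i copies of κ form an admissible product.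
    ; generates = λ g k → let i , g≗ = κ-generates g k in
                    replicate i κ , Allₚ.replicate⁺ i (id , (IsPermGroup.has-id Aff-isPermGroup , refl) , λ _ → refl) ,
                    λ x → trans (foldr-replicate i x) (sym (g≗ x))
    ; firstKind = inj₁ Stab-evenOrder
    ; conn      = S-conjugates
    }
    where
      lemma₁ : ∀ x n → x + n - x ≡ 1ℤ * (n - 0ℤ)
      lemma₁ = solve-∀
      lemma₂ : ∀ x i → i - 0ℤ ≡ 1ℤ * (x + i - x)
      lemma₂ = solve-∀
      foldr-replicate : ∀ i x → foldr (λ f h → f ∘ h) (λ x → x) (replicate i κ) x ≡ iter κ i x
      foldr-replicate zero    x = refl
      foldr-replicate (suc i) x = cong κ (foldr-replicate i x)

  S-hasSize : HasSize S _≡_ 6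
  S-hasSize = tabulate elements , refl , Allₚ.tabulate⁺ {f = elements} (λ k → from S⇔Six (Six-resp (≈-sym (ι-elements k)) (Six-unit α k))) ,
      AllPairsₚ.tabulate⁺ {f = elements} (λ {i} {j} i≢j e → i≢j (unit-injective {i} {j}
        (≈-trans (≈-sym (ι-elements i)) (≈-trans (ι-cong e) (ι-elements j))))) ,
      λ x s → let k , e = to S⇔Six s in Anyₚ.tabulate⁺ {f = elements} k (ι-injective (≈-trans e (≈-sym (ι-elements k))))
    where
      elements : Fin 6 → Fin n
      elements k = ρ (ev α (unit k))
      ι-elements : ∀ k → ι (elements k) ≈ ev α (unit k)
      ι-elements k = ι-ρ (ev α (unit k))

  S-frobCirc : FrobCirc n S
  S-frobCirc = S-hasSize , Aff n a , graph

-- Parameters, arc-transitivity and rotations of the graph of a solution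

module SolutionProps (n : ℕ) ⦃ nz : NonZero n ⦄ (7≤n : 7 ℕ.≤ n) (n%6≡1 : n % 6 ≡ 1)
  (a : ℕ) (a<n : a ℕ.< n) (sol : IsSol n a) where
  open Residues n
  open Units n
  open Equivalence
  open Affine n 7≤n n%6≡1 a a<n sol

  +a∸1≡ : + (a ℕ.∸ 1) ≡ α - 1ℤ
  +a∸1≡ = pos-∸ 1≤a

  tlParams : TLParams n a (a ℕ.∸ 1) 1
  tlParams = 1≤a , a≤n∸1 , 1≤a∸1 , ℕₚ.≤-trans (ℕₚ.m∸n≤m a 1) a≤n∸1 , ℕₚ.≤-refl , ℕₚ.≤-trans 1≤a a≤n∸1 ,
      Uniqueₚ.map⁺ {f = element} (λ {i} {j} e → unit-injective {i} {j}
        (≈-trans (≈-sym (element≈ i)) (≈-trans (≡⇒≈ (cong +_ e)) (element≈ j)))) distinct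
    where
      a≤n∸1 : a ℕ.≤ n ℕ.∸ 1
      a≤n∸1 = ℕₚ.m+n≤o⇒m≤o∸n a (subst (ℕ._≤ n) (ℕₚ.+-comm 1 a) a<n)
      element : Fin 6 → ℕ
      element zero                               = 1
      element (suc zero)                         = a
      element (suc (suc zero))                   = a ℕ.∸ 1
      element (suc (suc (suc zero)))             = n ℕ.∸ 1
      element (suc (suc (suc (suc zero))))       = n ℕ.∸ a
      element (suc (suc (suc (suc (suc zero))))) = n ℕ.∸ (a ℕ.∸ 1)
      element≈ : ∀ k → + element k ≈ ev α (unit k)
      element≈ zero                         = ≡⇒≈ (ev-1 α)
      element≈ (suc zero)                   = ≡⇒≈ (ev-α α)
      element≈ (suc (suc zero))             = ≡⇒≈ (trans +a∸1≡ (ev-α-1 α))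
      element≈ (suc (suc (suc zero)))       = ≈-trans (n∸-≈ (ℕₚ.≤-trans (s≤s z≤n) 7≤n)) (≡⇒≈ (ev--1 α))
      element≈ (suc (suc (suc (suc zero)))) = ≈-trans (n∸-≈ (ℕₚ.<⇒≤ a<n)) (≡⇒≈ (ev--α α))
      element≈ (suc (suc (suc (suc (suc zero))))) =
        ≈-trans (n∸-≈ (ℕₚ.≤-trans (ℕₚ.m∸n≤m a 1) (ℕₚ.<⇒≤ a<n))) (≡⇒≈ (trans (cong -_ +a∸1≡) (ev-1-α α)))
      distinct : Unique (# 1 ∷ # 4 ∷ # 2 ∷ # 5 ∷ # 0 ∷ # 3 ∷ [])
      distinct = from-yes (DecUnique.unique? (Finₚ._≟_ {6}) (# 1 ∷ # 4 ∷ # 2 ∷ # 5 ∷ # 0 ∷ # 3 ∷ []))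

  geometric : Geometric n a (a ℕ.∸ 1) 1
  geometric = n ℕ.∸ a , a ℕ.∸ 1 , 1 , inj₂ refl , inj₁ refl , inj₁ refl ,
    trans (cong (_% n) sum≡n) (ℕD.n%n≡0 n)
    where
      sum≡n : n ℕ.∸ a ℕ.+ (a ℕ.∸ 1) ℕ.+ 1 ≡ n
      sum≡n = trans (ℕₚ.+-assoc (n ℕ.∸ a) (a ℕ.∸ 1) 1)
        (trans (cong (n ℕ.∸ a ℕ.+_) (ℕₚ.m∸n+n≡m 1≤a)) (ℕₚ.m∸n+n≡m (ℕₚ.<⇒≤ a<n)))

  arcTransitive : ArcTransitive n (Aff n a) S
  arcTransitive = preserves , arcs
    where
      ι-image-diff : ∀ {g} x y → ((b , μ , _) : IsAffine g) →
        ι (_⊕_ n (g x) (⊖_ n (g y))) ≈ ι (_⊕_ n x (⊖_ n y)) * μ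
      ι-image-diff {g} x y (b , μ , _ , g≈) = ≈-trans (ι-diff (g x) (g y))
        (≈-trans (+-cong (g≈ x) (neg-cong (g≈ y)))
          (≈-trans (≡⇒≈ (lemma (ι x) (ι y) b μ)) (*-congʳ μ (≈-sym (ι-diff x y)))))
        where
          lemma : ∀ x y b μ → (x + b) * μ - (y + b) * μ ≡ (x - y) * μ
          lemma = solve-∀

      preserves : ∀ g → Aff n a g → ∀ x y → Adj n S x y ⇔ Adj n S (g x) (g y)
      preserves g ag x y = mk⇔ (forward (Aff⇒IsAffine ag)) (backward (Aff⇒IsAffine ag))
        where
          forward : IsAffine g → Adj n S x y → Adj n S (g x) (g y)
          forward af@(b , μ , s , _) adj = from S⇔Six (Six-resp (≈-sym (ι-image-diff x y af)) (R.Six-* (to S⇔Six adj) s))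
          backward : IsAffine g → Adj n S (g x) (g y) → Adj n S x y
          backward af@(b , μ , s , _) adj = let w , sw , μw = R.Six-inverse s in
            from S⇔Six (Six-resp (comb₂ w (ι (_⊕_ n x (⊖_ n y))) (ι-image-diff x y af) μw
                (lemma (ι (_⊕_ n (g x) (⊖_ n (g y)))) (ι (_⊕_ n x (⊖_ n y))) μ w))
              (R.Six-* (to S⇔Six adj) sw))
            where
              lemma : ∀ d′ d μ w → d′ * w - d ≡ w * (d′ - d * μ) + d * (μ * w - 1ℤ)
              lemma = solve-∀

      arcs : ∀ x y x′ y′ → Adj n S x y → Adj n S x′ y′ → ∃[ g ] (Aff n a g × g x ≡ x′ × g y ≡ y′)
      arcs x y x′ y′ xy x′y′ =
        let w , sw , dw = R.Six-inverse (Six-resp (ι-diff x y) (to S⇔Six xy))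
            sd′ = Six-resp (ι-diff x′ y′) (to S⇔Six x′y′)
            w′ , _ , d′w′ = R.Six-inverse sd′
            d = ι x - ι y
            d′ = ι x′ - ι y′
            -- The multiplier has to carry the difference d to d′, and b then solves (x + b) μ ≈ x′.
            μ = d′ * w
            b = ι x′ * (w′ * d) - ι x
        in affine b μ , affine∈Aff b (R.Six-* sd′ sw) ,
           ι-injective (≈-trans (ι-ρ ((ι x + b) * μ)) (comb₂ (ι x′ * d * w) (ι x′) d′w′ dw (lemma₁ (ι x) (ι x′) d d′ w w′))) ,
           ι-injective (≈-trans (ι-ρ ((ι y + b) * μ)) (comb₂ (ι x′ * d * w) (ι x′ - d′) d′w′ dw
             (lemma₂ (ι x) (ι y) (ι x′) (ι y′) w w′)))
        where
          lemma₁ : ∀ x x′ d d′ w w′ → (x + (x′ * (w′ * d) - x)) * (d′ * w) - x′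
            ≡ x′ * d * w * (d′ * w′ - 1ℤ) + x′ * (d * w - 1ℤ)
          lemma₁ = solve-∀
          lemma₂ : ∀ x y x′ y′ w w′ → (y + (x′ * (w′ * (x - y)) - x)) * ((x′ - y′) * w) - y′
            ≡ x′ * (x - y) * w * ((x′ - y′) * w′ - 1ℤ) + (x′ - (x′ - y′)) * ((x - y) * w - 1ℤ)
          lemma₂ = solve-∀

  module _ {β : ℤ} (rootβ : IsRoot β) (α⇒β : ∀ {z} → Six α z → Six β z) (β⇒α : ∀ {z} → Six β z → Six α z) where
    private module Rβ = Root {β} rootβ

    -- One argument serves both rotations: β = α for [a], and β = 1 - α for -[a²], because a² ≈ a -
    -- 1. The powers of β starting from 1 run through all six units.
    completeRotation : ∀ {m} → ι m ≈ β → CompleteRotation n S (λ x → _⊗_ n x m)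
    completeRotation {m} m≈β = ((injective , surjective) , additive) , (λ x → mk⇔ (forward x) (backward x)) ,
        [_] n 1 , from S⇔Six (Six-resp (≈-sym (ι-mod 1)) Six-1) , reach
      where
        f : Perm n
        f x = _⊗_ n x m
        ι-f : ∀ x → ι (f x) ≈ ι x * β
        ι-f x = ≈-trans (ι-⊗ x m) (*-congˡ (ι x) m≈β)
        β⁻¹ : ∃[ w ] Six β w × β * w ≈ 1ℤ
        β⁻¹ = Rβ.Six-inverse Six-α
        w = proj₁ β⁻¹
        βw : β * w ≈ 1ℤ
        βw = proj₂ (proj₂ β⁻¹)
        divide : ∀ x → ι (f x) * w ≈ ι x
        divide x = comb₂ w (ι x) (ι-f x) βw (lemma (ι (f x)) (ι x) β w)
          where
            lemma : ∀ fx x β w → fx * w - x ≡ w * (fx - x * β) + x * (β * w - 1ℤ)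
            lemma = solve-∀
        injective : ∀ x y → f x ≡ f y → x ≡ y
        injective x y e = ι-injective (≈-trans (≈-sym (divide x)) (≈-trans (*-congʳ w (ι-cong e)) (divide y)))
        surjective : ∀ y → ∃[ x ] f x ≡ y
        surjective y = ρ (ι y * w) , ι-injective (≈-trans (ι-f (ρ (ι y * w)))
            (comb₂ β (ι y) (ι-ρ (ι y * w)) βw (lemma (ι (ρ (ι y * w))) (ι y) β w)))
          where
            lemma : ∀ r y β w → r * β - y ≡ β * (r - y * w) + y * (β * w - 1ℤ)
            lemma = solve-∀
        additive : ∀ x y → f (_⊕_ n x y) ≡ _⊕_ n (f x) (f y)
        additive x y = ι-injective (≈-trans (ι-f (_⊕_ n x y)) (≈-trans (*-congʳ β (ι-⊕ x y))
          (≈-trans (≡⇒≈ (ℤₚ.*-distribʳ-+ β (ι x) (ι y)))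
            (≈-sym (≈-trans (ι-⊕ (f x) (f y)) (+-cong (ι-f x) (ι-f y)))))))
        forward : ∀ x → S x → S (f x)
        forward x s = from S⇔Six (β⇒α (Six-resp (≈-sym (ι-f x)) (Rβ.Six-* (α⇒β (to S⇔Six s)) Six-α)))
        backward : ∀ x → S (f x) → S x
        backward x s = from S⇔Six (β⇒α (Six-resp (divide x) (Rβ.Six-* (α⇒β (to S⇔Six s)) (proj₁ (proj₂ β⁻¹)))))
        ι-iter : ∀ i → ι (iter f i ([_] n 1)) ≈ β ℤ.^ i
        ι-iter zero    = ι-mod 1
        ι-iter (suc i) = ≈-trans (ι-f (iter f i ([_] n 1))) (≈-trans (*-congʳ β (ι-iter i)) (≡⇒≈ (ℤₚ.*-comm (β ℤ.^ i) β)))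
        reach : ∀ x → S x → ∃[ i ] iter f i ([_] n 1) ≡ x
        reach x s = let k , e = α⇒β (to S⇔Six s) in
          toℕ k , ι-injective (≈-trans (ι-iter (toℕ k)) (≈-trans (≈-sym (Rβ.unit≈^ k)) (≈-sym e)))

  a²≡a∸1 : [_] n (a ℕ.* a) ≡ [_] n (a ℕ.∸ 1)
  a²≡a∸1 = ≈⇒≡mod (≈-trans (ι-mod (a ℕ.* a)) (comb₁ 1ℤ root
      (trans (cong₂ _-_ (ℤₚ.pos-* a a) +a∸1≡) (lemma α))))
    where
      lemma : ∀ α → α * α - (α - 1ℤ) ≡ 1ℤ * (α * α - α + 1ℤ - 0ℤ)
      lemma = solve-∀

  rotation-α : CompleteRotation n S (λ x → _⊗_ n x ([_] n a))
  rotation-α = completeRotation root id id (ι-mod a)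

  rotation--α² : CompleteRotation n S (λ x → _⊗_ n x (⊖_ n ([_] n (a ℕ.* a))))
  rotation--α² = completeRotation (1-IsRoot {α} root) Six-unconjugate Six-conjugate
      (≈-trans (ι-⊖ _) (≈-trans (neg-cong (≈-trans (ι-cong a²≡a∸1) (ι-mod (a ℕ.∸ 1)))) (≡⇒≈ (trans (cong -_ +a∸1≡) (lemma α)))))
    where
      lemma : ∀ α → - (α - 1ℤ) ≡ 1ℤ - α
      lemma = solve-∀

  HGen-invertible : ∀ m → HGen n a m → ∃[ u ] (_⊗_ n m u ≡ [_] n 1)
  HGen-invertible m h = let w , _ , mw = R.Six-inverse (HGen⇒Six h) in
    ρ w , ≈⇒≡mod (≈-trans (ι-⊗ m (ρ w)) (≈-trans (*-congˡ (ι m) (ι-ρ w)) mw))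

  HGen⇔ : ∀ m → HGen n a m ⇔ (m ≡ [_] n 1 ⊎ m ≡ ⊖_ n ([_] n 1) ⊎ m ≡ [_] n a ⊎ m ≡ ⊖_ n ([_] n a)
                          ⊎ m ≡ [_] n (a ℕ.∸ 1) ⊎ m ≡ ⊖_ n ([_] n (a ℕ.∸ 1)))
  HGen⇔ m = mk⇔ (rotate ∘ from S⇔Six ∘ HGen⇒Six) (Six⇒HGen ∘ to S⇔Six ∘ unrotate)
    where
      rotate : ∀ {A B C D E F : Set} → A ⊎ B ⊎ C ⊎ D ⊎ E ⊎ F → E ⊎ F ⊎ A ⊎ B ⊎ C ⊎ D
      rotate (inj₁ a) = inj₂ (inj₂ (inj₁ a))
      rotate (inj₂ (inj₁ b)) = inj₂ (inj₂ (inj₂ (inj₁ b)))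
      rotate (inj₂ (inj₂ (inj₁ c))) = inj₂ (inj₂ (inj₂ (inj₂ (inj₁ c))))
      rotate (inj₂ (inj₂ (inj₂ (inj₁ d)))) = inj₂ (inj₂ (inj₂ (inj₂ (inj₂ d))))
      rotate (inj₂ (inj₂ (inj₂ (inj₂ (inj₁ e))))) = inj₁ e
      rotate (inj₂ (inj₂ (inj₂ (inj₂ (inj₂ f))))) = inj₂ (inj₁ f)
      unrotate : ∀ {A B C D E F : Set} → E ⊎ F ⊎ A ⊎ B ⊎ C ⊎ D → A ⊎ B ⊎ C ⊎ D ⊎ E ⊎ F
      -- Six summands are shifted by two places, so the shift has order three and its square is its
      -- inverse.
      unrotate = rotate ∘ rotate

  solProps : SolProps n a
  solProps = tlParams , S-frobCirc , (_ , rotation-α) , geometric , arcTransitive , graph , rotation-α , rotation--α² ,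
    HGen-invertible ,
    (λ m → subst (λ s → HGen n a m ⇔ (m ≡ [_] n 1 ⊎ m ≡ ⊖_ n ([_] n 1) ⊎ m ≡ [_] n a ⊎ m ≡ ⊖_ n ([_] n a)
                          ⊎ m ≡ s ⊎ m ≡ ⊖_ n s)) (sym a²≡a∸1) (HGen⇔ m)) ,
    HGen⇔

-- Groups of units acting without fixed points

module Semiregular (n : ℕ) ⦃ nz : NonZero n ⦄ where
  open Residues n
  open Units n

  module Group (U : ℤ → Set)
    (U-resp : ∀ {y z} → y ≈ z → U y → U z)
    (U-1 : U 1ℤ)
    (U-* : ∀ {y z} → U y → U z → U (y * z))
    (U-inverse : ∀ {u} → U u → ∃[ v ] U v × u * v ≈ 1ℤ)
    (U-regular : ∀ {u} → U u → ∀ j → u * j ≈ j → j ≈ 0ℤ ⊎ u ≈ 1ℤ)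
    where

    -- Since u - v = v (u v⁻¹ - 1), regularity extends from the w - 1 with w in U to all
    -- differences. This stands in for the absence of zero divisors when roots are counted.
    U-difference : ∀ {u v} → U u → U v → ∀ j → (u - v) * j ≈ 0ℤ → j ≈ 0ℤ ⊎ u ≈ v
    U-difference {u} {v} uu uv j e =
      let w , uw , vw = U-inverse uv in
      Sum.map₂ (λ uw≈1 → comb₂ v (- u) uw≈1 vw (lemma₂ u v w))
        (U-regular (U-* uu uw) j (comb₂ w j e vw (lemma₁ u v w j)))
      where
        lemma₁ : ∀ u v w j → u * w * j - j ≡ w * ((u - v) * j - 0ℤ) + j * (v * w - 1ℤ)
        lemma₁ = solve-∀
        lemma₂ : ∀ u v w → u - v ≡ v * (u * w - 1ℤ) + - u * (v * w - 1ℤ)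
        lemma₂ = solve-∀

    U-^ : ∀ {u} → U u → ∀ i → U (u ℤ.^ i)
    U-^ uu zero    = U-1
    U-^ uu (suc i) = U-* uu (U-^ uu i)

    prod : List (Fin n) → ℤ
    prod = foldr (λ x p → ι x * p) 1ℤ

    prod-↭ : ∀ {xs ys} → xs ↭ ys → prod xs ≡ prod ys
    prod-↭ ↭.refl         = refl
    prod-↭ (↭.prep x p)   = cong (ι x *_) (prod-↭ p)
    prod-↭ {ys = _ ∷ _ ∷ ys} (↭.swap x y p) = trans (cong (λ z → ι x * (ι y * z)) (prod-↭ p)) (lemma (ι x) (ι y) (prod ys))
      where
        lemma : ∀ x y z → x * (y * z) ≡ y * (x * z)
        lemma = solve-∀
    prod-↭ (↭.trans p q)  = trans (prod-↭ p) (prod-↭ q)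

    scale : ℤ → Fin n → Fin n
    scale u x = ρ (u * ι x)

    prod-scale : ∀ u xs → prod (map (scale u) xs) ≈ u ℤ.^ length xs * prod xs
    prod-scale u []       = ≈-refl
    prod-scale u (x ∷ xs) = ≈-trans (*-cong (ι-ρ (u * ι x)) (prod-scale u xs))
        (≡⇒≈ (lemma u (ι x) (u ℤ.^ length xs) (prod xs)))
      where
        lemma : ∀ u x p q → u * x * (p * q) ≡ u * p * (x * q)
        lemma = solve-∀

    scale-injective : ∀ {u v} → u * v ≈ 1ℤ → ∀ {x y} → scale u x ≡ scale u y → x ≡ y
    scale-injective {u} {v} uv {x} {y} e = ι-injective (cancel {u} {v} uv
      (≈-trans (≈-sym (ι-ρ (u * ι x))) (≈-trans (ι-cong e) (ι-ρ (u * ι y)))))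

    U-prod : ∀ {xs} → All (U ∘ ι) xs → U (prod xs)
    U-prod []       = U-1
    U-prod (p ∷ ps) = U-* p (U-prod ps)

    module _ (xs : List (Fin n)) (unique : Unique xs) (xs⊆U : All (U ∘ ι) xs)
             (U⊆xs : ∀ x → U (ι x) → x ∈ xs) where

      abstract
        -- Euler's argument: multiplication by u permutes the list, so comparing the product of its
        -- elements before and after gives u ^ k P ≈ P, where P lies in U and is invertible.
        U-order : ∀ {u} → U u → u ℤ.^ length xs ≈ 1ℤ
        U-order {u} uu =
          let v , uv , u*v = U-inverse uu
              w , _ , Pw = U-inverse (U-prod xs⊆U)
              scaled↭ : map (scale u) xs ↭ xs
              scaled↭ = ∼bag⇒↭ (unique∧set⇒bag (Uniqueₚ.map⁺ {f = scale u} (scale-injective {u} {v} u*v) unique) unique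
                (λ {z} → mk⇔ (scaled⊆ z) (⊆scaled u*v uv z)))
          in comb₂ (1ℤ - u ℤ.^ length xs) w Pw
               (≈-trans (≈-sym (prod-scale u xs)) (≡⇒≈ (prod-↭ scaled↭)))
               (lemma₂ (u ℤ.^ length xs) (prod xs) w)
          where
            scaled⊆ : ∀ z → z ∈ map (scale u) xs → z ∈ xs
            scaled⊆ z z∈ = let x , x∈ , z≡ = ∈-map⁻ (scale u) z∈ in
              U⊆xs z (U-resp (≈-sym (≈-trans (ι-cong z≡) (ι-ρ (u * ι x)))) (U-* uu (All.lookup xs⊆U x∈)))
            lemma₁ : ∀ u v z r → u * r - z ≡ u * (r - v * z) + z * (u * v - 1ℤ)
            lemma₁ = solve-∀
            lemma₂ : ∀ p P w → p - 1ℤ ≡ (1ℤ - p) * (P * w - 1ℤ) + w * (p * P - P)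
            lemma₂ = solve-∀
            ⊆scaled : ∀ {v} → u * v ≈ 1ℤ → U v → ∀ z → z ∈ xs → z ∈ map (scale u) xs
            ⊆scaled {v} u*v uv z z∈ = subst (_∈ map (scale u) xs)
              (ι-injective (≈-trans (ι-ρ (u * ι (ρ (v * ι z)))) (comb₂ u (ι z) (ι-ρ (v * ι z)) u*v (lemma₁ u v (ι z) (ι (ρ (v * ι z)))))))
              (∈-map⁺ (scale u) (U⊆xs (ρ (v * ι z)) (U-resp (≈-sym (ι-ρ (v * ι z))) (U-* uv (All.lookup xs⊆U z∈)))))

    -- Four distinct elements are enough: an element of cube 1 is 1 or one of at most two roots of
    -- `Φ₃`, so not all four have cube 1, and the remaining possibility, cube -1, puts -1 into U.
    module Order6 (order : ∀ {u} → U u → u ℤ.^ 6 ≈ 1ℤ)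
      (x₁ x₂ x₃ x₄ : ℤ) (u₁ : U x₁) (u₂ : U x₂) (u₃ : U x₃) (u₄ : U x₄)
      (x₁₂ : x₁ ≉ x₂) (x₁₃ : x₁ ≉ x₃) (x₁₄ : x₁ ≉ x₄) (x₂₃ : x₂ ≉ x₃) (x₂₄ : x₂ ≉ x₄) (x₃₄ : x₃ ≉ x₄) where

      Φ₃ : ℤ → Set
      Φ₃ u = u * u + u + 1ℤ ≈ 0ℤ

      -- From u⁶ ≈ 1, multiplication by u³ fixes u³ + 1, and u³ belongs to U, so regularity applies
      -- with j = u³ + 1.
      cube≈±1 : ∀ {u} → U u → u ℤ.^ 3 ≈ -1ℤ ⊎ u ℤ.^ 3 ≈ 1ℤ
      cube≈±1 {u} uu = Sum.map₁ (λ e → comb₁ 1ℤ e (lemma₂ (u ℤ.^ 3)))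
          (U-regular (U-^ uu 3) (u ℤ.^ 3 + 1ℤ) (comb₁ 1ℤ (order uu) (lemma₁ u)))
        where
          lemma₁ : ∀ u → u * (u * (u * 1ℤ)) * (u * (u * (u * 1ℤ)) + 1ℤ) - (u * (u * (u * 1ℤ)) + 1ℤ)
            ≡ 1ℤ * (u * (u * (u * (u * (u * (u * 1ℤ))))) - 1ℤ)
          lemma₁ = solve-∀
          lemma₂ : ∀ v → v - -1ℤ ≡ 1ℤ * (v + 1ℤ - 0ℤ)
          lemma₂ = solve-∀

      cube≈1⇒ : ∀ {u} → U u → u ℤ.^ 3 ≈ 1ℤ → Φ₃ u ⊎ u ≈ 1ℤ
      cube≈1⇒ {u} uu e = U-regular uu (u * u + u + 1ℤ) (comb₁ 1ℤ e (lemma u))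
        where
          lemma : ∀ u → u * (u * u + u + 1ℤ) - (u * u + u + 1ℤ) ≡ 1ℤ * (u * (u * (u * 1ℤ)) - 1ℤ)
          lemma = solve-∀

      -- The difference of the two equations is (u - v)(u + v + 1). A root thus determines the other
      -- one as -1 - u, which excludes a third.
      two-Φ₃ : ∀ {u v} → U u → U v → Φ₃ u → Φ₃ v → u ≉ v → u + v + 1ℤ ≈ 0ℤ
      two-Φ₃ {u} {v} uu uv pu pv u≉v = Sum.[ id , (λ u≈v → contradiction u≈v u≉v) ]′
          (U-difference uu uv (u + v + 1ℤ) (comb₂ 1ℤ -1ℤ pu pv (lemma u v)))
        where
          lemma : ∀ u v → (u - v) * (u + v + 1ℤ) - 0ℤ ≡ 1ℤ * (u * u + u + 1ℤ - 0ℤ) + -1ℤ * (v * v + v + 1ℤ - 0ℤ)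
          lemma = solve-∀

      ¬three-Φ₃ : ∀ {u v w} → U u → U v → U w → Φ₃ u → Φ₃ v → Φ₃ w → u ≉ v → u ≉ w → ¬ (v ≉ w)
      ¬three-Φ₃ {u} {v} {w} uu uv uw pu pv pw u≉v u≉w v≉w =
          v≉w (comb₂ 1ℤ -1ℤ (two-Φ₃ uu uv pu pv u≉v) (two-Φ₃ uu uw pu pw u≉w) (lemma u v w))
        where
          lemma : ∀ u v w → v - w ≡ 1ℤ * (u + v + 1ℤ - 0ℤ) + -1ℤ * (u + w + 1ℤ - 0ℤ)
          lemma = solve-∀

      Φ₃⊎1 : ℤ → Set
      Φ₃⊎1 u = Φ₃ u ⊎ u ≈ 1ℤ

      ¬all-Φ₃⊎1 : Φ₃⊎1 x₁ → Φ₃⊎1 x₂ → Φ₃⊎1 x₃ → ¬ Φ₃⊎1 x₄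
      ¬all-Φ₃⊎1 = go
        where
          both : ∀ {u v} → u ≈ 1ℤ → v ≈ 1ℤ → ¬ (u ≉ v)
          both p q r = r (≈-trans p (≈-sym q))
          go : Φ₃⊎1 x₁ → Φ₃⊎1 x₂ → Φ₃⊎1 x₃ → ¬ Φ₃⊎1 x₄
          go (inj₁ p) (inj₁ q) (inj₁ r) _        = ¬three-Φ₃ u₁ u₂ u₃ p q r x₁₂ x₁₃ x₂₃
          go (inj₁ p) (inj₁ q) (inj₂ r) (inj₁ s) = ¬three-Φ₃ u₁ u₂ u₄ p q s x₁₂ x₁₄ x₂₄
          go (inj₁ p) (inj₂ q) (inj₁ r) (inj₁ s) = ¬three-Φ₃ u₁ u₃ u₄ p r s x₁₃ x₁₄ x₃₄
          go (inj₂ p) (inj₁ q) (inj₁ r) (inj₁ s) = ¬three-Φ₃ u₂ u₃ u₄ q r s x₂₃ x₂₄ x₃₄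
          go (inj₂ p) (inj₂ q) _        _        = both p q x₁₂
          go (inj₂ p) (inj₁ q) (inj₂ r) _        = both p r x₁₃
          go (inj₂ p) (inj₁ q) (inj₁ r) (inj₂ s) = both p s x₁₄
          go (inj₁ p) (inj₂ q) (inj₂ r) _        = both q r x₂₃
          go (inj₁ p) (inj₂ q) (inj₁ r) (inj₂ s) = both q s x₂₄
          go (inj₁ p) (inj₁ q) (inj₂ r) (inj₂ s) = both r s x₃₄

      abstract
        U--1 : U -1ℤ
        U--1 = go (cube≈±1 u₁) (cube≈±1 u₂) (cube≈±1 u₃) (cube≈±1 u₄)
          where
            Cube : ℤ → Set
            Cube u = u ℤ.^ 3 ≈ -1ℤ ⊎ u ℤ.^ 3 ≈ 1ℤ
            found : ∀ {u} → U u → u ℤ.^ 3 ≈ -1ℤ → U -1ℤ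
            found uu e = U-resp e (U-^ uu 3)
            go : Cube x₁ → Cube x₂ → Cube x₃ → Cube x₄ → U -1ℤ
            go (inj₁ e) _ _ _ = found u₁ e
            go (inj₂ _) (inj₁ e) _ _ = found u₂ e
            go (inj₂ _) (inj₂ _) (inj₁ e) _ = found u₃ e
            go (inj₂ _) (inj₂ _) (inj₂ _) (inj₁ e) = found u₄ e
            go (inj₂ p) (inj₂ q) (inj₂ r) (inj₂ s) = ⊥-elim
              (¬all-Φ₃⊎1 (cube≈1⇒ u₁ p) (cube≈1⇒ u₂ q) (cube≈1⇒ u₃ r) (cube≈1⇒ u₄ s))

      U-neg : ∀ {u} → U u → U (- u)
      U-neg {u} uu = U-resp (≡⇒≈ (ℤₚ.-1*i≡-i u)) (U-* U--1 uu)

      neg-cube : ∀ {u} → u ℤ.^ 3 ≈ -1ℤ → (- u) ℤ.^ 3 ≈ 1ℤ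
      neg-cube {u} e = comb₁ -1ℤ e (lemma u)
        where
          lemma : ∀ u → - u * (- u * (- u * 1ℤ)) - 1ℤ ≡ -1ℤ * (u * (u * (u * 1ℤ)) - -1ℤ)
          lemma = solve-∀

      abstract
        -- Of three distinct elements one is neither 1 nor -1; its cube is 1 or -1, and accordingly
        -- it or its negative is a root of `Φ₃`.
        Φ₃-witness : ∃[ w ] U w × Φ₃ w
        Φ₃-witness = go (classify u₁) (classify u₂) (classify u₃)
          where
            Class : ℤ → Set
            Class u = (∃[ w ] U w × Φ₃ w) ⊎ u ≈ 1ℤ ⊎ u ≈ -1ℤ
            classify : ∀ {u} → U u → Class u
            classify {u} uu = by-cube (cube≈±1 uu)
              where
                unneg : - u ≈ 1ℤ → u ≈ -1ℤ
                unneg e = comb₁ -1ℤ e (lemma u)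
                  where
                    lemma : ∀ u → u - -1ℤ ≡ -1ℤ * (- u - 1ℤ)
                    lemma = solve-∀
                by-cube : u ℤ.^ 3 ≈ -1ℤ ⊎ u ℤ.^ 3 ≈ 1ℤ → Class u
                by-cube (inj₂ e) = Sum.map (λ p → u , uu , p) inj₁ (cube≈1⇒ uu e)
                by-cube (inj₁ e) = Sum.map (λ p → - u , U-neg uu , p) (λ p → inj₂ (unneg p)) (cube≈1⇒ (U-neg uu) (neg-cube {u} e))
            same : ∀ {u v c} → u ≈ c → v ≈ c → u ≉ v → ∃[ w ] U w × Φ₃ w
            same p q r = ⊥-elim (r (≈-trans p (≈-sym q)))
            go : Class x₁ → Class x₂ → Class x₃ → ∃[ w ] U w × Φ₃ w
            go (inj₁ f) _ _ = f
            go (inj₂ _) (inj₁ f) _ = f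
            go (inj₂ _) (inj₂ _) (inj₁ f) = f
            go (inj₂ (inj₁ p)) (inj₂ (inj₁ q)) _ = same p q x₁₂
            go (inj₂ (inj₂ p)) (inj₂ (inj₂ q)) _ = same p q x₁₂
            go (inj₂ (inj₁ p)) (inj₂ (inj₂ _)) (inj₂ (inj₁ q)) = same p q x₁₃
            go (inj₂ (inj₂ p)) (inj₂ (inj₁ _)) (inj₂ (inj₂ q)) = same p q x₁₃
            go (inj₂ (inj₁ _)) (inj₂ (inj₂ p)) (inj₂ (inj₂ q)) = same p q x₂₃
            go (inj₂ (inj₂ _)) (inj₂ (inj₁ p)) (inj₂ (inj₁ q)) = same p q x₂₃

      α : ℤ
      α = - proj₁ Φ₃-witness

      root : IsRoot α
      root = comb₁ 1ℤ (proj₂ (proj₂ Φ₃-witness)) (lemma (proj₁ Φ₃-witness))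
        where
          lemma : ∀ w → - w * - w - - w + 1ℤ - 0ℤ ≡ 1ℤ * (w * w + w + 1ℤ - 0ℤ)
          lemma = solve-∀

      U-α : U α
      U-α = U-neg (proj₁ (proj₂ Φ₃-witness))

      private module R = Root {α} root

      Six⇒U : ∀ {z} → Six α z → U z
      Six⇒U (k , e) = U-resp (≈-trans (≈-sym (R.unit≈^ k)) (≈-sym e)) (U-^ U-α (toℕ k))

      U⇒Six : ∀ {z} → U z → Six α z
      U⇒Six {z} uz = by-cube (cube≈±1 uz)
        where
          Φ₃⇒Six : ∀ {y} → U y → Φ₃ y → Six α y
          -- The equations for y and α differ by (y + α)(y - α + 1), whose first factor is a
          -- difference of elements of U; hence y is -α or α - 1.
          Φ₃⇒Six {y} uy p = from-factor (U-difference uy (U-neg U-α) (y - α + 1ℤ) (comb₂ 1ℤ -1ℤ p root (lemma₁ y α)))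
            where
              lemma₁ : ∀ y α → (y - - α) * (y - α + 1ℤ) - 0ℤ ≡ 1ℤ * (y * y + y + 1ℤ - 0ℤ) + -1ℤ * (α * α - α + 1ℤ - 0ℤ)
              lemma₁ = solve-∀
              lemma₂ : ∀ y α → α - 1ℤ - y ≡ -1ℤ * (y - α + 1ℤ - 0ℤ)
              lemma₂ = solve-∀
              from-factor : y - α + 1ℤ ≈ 0ℤ ⊎ y ≈ - α → Six α y
              from-factor (inj₁ e) = Six-resp (comb₁ -1ℤ e (lemma₂ y α)) (# 2 , ≡⇒≈ (ev-α-1 α))
              from-factor (inj₂ e) = Six-resp (≈-sym e) (R.Six-neg Six-α)
          cube≈1⇒Six : ∀ {y} → U y → y ℤ.^ 3 ≈ 1ℤ → Six α y
          cube≈1⇒Six uy e = Sum.[ Φ₃⇒Six uy , (λ y≈1 → Six-resp (≈-sym y≈1) Six-1) ]′ (cube≈1⇒ uy e)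
          by-cube : z ℤ.^ 3 ≈ -1ℤ ⊎ z ℤ.^ 3 ≈ 1ℤ → Six α z
          by-cube (inj₂ e) = cube≈1⇒Six uz e
          by-cube (inj₁ e) = Six-resp (≡⇒≈ (ℤₚ.neg-involutive z)) (R.Six-neg (cube≈1⇒Six (U-neg uz) (neg-cube {z} e)))

      -- Modulo α² - α + 1 one has (α + 1)² = 3 α, so n = 3 m would make (α + 1)² annihilate m. The
      -- factor α + 1 = α - (-1) is cancelled twice, leaving m ≈ 0, against 0 < m < n, or α ≈ -1,
      -- which would make 3 vanish.
      3∤n : 3 ℕ.< n → ¬ 3 ℕ∣.∣ n
      3∤n 3<n (ℕ∣.divides m n≡m*3) = Sum.[ (λ e → Sum.[ m≉0 , α≉-1 ]′ (regular+1 (+ m) e)) , α≉-1 ]′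
          (regular+1 ((α + 1ℤ) * + m) (comb₂ (+ m) α root (≈-trans (≡⇒≈ (trans (sym (ℤₚ.pos-* m 3)) (cong +_ (sym n≡m*3)))) n≈0) (lemma₁ α (+ m))))
        where
          lemma₁ : ∀ α m → (α + 1ℤ) * ((α + 1ℤ) * m) - 0ℤ ≡ m * (α * α - α + 1ℤ - 0ℤ) + α * (m * + 3 - 0ℤ)
          lemma₁ = solve-∀
          lemma₂ : ∀ α j → (α - -1ℤ) * j ≡ (α + 1ℤ) * j
          lemma₂ = solve-∀
          lemma₃ : ∀ α → + 3 - 0ℤ ≡ 1ℤ * (α * α - α + 1ℤ - 0ℤ) + (+ 2 - α) * (α - -1ℤ)
          lemma₃ = solve-∀
          regular+1 : ∀ j → (α + 1ℤ) * j ≈ 0ℤ → j ≈ 0ℤ ⊎ α ≈ -1ℤ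
          regular+1 j e = U-difference U-α U--1 j (≈-trans (≡⇒≈ (lemma₂ α j)) e)
          α≉-1 : α ≉ -1ℤ
          α≉-1 e = ℕ∣.>⇒∤ 3<n (≈0⇒∣ (comb₂ 1ℤ (+ 2 - α) root e (lemma₃ α)))
          instance m≢0 : NonZero m
          m≢0 = ℕ.≢-nonZero λ { refl → contradiction (subst (3 ℕ.<_) n≡m*3 3<n) λ () }
          m≉0 : + m ≉ 0ℤ
          m≉0 e = ℕ∣.>⇒∤ (subst (m ℕ.<_) (sym n≡m*3) (ℕₚ.m<m*n m 3 (s≤s (s≤s z≤n)))) (≈0⇒∣ e)

-- Action of the point stabiliser on a cyclic Frobenius kernel

iter-+ : ∀ {A : Set} (f : A → A) i j x → iter f (i ℕ.+ j) x ≡ iter f i (iter f j x)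
iter-+ f zero    j x = refl
iter-+ f (suc i) j x = cong f (iter-+ f i j x)

iter-multiple : ∀ {A : Set} (f : A → A) m → iter f m ≗ id → ∀ q → iter f (q ℕ.* m) ≗ id
iter-multiple f m e zero    x = refl
iter-multiple f m e (suc q) x = trans (iter-+ f m (q ℕ.* m) x) (trans (e _) (iter-multiple f m e q x))

module FrobeniusStructure (n : ℕ) ⦃ nz : NonZero n ⦄ (7≤n : 7 ℕ.≤ n) {G : PermSet n} {S : Sub n}
  (F : FirstKindFrobeniusGraph n G S) where

  open Residues n
  open FirstKindFrobeniusGraph F using (κ; κ-gen; κ-order; ω)
  open IsFrobenius (FirstKindFrobeniusGraph.frobenius F)
  open IsPermGroup group
  open Equivalence

  private
    κ∈K = FirstKindFrobeniusGraph.κ∈K F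
    Gκ = proj₁ κ∈K
    H = Stab G ω

  -- Because κ has order n its exponents may be taken in ℤ up to congruence, which makes exponent
  -- arithmetic available to the ring solver.
  pw : ℤ → Perm n
  pw z = iter κ (toℕ (ρ z))

  pw-cong : ∀ {y z} → y ≈ z → ∀ x → pw y x ≡ pw z x
  pw-cong e x = cong (λ r → iter κ (toℕ r) x) (ρ-cong e)

  iter-% : ∀ i x → iter κ i x ≡ iter κ (i % n) x
  iter-% i x = begin
    iter κ i x                                            ≡⟨ cong (λ j → iter κ j x) (ℕD.m≡m%n+[m/n]*n i n) ⟩
    iter κ (i % n ℕ.+ (i ℕD./ n) ℕ.* n) x                 ≡⟨ iter-+ κ (i % n) _ x ⟩
    iter κ (i % n) (iter κ ((i ℕD./ n) ℕ.* n) x)          ≡⟨ cong (iter κ (i % n)) (iter-multiple κ n (proj₁ κ-order) (i ℕD./ n) x) ⟩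
    iter κ (i % n) x                                      ∎
    where open ≡-Reasoning

  iter-cong : ∀ {i j} → + i ≈ + j → ∀ x → iter κ i x ≡ iter κ j x
  iter-cong {i} {j} e x = trans (iter-% i x) (trans (cong (λ r → iter κ r x) (≈⇒% e)) (sym (iter-% j x)))

  iter≡pw : ∀ i x → iter κ i x ≡ pw (+ i) x
  iter≡pw i = iter-cong (≈-sym (ι-ρ (+ i)))

  pw-+ : ∀ y z x → pw (y + z) x ≡ pw y (pw z x)
  pw-+ y z x = trans (iter-cong (≈-trans (ι-ρ (y + z)) (+-cong (≈-sym (ι-ρ y)) (≈-sym (ι-ρ z)))) x)
    (iter-+ κ (toℕ (ρ y)) (toℕ (ρ z)) x)

  pw-0 : ∀ x → pw 0ℤ x ≡ x
  pw-0 x = sym (iter≡pw 0 x)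

  pw-1 : ∀ x → κ x ≡ pw 1ℤ x
  pw-1 = iter≡pw 1

  κ-free : ∀ x → κ x ≢ x
  κ-free = Sum.[ (λ κ≗id → ⊥-elim (proj₂ κ-order 1 (s≤s z≤n) (ℕₚ.≤-trans (s≤s (s≤s z≤n)) 7≤n) κ≗id)) , id ]′ (proj₂ κ∈K)

  G-iter : ∀ i → G (iter κ i)
  G-iter zero    = has-id
  G-iter (suc i) = closed Gκ (G-iter i)

  iter-commute : ∀ i x → iter κ i (κ x) ≡ κ (iter κ i x)
  iter-commute i x = trans (sym (iter-+ κ i 1 x)) (cong (λ j → iter κ j x) (ℕₚ.+-comm i 1))

  -- A power of κ fixing x also fixes κ x ≠ x.
  iter-fixes⇒id : ∀ i {x} → iter κ i x ≡ x → iter κ i ≗ id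
  iter-fixes⇒id i {x} e = twoPoints (iter κ i) x (κ x) (G-iter i) (λ x≡κx → κ-free x (sym x≡κx)) e
    (trans (iter-commute i x) (cong κ e))

  pw-fixes⇒≈0 : ∀ z {x} → pw z x ≡ x → z ≈ 0ℤ
  pw-fixes⇒≈0 z {x} e = ≈-trans (≈-sym (ι-ρ z)) (≡⇒≈ (cong +_ toℕ≡0))
    where
      i = toℕ (ρ z)
      toℕ≡0 : i ≡ 0
      toℕ≡0 with i ℕₚ.≟ 0
      ... | yes i≡0 = i≡0
      ... | no  i≢0 = ⊥-elim (proj₂ κ-order i (ℕₚ.n≢0⇒n>0 i≢0) (Finₚ.toℕ<n (ρ z)) (iter-fixes⇒id i e))

  pw-injective : ∀ {y z x} → pw y x ≡ pw z x → y ≈ z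
  pw-injective {y} {z} {x} e = comb₁ 1ℤ (pw-fixes⇒≈0 (y - z) {pw z x} (trans (sym (pw-+ (y - z) z x))
      (trans (pw-cong (≡⇒≈ (lemma₁ y z)) x) e))) (lemma₂ y z)
    where
      lemma₁ : ∀ y z → y - z + z ≡ y
      lemma₁ = solve-∀
      lemma₂ : ∀ y z → y - z ≡ 1ℤ * (y - z - 0ℤ)
      lemma₂ = solve-∀

  -- The relation h κ h⁻¹ = κ ^ u, written without the inverse.
  Normalises : Perm n → ℤ → Set
  Normalises h u = ∀ x → h (κ x) ≡ pw u (h x)

  normalises-iter : ∀ {h u} → Normalises h u → ∀ j x → h (iter κ j x) ≡ pw (u * + j) (h x)
  normalises-iter {h} {u} N zero    x = trans (sym (pw-0 (h x))) (pw-cong (≡⇒≈ (sym (ℤₚ.*-zeroʳ u))) (h x))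
  normalises-iter {h} {u} N (suc j) x = trans (N (iter κ j x)) (trans (cong (pw u) (normalises-iter N j x))
      (trans (sym (pw-+ u (u * + j) (h x))) (pw-cong (≡⇒≈ (lemma u (+ j))) (h x))))
    where
      lemma : ∀ u j → u + u * j ≡ u * (1ℤ + j)
      lemma = solve-∀

  normalises-pw : ∀ {h u} → Normalises h u → ∀ z x → h (pw z x) ≡ pw (u * z) (h x)
  normalises-pw {h} {u} N z x = trans (normalises-iter N (toℕ (ρ z)) x) (pw-cong (*-congˡ u (ι-ρ z)) (h x))

  -- A conjugate of the fixed-point-free κ is again fixed-point-free, hence in the kernel, where
  -- `κ-gen` makes it a power of κ.
  normaliser : ∀ {h} → G h → ∃[ u ] Normalises h u
  normaliser {h} Gh =
    let h⁻¹ , Gh⁻¹ , hh⁻¹ , h⁻¹h = inverses Gh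
        i , hκh⁻¹≗ = κ-gen (h ∘ κ ∘ h⁻¹) (closed Gh (closed Gκ Gh⁻¹) ,
          inj₂ λ x e → κ-free (h⁻¹ x) (trans (sym (h⁻¹h (κ (h⁻¹ x)))) (cong h⁻¹ e)))
    in + i , λ x → trans (cong (h ∘ κ) (sym (h⁻¹h x))) (trans (hκh⁻¹≗ (h x)) (iter≡pw i (h x)))

  -- Under i ↦ κ ^ i ω the point stabiliser acts on ℤ/n by multiplication by the u with U u.
  U : ℤ → Set
  U u = ∃[ h ] H h × Normalises h u

  U-resp : ∀ {y z} → y ≈ z → U y → U z
  U-resp e (h , Hh , N) = h , Hh , λ x → trans (N x) (pw-cong e (h x))

  U-1 : U 1ℤ
  U-1 = id , (has-id , refl) , pw-1

  U-* : ∀ {y z} → U y → U z → U (y * z)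
  U-* {y} {z} (g , (Gg , gω) , M) (h , (Gh , hω) , N) = g ∘ h , (closed Gg Gh , trans (cong g hω) gω) ,
    λ x → trans (cong g (N x)) (normalises-pw M z (h x))

  U-inverse : ∀ {u} → U u → ∃[ v ] U v × u * v ≈ 1ℤ
  U-inverse {u} (h , (Gh , hω) , M) =
    let h⁻¹ , Gh⁻¹ , hh⁻¹ , h⁻¹h = inverses Gh
        v , N = normaliser Gh⁻¹
    in v , (h⁻¹ , (Gh⁻¹ , trans (cong h⁻¹ (sym hω)) (h⁻¹h ω)) , N) ,
       ≈-sym (pw-injective {x = ω} (trans (sym (pw-1 ω)) (trans (sym (hh⁻¹ (κ ω)))
         (trans (cong h (N ω)) (trans (normalises-pw M v (h⁻¹ ω)) (cong (pw (u * v)) (hh⁻¹ ω)))))))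

  -- When u j ≈ j, the element h fixes both ω and κ ^ j ω. Either these points coincide and j ≈ 0,
  -- or the Frobenius condition makes h the identity and u ≈ 1.
  U-regular : ∀ {u} → U u → ∀ j → u * j ≈ j → j ≈ 0ℤ ⊎ u ≈ 1ℤ
  U-regular {u} (h , (Gh , hω) , N) j e with pw j ω Finₚ.≟ ω
  ... | yes fixed = inj₁ (pw-fixes⇒≈0 j fixed)
  ... | no moved  = inj₂ (≈-sym (pw-injective {x = ω} (trans (sym (pw-1 ω)) (trans (sym (h≗id (κ ω)))
          (trans (N ω) (cong (pw u) hω))))))
    where
      h≗id : h ≗ id
      h≗id = twoPoints h ω (pw j ω) Gh (λ e → moved (sym e)) hω
        (trans (normalises-pw N j ω) (trans (cong (pw (u * j)) hω) (pw-cong e ω)))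

  s : ℤ
  s = + proj₁ (κ-gen (FirstKindFrobeniusGraph.a F) (FirstKindFrobeniusGraph.a∈K F))

  a≗pw-s : ∀ x → FirstKindFrobeniusGraph.a F x ≡ pw s x
  a≗pw-s x = trans (proj₂ (κ-gen (FirstKindFrobeniusGraph.a F) (FirstKindFrobeniusGraph.a∈K F)) x) (iter≡pw _ x)

  conjugate≗pw : ∀ c → Conj H (FirstKindFrobeniusGraph.a F) c → ∃[ u ] U u × (∀ x → c x ≡ pw (u * s) x)
  conjugate≗pw c (h , (Gh , hω) , e) =
    let h⁻¹ , _ , hh⁻¹ , _ = inverses Gh
        u , N = normaliser Gh
    in u , (h , (Gh , hω) , N) , λ x → trans (cong c (sym (hh⁻¹ x))) (trans (e (h⁻¹ x)) (trans (cong h (a≗pw-s (h⁻¹ x)))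
         (trans (normalises-pw N s (h⁻¹ x)) (cong (pw (u * s)) (hh⁻¹ x)))))

  product≗pw : ∀ {cs} → All (Conj H (FirstKindFrobeniusGraph.a F)) cs →
    ∃[ t ] (∀ x → foldr (λ f h → f ∘ h) (λ x → x) cs x ≡ pw (s * t) x)
  product≗pw [] = 0ℤ , λ x → trans (sym (pw-0 x)) (pw-cong (≡⇒≈ (sym (ℤₚ.*-zeroʳ s))) x)
  product≗pw (_∷_ {x = c} {xs = cs} conj conjs) =
    let u , _ , c≗ = conjugate≗pw c conj
        t , cs≗ = product≗pw conjs
    in u + t , λ x → trans (c≗ _) (trans (cong (pw (u * s)) (cs≗ x))
         (trans (sym (pw-+ (u * s) (s * t) x)) (pw-cong (≡⇒≈ (lemma u s t)) x)))
    where
      lemma : ∀ u s t → u * s + s * t ≡ s * (u + t)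
      lemma = solve-∀

  -- Every product of conjugates of a = κ ^ s is a power of κ with exponent a multiple of s, and κ
  -- itself is such a product.
  s-invertible : ∃[ t ] s * t ≈ 1ℤ
  s-invertible =
    let cs , conjs , product≗κ = FirstKindFrobeniusGraph.generates F κ κ∈K
        t , product≗ = product≗pw conjs
    in t , pw-injective {x = ω} (trans (sym (product≗ ω)) (trans (product≗κ ω) (pw-1 ω)))

  S⇒ : ∀ {x} → S x → ∃[ u ] U u × ι x ≈ u * s
  S⇒ {x} sx = let u , uu , c≗ = conjugate≗pw (iter κ (toℕ x)) (to (FirstKindFrobeniusGraph.conn F x) sx) in
    u , uu , pw-injective {x = ω} (trans (cong (λ r → iter κ (toℕ r) ω) (ρ-ι x)) (c≗ ω))

  ⇒S : ∀ {x u} → U u → ι x ≈ u * s → S x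
  ⇒S {x} {u} (h , Hh , N) e = from (FirstKindFrobeniusGraph.conn F x) (h , Hh , λ y →
    trans (iter≡pw (toℕ x) (h y)) (trans (pw-cong e (h y)) (trans (sym (normalises-pw N s y)) (cong h (sym (a≗pw-s y))))))

  private
    t = proj₁ s-invertible
    st = proj₂ s-invertible

  module SR = Semiregular.Group n U U-resp U-1 U-* U-inverse U-regular

  -- The connection set is s U, so division by s converts its list of six elements into a list of U.
  divide : Fin n → Fin n
  divide x = ρ (t * ι x)

  divide∈U : ∀ {x} → S x → U (ι (divide x))
  divide∈U {x} sx = let u , uu , e = S⇒ sx in
      U-resp (≈-sym (≈-trans (ι-ρ (t * ι x)) (comb₂ t u e st (lemma t (ι x) u s)))) uu
    where
      lemma : ∀ t x u s → t * x - u ≡ t * (x - u * s) + u * (s * t - 1ℤ)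
      lemma = solve-∀

  divide-multiply : ∀ z → ι (divide (ρ (z * s))) ≈ z
  divide-multiply z = ≈-trans (ι-ρ (t * ι (ρ (z * s)))) (comb₂ t z (ι-ρ (z * s)) st (lemma t z s (ι (ρ (z * s)))))
    where
      lemma : ∀ t z s r → t * r - z ≡ t * (r - z * s) + z * (s * t - 1ℤ)
      lemma = solve-∀

  module Sixth (S-size : HasSize S _≡_ 6) where
    private
      xs = proj₁ S-size
      ys = map divide xs

      length-ys : length ys ≡ 6
      length-ys = trans (length-map divide xs) (proj₁ (proj₂ S-size))

      unique-ys : Unique ys
      unique-ys = Uniqueₚ.map⁺ {f = divide} (SR.scale-injective {t} {s} (≈-trans (≡⇒≈ (ℤₚ.*-comm t s)) st))
        (proj₁ (proj₂ (proj₂ (proj₂ S-size))))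

      ys⊆U : All (U ∘ ι) ys
      ys⊆U = Allₚ.map⁺ (All.map divide∈U (proj₁ (proj₂ (proj₂ S-size))))

      U⊆ys : ∀ x → U (ι x) → x ∈ ys
      U⊆ys x ux = subst (_∈ ys) (ι-injective (divide-multiply (ι x)))
        (∈-map⁺ divide (proj₂ (proj₂ (proj₂ (proj₂ S-size))) (ρ (ι x * s)) (⇒S ux (ι-ρ (ι x * s)))))

      order : ∀ {u} → U u → u ℤ.^ 6 ≈ 1ℤ
      order {u} uu = subst (λ k → u ℤ.^ k ≈ 1ℤ) length-ys (SR.U-order ys unique-ys ys⊆U U⊆ys uu)

    open Units n using (Six)

    Structure : Set
    Structure = n % 6 ≡ 1 × ∃[ α ] IsRoot α × (∀ {z} → U z → Six α z) × (∀ {z} → Six α z → U z)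

    private
      from-four : ∀ y₁ y₂ y₃ y₄ → U (ι y₁) → U (ι y₂) → U (ι y₃) → U (ι y₄) →
        y₁ ≢ y₂ → y₁ ≢ y₃ → y₁ ≢ y₄ → y₂ ≢ y₃ → y₂ ≢ y₄ → y₃ ≢ y₄ → Structure
      from-four y₁ y₂ y₃ y₄ u₁ u₂ u₃ u₄ y₁₂ y₁₃ y₁₄ y₂₃ y₂₄ y₃₄ =
          root⇒%6≡1 n {O.α} O.root (O.3∤n (ℕₚ.≤-trans (s≤s (s≤s (s≤s (s≤s z≤n)))) 7≤n)) ,
          O.α , O.root , O.U⇒Six , O.Six⇒U
        where
          ≢⇒≉ : ∀ {x y} → x ≢ y → ι x ≉ ι y
          ≢⇒≉ x≢y e = x≢y (ι-injective e)
          module O = SR.Order6 order (ι y₁) (ι y₂) (ι y₃) (ι y₄) u₁ u₂ u₃ u₄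
            (≢⇒≉ y₁₂) (≢⇒≉ y₁₃) (≢⇒≉ y₁₄) (≢⇒≉ y₂₃) (≢⇒≉ y₂₄) (≢⇒≉ y₃₄)

      from-list : ∀ ys → length ys ≡ 6 → Unique ys → All (U ∘ ι) ys → Structure
      from-list (y₁ ∷ y₂ ∷ y₃ ∷ y₄ ∷ _) _ ((y₁₂ ∷ y₁₃ ∷ y₁₄ ∷ _) ∷ (y₂₃ ∷ y₂₄ ∷ _) ∷ (y₃₄ ∷ _) ∷ _) (u₁ ∷ u₂ ∷ u₃ ∷ u₄ ∷ _) =
        from-four y₁ y₂ y₃ y₄ u₁ u₂ u₃ u₄ y₁₂ y₁₃ y₁₄ y₂₃ y₂₄ y₃₄

    abstract
      structure : Structure
      structure = from-list ys length-ys unique-ys ys⊆U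

-- From a Frobenius circulant to a solution of the congruence

module Circulant (n : ℕ) ⦃ nz : NonZero n ⦄ (7≤n : 7 ℕ.≤ n) {S : Sub n} (circ : FrobCirc n S) where
  open Residues n
  open Units n
  open Equivalence
  open FrobeniusStructure n 7≤n (proj₂ (proj₂ circ))
  open Sixth (proj₁ circ)

  n%6≡1 : n % 6 ≡ 1
  n%6≡1 = proj₁ structure

  private
    α′ : ℤ
    α′ = proj₁ (proj₂ structure)
    root′ : IsRoot α′
    root′ = proj₁ (proj₂ (proj₂ structure))

  a : ℕ
  a = toℕ (ρ α′)

  a<n : a ℕ.< n
  a<n = Finₚ.toℕ<n (ρ α′)

  root : IsRoot (+ a)
  root = IsRoot-resp (≈-sym (ι-ρ α′)) root′

  sol : IsSol n a
  sol = IsRoot⇒IsSol root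

  U⇒Six : ∀ {z} → U z → Six (+ a) z
  U⇒Six uz = Six-cong (≈-sym (ι-ρ α′)) (proj₁ (proj₂ (proj₂ (proj₂ structure))) uz)

  Six⇒U : ∀ {z} → Six (+ a) z → U z
  Six⇒U sz = proj₂ (proj₂ (proj₂ (proj₂ structure))) (Six-cong (ι-ρ α′) sz)

  private
    t = proj₁ s-invertible
    st : s * t ≈ 1ℤ
    st = proj₂ s-invertible
    T : Sub n
    T = TL n a (a ℕ.∸ 1) 1
    module A = Affine n 7≤n n%6≡1 a a<n sol

  -- If 1 lies in s U, then s is the inverse of an element of U, so s lies in U and s U = U.
  S⇔TL : S ([_] n 1) → _≐_ n S T
  S⇔TL S1 x = mk⇔ forward backward
    where
      v = proj₁ (S⇒ S1)
      v∈U = proj₁ (proj₂ (S⇒ S1))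
      vs≈1 : v * s ≈ 1ℤ
      vs≈1 = ≈-trans (≈-sym (proj₂ (proj₂ (S⇒ S1)))) (ι-mod 1)
      w = proj₁ (U-inverse v∈U)
      w∈U = proj₁ (proj₂ (U-inverse v∈U))
      s≈w : w ≈ s
      s≈w = comb₂ s (- w) (proj₂ (proj₂ (U-inverse v∈U))) vs≈1 (lemma v w s)
        where
          lemma : ∀ v w s → w - s ≡ s * (v * w - 1ℤ) + - w * (v * s - 1ℤ)
          lemma = solve-∀
      s∈U : U s
      s∈U = U-resp s≈w w∈U
      forward : S x → T x
      forward sx = let u , uu , e = S⇒ sx in from A.S⇔Six (U⇒Six (U-resp (≈-sym e) (U-* uu s∈U)))
      backward : T x → S x
      backward tx = ⇒S (U-* (Six⇒U (to A.S⇔Six tx)) v∈U)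
          (comb₁ (- ι x) vs≈1 (lemma (ι x) v s))
        where
          lemma : ∀ x v s → x - x * v * s ≡ - x * (v * s - 1ℤ)
          lemma = solve-∀

  -- Multiplication by t = s⁻¹ carries the connection set s U to U.
  isoTL : Iso n S T
  isoTL = f , (injective , surjective) , λ x y → mk⇔ (forward x y) (backward x y)
    where
      f : Perm n
      f x = ρ (t * ι x)
      ι-f : ∀ x → ι (f x) ≈ t * ι x
      ι-f x = ι-ρ (t * ι x)
      s*f : ∀ x → s * ι (f x) ≈ ι x
      s*f x = comb₂ s (ι x) (ι-f x) st (lemma s t (ι x) (ι (f x)))
        where
          lemma : ∀ s t x fx → s * fx - x ≡ s * (fx - t * x) + x * (s * t - 1ℤ)
          lemma = solve-∀
      injective : ∀ x y → f x ≡ f y → x ≡ y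
      injective x y e = ι-injective (≈-trans (≈-sym (s*f x)) (≈-trans (*-congˡ s (ι-cong e)) (s*f y)))
      surjective : ∀ y → ∃[ x ] f x ≡ y
      surjective y = ρ (s * ι y) , ι-injective (≈-trans (ι-f (ρ (s * ι y)))
          (comb₂ t (ι y) (ι-ρ (s * ι y)) st (lemma s t (ι y) (ι (ρ (s * ι y))))))
        where
          lemma : ∀ s t y r → t * r - y ≡ t * (r - s * y) + y * (s * t - 1ℤ)
          lemma = solve-∀
      ι-f-diff : ∀ x y → ι (_⊕_ n (f x) (⊖_ n (f y))) ≈ t * ι (_⊕_ n x (⊖_ n y))
      ι-f-diff x y = ≈-trans (ι-diff (f x) (f y)) (≈-trans (+-cong (ι-f x) (neg-cong (ι-f y)))
          (≈-trans (≡⇒≈ (lemma t (ι x) (ι y))) (*-congˡ t (≈-sym (ι-diff x y)))))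
        where
          lemma : ∀ t x y → t * x - t * y ≡ t * (x - y)
          lemma = solve-∀
      forward : ∀ x y → Adj n S x y → Adj n T (f x) (f y)
      forward x y adj = let u , uu , e = S⇒ adj in
          from A.S⇔Six (U⇒Six (U-resp (≈-sym (≈-trans (ι-f-diff x y)
            (comb₂ t u e st (lemma s t (ι (_⊕_ n x (⊖_ n y))) u)))) uu))
        where
          lemma : ∀ s t d u → t * d - u ≡ t * (d - u * s) + u * (s * t - 1ℤ)
          lemma = solve-∀
      backward : ∀ x y → Adj n T (f x) (f y) → Adj n S x y
      backward x y adj = ⇒S (U-resp (ι-f-diff x y) (Six⇒U (to A.S⇔Six adj)))
          (comb₁ (- ι (_⊕_ n x (⊖_ n y))) st (lemma s t (ι (_⊕_ n x (⊖_ n y)))))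
        where
          lemma : ∀ s t d → d - t * d * s ≡ - d * (s * t - 1ℤ)
          lemma = solve-∀

-- Rigidity of the triangular neighbourhoods

module Rigidity (n : ℕ) ⦃ nz : NonZero n ⦄ where
  open Residues n
  open Units n

  module _ (10≤n : 10 ℕ.≤ n) {α : ℤ} (root : IsRoot α)
    (f : ℤ → ℤ) (f-cong : ∀ {y z} → y ≈ z → f y ≈ f z) (f-injective : ∀ {y z} → f y ≈ f z → y ≈ z) where

    private module R = Root {α} root

    -- Two steps around the hexagon do not return to the start; otherwise 3 would vanish modulo n.
    α²≉1 : α * α ≉ 1ℤ
    α²≉1 e = ℕ∣.>⇒∤ (ℕₚ.≤-trans (s≤s (s≤s (s≤s (s≤s z≤n)))) 10≤n) (≈0⇒∣ (comb₂ (+ 2 + α) (- (1ℤ + α)) root e (lemma α)))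
      where
        lemma : ∀ α → + 3 - 0ℤ ≡ (+ 2 + α) * (α * α - α + 1ℤ - 0ℤ) + - (1ℤ + α) * (α * α - 1ℤ)
        lemma = solve-∀

    module _ {γ : ℤ} (rootγ : IsRoot γ) (f-edge : ∀ {y z} → Six α (y - z) → Six γ (f y - f z)) where
      private module Rγ = Root {γ} rootγ

      u : ℤ
      u = f 1ℤ - f 0ℤ

      -- The local form of affinity: at x, direction A goes to direction u C, where u is the image
      -- of the step from 0 to 1.
      Local : ℤ → ℤ → ℤ → Set
      Local x A C = f (x + A) ≈ f x + u * C

      -- The neighbour x + Aα² of x is adjacent to x + Aα; its image is adjacent to the
      -- images of both, which leaves one choice besides the image of x + A.
      rotate : ∀ x {A C} → Six α A → Local x A C → Local x (A * α) (C * γ) → Local x (A * α * α) (C * γ * γ)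
      rotate x {A} {C} sA p q = by-cases (Rγ.hexagon 10≤n sw sz szw)
        where
          w = f (x + A * α) - f x
          z = f (x + A * α * α) - f x
          lemma₁ : ∀ x d → d ≡ x + d - x
          lemma₁ = solve-∀
          neighbour : ∀ {d} → Six α d → Six γ (f (x + d) - f x)
          neighbour {d} sd = f-edge (Six-resp (≡⇒≈ (lemma₁ x d)) sd)
          sw : Six γ w
          sw = neighbour (R.Six-* sA Six-α)
          sz : Six γ z
          sz = neighbour (R.Six-* (R.Six-* sA Six-α) Six-α)
          lemma₂ : ∀ x A α → - A - (x + A * α * α - (x + A * α)) ≡ - A * (α * α - α + 1ℤ - 0ℤ)
          lemma₂ = solve-∀
          lemma₃ : ∀ a b c → a - c ≡ a - b - (c - b)
          lemma₃ = solve-∀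
          szw : Six γ (z - w)
          szw = Six-resp (≡⇒≈ (lemma₃ (f (x + A * α * α)) (f x) (f (x + A * α))))
            (f-edge (Six-resp (comb₁ (- A) root (lemma₂ x A α)) (R.Six-neg sA)))
          lemma₄ : ∀ fz fx fw u C γ → fz - (fx + u * (C * γ * γ)) ≡ 1ℤ * (fz - fx - (fw - fx) * γ) + γ * (fw - (fx + u * (C * γ)))
          lemma₄ = solve-∀
          lemma₅ : ∀ fz fx fw u C γ → fz - (fx + u * C)
            ≡ 1ℤ * (fz - fx - (fw - fx) * (1ℤ - γ)) + (1ℤ - γ) * (fw - (fx + u * (C * γ))) + - (u * C) * (γ * γ - γ + 1ℤ - 0ℤ)
          lemma₅ = solve-∀
          lemma₆ : ∀ x A α v → α * α - 1ℤ ≡ v * (x + A * α * α - (x + A)) + (1ℤ - α * α) * (A * v - 1ℤ)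
          lemma₆ = solve-∀
          by-cases : z ≈ w * γ ⊎ z ≈ w * (1ℤ - γ) → Local x (A * α * α) (C * γ * γ)
          by-cases (inj₁ e) = comb₂ 1ℤ γ e q (lemma₄ (f (x + A * α * α)) (f x) (f (x + A * α)) u C γ)
          -- As γ (1 - γ) ≈ 1, this candidate is the image of x + A; injectivity then yields A α² ≈
          -- A and so α² ≈ 1.
          by-cases (inj₂ e) = let v , _ , Av = R.Six-inverse sA in
            ⊥-elim (α²≉1 (comb₂ v (1ℤ - α * α)
              (f-injective (≈-trans (comb₃ 1ℤ (1ℤ - γ) (- (u * C)) e q rootγ
                (lemma₅ (f (x + A * α * α)) (f x) (f (x + A * α)) u C γ)) (≈-sym p))) Av
              (lemma₆ x A α v)))

      Turn : ℤ → ℤ → ℤ → Set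
      Turn x A C = Six α A × Local x A C × Local x (A * α) (C * γ)

      turn : ∀ x A C → Turn x A C → Turn x (A * α) (C * γ)
      turn x A C (sA , p , q) = R.Six-* sA Six-α , q , rotate x {A} {C} sA p q

      Local-resp : ∀ x {A A′ C C′} → A ≈ A′ → C ≈ C′ → Local x A C → Local x A′ C′
      Local-resp x e e′ p = ≈-trans (f-cong (+-congˡ x (≈-sym e))) (≈-trans p (+-congˡ (f x) (*-congˡ u e′)))

      Frame : ℤ → Set
      Frame x = Local x 1ℤ 1ℤ × Local x α γ

      -- At x + 1 the directions α² and α³ = -1 lead to x + α and x.
      advance : ∀ x → Frame x → Frame (x + 1ℤ)
      advance x (p , q) = Local-resp (x + 1ℤ) (sixth α root) (sixth γ rootγ) (proj₁ (proj₂ t)) ,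
                          Local-resp (x + 1ℤ) (seventh α root) (seventh γ rootγ) (proj₂ (proj₂ t))
        where
          lemma₁ : ∀ x α → x + 1ℤ + α * α - (x + α) ≡ 1ℤ * (α * α - α + 1ℤ - 0ℤ)
          lemma₁ = solve-∀
          lemma₂ : ∀ fx fx1 fxα u γ → fxα - (fx1 + u * (γ * γ))
            ≡ 1ℤ * (fxα - (fx + u * γ)) + -1ℤ * (fx1 - (fx + u * 1ℤ)) + - u * (γ * γ - γ + 1ℤ - 0ℤ)
          lemma₂ = solve-∀
          lemma₃ : ∀ x α → x + 1ℤ + α * α * α - x ≡ (1ℤ + α) * (α * α - α + 1ℤ - 0ℤ)
          lemma₃ = solve-∀
          lemma₄ : ∀ fx fx1 u γ → fx - (fx1 + u * (γ * γ * γ))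
            ≡ -1ℤ * (fx1 - (fx + u * 1ℤ)) + - u * (1ℤ + γ) * (γ * γ - γ + 1ℤ - 0ℤ)
          lemma₄ = solve-∀
          lemma₅ : ∀ α → α * α * α * α * α * α - 1ℤ ≡ (1ℤ + α) * (α * α * α - 1ℤ) * (α * α - α + 1ℤ - 0ℤ)
          lemma₅ = solve-∀
          lemma₆ : ∀ α → α * α * α * α * α * α * α - α ≡ α * (1ℤ + α) * (α * α * α - 1ℤ) * (α * α - α + 1ℤ - 0ℤ)
          lemma₆ = solve-∀
          sixth : ∀ α → IsRoot α → α * α * α * α * α * α ≈ 1ℤ
          sixth α r = comb₁ ((1ℤ + α) * (α * α * α - 1ℤ)) r (lemma₅ α)
          seventh : ∀ α → IsRoot α → α * α * α * α * α * α * α ≈ α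
          seventh α r = comb₁ (α * (1ℤ + α) * (α * α * α - 1ℤ)) r (lemma₆ α)
          start : Turn (x + 1ℤ) (α * α) (γ * γ)
          start = R.Six-* Six-α Six-α ,
            ≈-trans (f-cong (comb₁ 1ℤ root (lemma₁ x α)))
              (comb₃ 1ℤ -1ℤ (- u) q p rootγ (lemma₂ (f x) (f (x + 1ℤ)) (f (x + α)) u γ)) ,
            ≈-trans (f-cong (comb₁ (1ℤ + α) root (lemma₃ x α)))
              (comb₂ -1ℤ (- u * (1ℤ + γ)) p rootγ (lemma₄ (f x) (f (x + 1ℤ)) u γ))
          -- Four turns take the pair of directions α², α³ to α⁶ ≈ 1, α⁷ ≈ α, the frame wanted at x
          -- + 1.
          t = turn (x + 1ℤ) (α * α * α * α * α) (γ * γ * γ * γ * γ) (turn (x + 1ℤ) (α * α * α * α) (γ * γ * γ * γ)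
                (turn (x + 1ℤ) (α * α * α) (γ * γ * γ) (turn (x + 1ℤ) (α * α) (γ * γ) start)))

      module _ (start : f α - f 0ℤ ≈ u * γ) where

        frame : ∀ j → Frame (+ j)
        frame zero = comb₁ 1ℤ (≈-refl {f 1ℤ}) (lemma₁ (f 1ℤ) (f 0ℤ)) ,
            ≈-trans (f-cong (≡⇒≈ (ℤₚ.+-identityˡ α))) (comb₁ 1ℤ start (lemma₂ (f α) (f 0ℤ) (u * γ)))
          where
            lemma₁ : ∀ a b → a - (b + (a - b) * 1ℤ) ≡ 1ℤ * (a - a)
            lemma₁ = solve-∀
            lemma₂ : ∀ a b c → a - (b + c) ≡ 1ℤ * (a - b - c)
            lemma₂ = solve-∀
        frame (suc j) = subst Frame (ℤₚ.+-comm (+ j) 1ℤ) (advance (+ j) (frame j))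

        f-linear : ∀ j → f (+ j) ≈ f 0ℤ + u * + j
        f-linear zero    = ≡⇒≈ (lemma (f 0ℤ) u)
          where
            lemma : ∀ a u → a ≡ a + u * 0ℤ
            lemma = solve-∀
        f-linear (suc j) = ≈-trans (f-cong (≡⇒≈ (ℤₚ.+-comm 1ℤ (+ j)))) (comb₂ 1ℤ 1ℤ (proj₁ (frame j)) (f-linear j)
            (lemma (f (+ j + 1ℤ)) (f (+ j)) (f 0ℤ) u (+ j)))
          where
            lemma : ∀ f₁ fⱼ f₀ u j → f₁ - (f₀ + u * (1ℤ + j)) ≡ 1ℤ * (f₁ - (fⱼ + u * 1ℤ)) + 1ℤ * (fⱼ - (f₀ + u * j))
            lemma = solve-∀

        -- Along 0, 1, 2, ... the map is j ↦ f 0 + u j. Some j represents α, so f α is both f 0 + u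
        -- α and f 0 + u γ, and u is a unit.
        α≈γ : α ≈ γ
        α≈γ = let v , _ , uv = Rγ.Six-inverse (f-edge {1ℤ} {0ℤ} Six-1) in
            cancel {u} {v} uv (comb₂ 1ℤ -1ℤ start fα≈ (lemma (f α) (f 0ℤ) (u * α) (u * γ)))
          where
            fα≈ : f α ≈ f 0ℤ + u * α
            fα≈ = ≈-trans (f-cong (≈-sym (ι-ρ α))) (≈-trans (f-linear (toℕ (ρ α))) (+-congˡ (f 0ℤ) (*-congˡ u (ι-ρ α))))
            lemma : ∀ fα f₀ uα uγ → uα - uγ ≡ 1ℤ * (fα - f₀ - uγ) + -1ℤ * (fα - (f₀ + uα))
            lemma = solve-∀

    -- The image of α is a common neighbour of the images of 0 and 1, so relative to f 0 it is u β
    -- or u (1 - β). In the second case the propagation is run with the conjugate root, which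
    -- defines the same target graph.
    rigid : ∀ {β} → IsRoot β → (∀ {y z} → Six α (y - z) → Six β (f y - f z)) → α ≈ β ⊎ α ≈ 1ℤ - β
    rigid {β} rootβ f-edge = Sum.map
        (α≈γ rootβ f-edge)
        (α≈γ (1-IsRoot {β} rootβ) (λ s → Six-unconjugate (f-edge s)))
        (Root.hexagon {β} rootβ 10≤n
          (f-edge {1ℤ} {0ℤ} Six-1)
          (f-edge {α} {0ℤ} (Six-resp (≡⇒≈ (sym (ℤₚ.+-identityʳ α))) Six-α))
          (Six-resp (≡⇒≈ (lemma (f α) (f 1ℤ) (f 0ℤ))) (f-edge {α} {1ℤ} (# 2 , ≡⇒≈ (ev-α-1 α)))))
      where
        lemma : ∀ a b c → a - b ≡ a - c - (b - c)
        lemma = solve-∀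

-- Idempotents modulo n and sets of primes

prime-divisor : ∀ d → d ≢ 0 → d ≢ 1 → ∃[ p ] Prime p × p ℕ∣.∣ d
prime-divisor d d≢0 d≢1 = from-factors factors factorsPrime isFactorisation
  where
    open PrimeFactorisation (factorise d ⦃ ℕ.≢-nonZero d≢0 ⦄)
    from-factors : ∀ ps → All Prime ps → d ≡ foldr ℕ._*_ 1 ps → ∃[ p ] Prime p × p ℕ∣.∣ d
    from-factors []       _        d≡ = contradiction d≡ d≢1
    from-factors (p ∷ ps) (pr ∷ _) d≡ = p , pr , subst (p ℕ∣.∣_) (sym d≡) (ℕ∣.m∣m*n (foldr ℕ._*_ 1 ps))

prime∤1 : ∀ {p} → Prime p → ¬ p ℕ∣.∣ 1
prime∤1 pp p∣1 = ¬prime[1] (subst Prime (ℕ∣.∣1⇒≡1 p∣1) pp)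

prime∣prime : ∀ {p q} → Prime p → Prime q → p ℕ∣.∣ q → p ≡ q
prime∣prime pp pq p∣q = Sum.[ (λ { refl → contradiction pp ¬prime[1] }) , id ]′ (prime⇒irreducible pq p∣q)

prime∣^ : ∀ {p} → Prime p → ∀ m k → p ℕ∣.∣ m ℕ.^ k → p ℕ∣.∣ m
prime∣^ pp m zero    p∣1 = contradiction p∣1 (prime∤1 pp)
prime∣^ pp m (suc k) p∣  = Sum.[ id , prime∣^ pp m k ]′ (euclidsLemma m (m ℕ.^ k) pp p∣)

module Idempotents (n : ℕ) ⦃ nz : NonZero n ⦄ where
  open Residues n

  -- Natural representatives are used so that an idempotent can be labelled by the primes of n that
  -- divide it.
  Idempotent : ℕ → Set
  Idempotent e = + e * + e ≈ + e

  Idempotent-* : ∀ {e f} → Idempotent e → Idempotent f → Idempotent (e ℕ.* f)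
  Idempotent-* {e} {f} ee ff = ≈-trans (≡⇒≈ (cong₂ _*_ (ℤₚ.pos-* e f) (ℤₚ.pos-* e f)))
      (≈-trans (comb₂ (+ f * + f) (+ e) ee ff (lemma (+ e) (+ f))) (≡⇒≈ (sym (ℤₚ.pos-* e f))))
    where
      lemma : ∀ e f → e * f * (e * f) - e * f ≡ f * f * (e * e - e) + e * (f * f - f)
      lemma = solve-∀

  -- Two powers of m agree by the pigeonhole principle, so the powers are eventually
  -- periodic; a multiple of the period beyond the preperiod is an idempotent exponent.
  idempotent-power : ∀ m → ∃[ k ] 1 ℕ.≤ k × Idempotent (m ℕ.^ k)
  idempotent-power m = suc i′ ℕ.* d , ℕₚ.*-mono-≤ {1} {suc i′} {1} {d} (s≤s z≤n) 1≤d , idem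
    where
      f : Fin (suc n) → Fin n
      f i = ρ (+ (m ℕ.^ toℕ i))
      collision = Finₚ.pigeonhole (ℕₚ.n<1+n n) f
      i j : Fin (suc n)
      i = proj₁ collision
      j = proj₁ (proj₂ collision)
      i′ d : ℕ
      i′ = toℕ i
      d = toℕ j ℕ.∸ i′
      i<j : i′ ℕ.< toℕ j
      i<j = proj₁ (proj₂ (proj₂ collision))
      1≤d : 1 ℕ.≤ d
      1≤d = ℕₚ.m<n⇒0<n∸m i<j
      M : ℕ → ℤ
      M k = + (m ℕ.^ k)
      M-+ : ∀ k l → M (k ℕ.+ l) ≡ M k * M l
      M-+ k l = trans (cong +_ (ℕₚ.^-distribˡ-+-* m k l)) (ℤₚ.pos-* (m ℕ.^ k) (m ℕ.^ l))
      base : M i′ ≈ M (i′ ℕ.+ d)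
      base = ≈-trans (≈-sym (ι-ρ (M i′))) (≈-trans (ι-cong (proj₂ (proj₂ (proj₂ collision))))
        (≈-trans (ι-ρ (M (toℕ j))) (≡⇒≈ (cong M (sym (ℕₚ.m+[n∸m]≡n (ℕₚ.<⇒≤ i<j)))))))
      period : ∀ r → M (i′ ℕ.+ r) ≈ M (i′ ℕ.+ r ℕ.+ d)
      period r = ≈-trans (≡⇒≈ (M-+ i′ r)) (≈-trans (*-congʳ (M r) base)
        (≡⇒≈ (trans (sym (M-+ (i′ ℕ.+ d) r)) (cong M (trans (ℕₚ.+-assoc i′ d r)
          (trans (cong (i′ ℕ.+_) (ℕₚ.+-comm d r)) (sym (ℕₚ.+-assoc i′ r d))))))))
      periods : ∀ r q → M (i′ ℕ.+ r) ≈ M (i′ ℕ.+ r ℕ.+ q ℕ.* d)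
      periods r zero    = ≡⇒≈ (cong M (sym (ℕₚ.+-identityʳ (i′ ℕ.+ r))))
      periods r (suc q) = ≈-trans (period r) (≈-trans (≡⇒≈ (cong M (ℕₚ.+-assoc i′ r d)))
        (≈-trans (periods (r ℕ.+ d) q) (≡⇒≈ (cong M
          (trans (cong (ℕ._+ q ℕ.* d) (sym (ℕₚ.+-assoc i′ r d))) (ℕₚ.+-assoc (i′ ℕ.+ r) d (q ℕ.* d)))))))
      k r : ℕ
      k = suc i′ ℕ.* d
      r = k ℕ.∸ i′
      i′≤k : i′ ℕ.≤ k
      i′≤k = ℕₚ.≤-trans (ℕₚ.n≤1+n i′) (ℕₚ.≤-trans (ℕₚ.≤-reflexive (sym (ℕₚ.*-identityʳ (suc i′)))) (ℕₚ.*-monoʳ-≤ (suc i′) 1≤d))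
      k≡ : i′ ℕ.+ r ≡ k
      k≡ = ℕₚ.m+[n∸m]≡n i′≤k
      idem : Idempotent (m ℕ.^ k)
      idem = ≈-sym (subst (λ k → M k ≈ M k * M k) k≡
        (≈-trans (periods r (suc i′)) (≡⇒≈ (trans (M-+ (i′ ℕ.+ r) k) (cong (λ l → M (i′ ℕ.+ r) * M l) (sym k≡))))))

  -- n divides (g - 1) g. Every prime of n divides g, so none divides g - 1; thus n is coprime to g
  -- - 1 and divides g.
  nilpotent-idempotent : ∀ {g} → g * g ≈ g → (∀ {p} → Prime p → p ℕ∣.∣ n → p ℕ∣.∣ ∣ g ∣) → g ≈ 0ℤ
  nilpotent-idempotent {g} gg p∣g = ∣⇒≈ (subst (λ z → n ℕ∣.∣ ∣ z ∣) (sym (ℤₚ.+-identityʳ g))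
      (coprime-divisor {n} {∣ g - 1ℤ ∣} {∣ g ∣} coprime n∣))
    where
      lemma₁ : ∀ g → g * g - g ≡ (g - 1ℤ) * g
      lemma₁ = solve-∀
      lemma₂ : ∀ g → 1ℤ - 0ℤ ≡ 1ℤ * (g - 0ℤ) + -1ℤ * (g - 1ℤ - 0ℤ)
      lemma₂ = solve-∀
      n∣ : n ℕ∣.∣ ∣ g - 1ℤ ∣ ℕ.* ∣ g ∣
      n∣ = subst (n ℕ∣.∣_) (trans (cong ∣_∣ (lemma₁ g)) (ℤₚ.abs-* (g - 1ℤ) g)) (≈⇒∣ gg)
      no-common-prime : ∀ {p} → Prime p → p ℕ∣.∣ n → ¬ p ℕ∣.∣ ∣ g - 1ℤ ∣
      no-common-prime {p} pp p∣n p∣g-1 = prime∤1 pp (Rp.≈0⇒∣ {1}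
          (Rp.comb₂ 1ℤ -1ℤ (∣⇒≈p0 {g} (p∣g pp p∣n)) (∣⇒≈p0 {g - 1ℤ} p∣g-1) (lemma₂ g)))
        where
          instance p≢0 : NonZero p
          p≢0 = prime⇒nonZero pp
          module Rp = Residues p
          ∣⇒≈p0 : ∀ {x} → p ℕ∣.∣ ∣ x ∣ → x Rp.≈ 0ℤ
          ∣⇒≈p0 {x} p∣x = Rp.∣⇒≈ (subst (λ z → p ℕ∣.∣ ∣ z ∣) (sym (ℤₚ.+-identityʳ x)) p∣x)
      coprime : Coprime n ∣ g - 1ℤ ∣
      coprime {d} (d∣n , d∣g-1) with d ℕₚ.≟ 1
      ... | yes d≡1 = d≡1
      ... | no  d≢1 =
        let d≢0 = λ { refl → ℕ.≢-nonZero⁻¹ n (ℕ∣.0∣⇒≡0 d∣n) }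
            p , pp , p∣d = prime-divisor d d≢0 d≢1
        in ⊥-elim (no-common-prime pp (ℕ∣.∣-trans p∣d d∣n) (ℕ∣.∣-trans p∣d d∣g-1))

  -- The product e (1 - f) is idempotent. A prime of n divides f or f - 1, and in the first case it
  -- divides e, so it always divides e (1 - f), which must vanish.
  idempotent-absorbs : ∀ {e f} → Idempotent e → Idempotent f →
    (∀ {p} → Prime p → p ℕ∣.∣ n → p ℕ∣.∣ f → p ℕ∣.∣ e) → + e ≈ + e * + f
  idempotent-absorbs {e} {f} ee ff f⇒e = comb₁ 1ℤ (nilpotent-idempotent {g} gg p∣g) (lemma₁ (+ e) (+ f))
    where
      g = + e * (1ℤ - + f)
      lemma₁ : ∀ e f → e - e * f ≡ 1ℤ * (e * (1ℤ - f) - 0ℤ)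
      lemma₁ = solve-∀
      lemma₂ : ∀ e f → e * (1ℤ - f) * (e * (1ℤ - f)) - e * (1ℤ - f)
        ≡ (1ℤ - f) * (1ℤ - f) * (e * e - e) + e * (f * f - f)
      lemma₂ = solve-∀
      lemma₃ : ∀ f → f * f - f ≡ f * (f - 1ℤ)
      lemma₃ = solve-∀
      gg : g * g ≈ g
      gg = comb₂ ((1ℤ - + f) * (1ℤ - + f)) (+ e) ee ff (lemma₂ (+ e) (+ f))
      ∣g∣ : ∣ g ∣ ≡ e ℕ.* ∣ + f - 1ℤ ∣
      ∣g∣ = trans (ℤₚ.abs-* (+ e) (1ℤ - + f)) (cong (e ℕ.*_) (ℤₚ.∣i-j∣≡∣j-i∣ 1ℤ (+ f)))
      p∣g : ∀ {p} → Prime p → p ℕ∣.∣ n → p ℕ∣.∣ ∣ g ∣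
      p∣g {p} pp p∣n = subst (p ℕ∣.∣_) (sym ∣g∣) (Sum.[ (λ p∣f → ℕ∣.∣m⇒∣m*n ∣ + f - 1ℤ ∣ (f⇒e pp p∣n p∣f)) , ℕ∣.∣n⇒∣m*n e ]′
        (euclidsLemma f ∣ + f - 1ℤ ∣ pp (ℕ∣.∣-trans p∣n
          (subst (n ℕ∣.∣_) (trans (cong ∣_∣ (lemma₃ (+ f))) (ℤₚ.abs-* (+ f) (+ f - 1ℤ))) (≈⇒∣ ff)))))

  idempotent-unique : ∀ {e f} → Idempotent e → Idempotent f →
    (∀ {p} → Prime p → p ℕ∣.∣ n → p ℕ∣.∣ e → p ℕ∣.∣ f) →
    (∀ {p} → Prime p → p ℕ∣.∣ n → p ℕ∣.∣ f → p ℕ∣.∣ e) → + e ≈ + f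
  idempotent-unique {e} {f} ee ff e⇒f f⇒e = ≈-trans (idempotent-absorbs {e} {f} ee ff f⇒e)
    (≈-trans (≡⇒≈ (ℤₚ.*-comm (+ e) (+ f))) (≈-sym (idempotent-absorbs {f} {e} ff ee e⇒f)))

  abstract
    -- Opaque, so that type checking does not run the pigeonhole search.
    exponent : ℕ → ℕ
    exponent q = proj₁ (idempotent-power q)

    1≤exponent : ∀ q → 1 ℕ.≤ exponent q
    1≤exponent q = proj₁ (proj₂ (idempotent-power q))

    exponent-idempotent : ∀ q → Idempotent (q ℕ.^ exponent q)
    exponent-idempotent q = proj₂ (proj₂ (idempotent-power q))

  -- For prime q this is an idempotent with q as its only prime divisor: the building block for
  -- prescribing a set of primes.
  E : ℕ → ℕ
  E q = q ℕ.^ exponent q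

  q∣E : ∀ q → q ℕ∣.∣ E q
  q∣E q with exponent q | 1≤exponent q
  ... | suc k | _ = ℕ∣.m∣m*n (q ℕ.^ k)

  ∣E⇒≡ : ∀ {p q} → Prime p → Prime q → p ℕ∣.∣ E q → p ≡ q
  ∣E⇒≡ {p} {q} pp pq p∣E = prime∣prime pp pq (prime∣^ pp q (exponent q) p∣E)

  idempotents : List ℕ → List ℕ
  idempotents []       = 1 ∷ []
  idempotents (q ∷ qs) = idempotents qs ++ map (E q ℕ.*_) (idempotents qs)

  idempotents-length : ∀ qs → length (idempotents qs) ≡ 2 ℕ.^ length qs
  idempotents-length []       = refl
  idempotents-length (q ∷ qs) = trans (length-++ (idempotents qs))
    (cong₂ ℕ._+_ (idempotents-length qs) (trans (length-map (E q ℕ.*_) (idempotents qs))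
      (trans (idempotents-length qs) (sym (ℕₚ.+-identityʳ _)))))

  idempotents-idempotent : ∀ qs → All Idempotent (idempotents qs)
  idempotents-idempotent []       = ≈-refl ∷ []
  idempotents-idempotent (q ∷ qs) = Allₚ.++⁺ (idempotents-idempotent qs)
    (Allₚ.map⁺ (All.map (λ {f} ff → Idempotent-* {E q} {f} (exponent-idempotent q) ff) (idempotents-idempotent qs)))

  DivisorsIn : List ℕ → ℕ → Set
  DivisorsIn qs f = ∀ p → Prime p → p ℕ∣.∣ f → p ∈ qs

  idempotents-divisors : ∀ {qs} → All Prime qs → All (DivisorsIn qs) (idempotents qs)
  idempotents-divisors [] = (λ p pp p∣1 → contradiction p∣1 (prime∤1 pp)) ∷ []
  idempotents-divisors (_∷_ {x = q} {xs = qs} pq pqs) = Allₚ.++⁺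
    (All.map (λ d p pp p∣f → there (d p pp p∣f)) (idempotents-divisors pqs))
    (Allₚ.map⁺ (All.map (λ {f} d p pp p∣ → Sum.[ (λ p∣E → here (∣E⇒≡ pp pq p∣E)) , (λ p∣f → there (d p pp p∣f)) ]′
      (euclidsLemma (E q) f pp p∣)) (idempotents-divisors pqs)))

  Separated : List ℕ → ℕ → ℕ → Set
  Separated qs f g = ∃[ r ] r ∈ qs × ((r ℕ∣.∣ f × ¬ r ℕ∣.∣ g) ⊎ (¬ r ℕ∣.∣ f × r ℕ∣.∣ g))

  -- A pair in which exactly one member contains the factor `E q` is separated by q. Otherwise the
  -- separating prime comes from the recursion, and a common factor `E q` does not disturb it
  -- because no other prime divides it.
  idempotents-separated : ∀ {qs} → Unique qs → All Prime qs → AllPairs (Separated qs) (idempotents qs)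
  idempotents-separated [] [] = [] ∷ []
  idempotents-separated {q ∷ qs} uu@(_ ∷ u) (pq ∷ pqs) = AllPairsₚ.++⁺
      (AllPairs.map (λ (r , r∈ , s) → r , there r∈ , s) rec)
      (AllPairsₚ.map⁺ (AllPairs.map (λ {f} {g} (r , r∈ , s) → r , there r∈ ,
        Sum.map (λ (r∣f , r∤g) → ℕ∣.∣n⇒∣m*n (E q) r∣f , r∤g ∘ undo r∈ g)
                (λ (r∤f , r∣g) → r∤f ∘ undo r∈ f , ℕ∣.∣n⇒∣m*n (E q) r∣g) s) rec))
      (All.map (λ {f} d → Allₚ.map⁺ (All.universal (λ g → q , here refl ,
        inj₂ ((λ q∣f → q∉qs (d q pq q∣f)) , ℕ∣.∣m⇒∣m*n g (q∣E q))) (idempotents qs))) (idempotents-divisors pqs))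
    where
      rec = idempotents-separated u pqs
      q∉qs : q ∉ qs
      q∉qs = unique-head uu
      undo : ∀ {r} → r ∈ qs → ∀ f → r ℕ∣.∣ E q ℕ.* f → r ℕ∣.∣ f
      undo {r} r∈ f r∣ = Sum.[ (λ r∣E → contradiction (subst (_∈ qs) (∣E⇒≡ (All.lookup pqs r∈) pq r∣E) r∈) q∉qs) , id ]′
        (euclidsLemma (E q) f (All.lookup pqs r∈) r∣)

  -- The factor `E q` is taken exactly when q divides e.
  idempotents-complete : ∀ {qs} → All Prime qs → ∀ e → ∃[ f ] f ∈ idempotents qs ×
    (∀ {p} → Prime p → p ℕ∣.∣ f → p ℕ∣.∣ e) × (∀ {p} → p ∈ qs → p ℕ∣.∣ e → p ℕ∣.∣ f)
  idempotents-complete [] e = 1 , here refl ,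
    (λ pp p∣1 → contradiction p∣1 (prime∤1 pp)) , λ ()
  idempotents-complete {q ∷ qs} (pq ∷ pqs) e with idempotents-complete pqs e | q ℕ∣.∣? e
  ... | f , f∈ , f⇒e , e⇒f | no q∤e = f , ∈-++⁺ˡ f∈ , f⇒e ,
      λ { (here refl) q∣e → contradiction q∣e q∤e ; (there p∈) p∣e → e⇒f p∈ p∣e }
  ... | f , f∈ , f⇒e , e⇒f | yes q∣e = E q ℕ.* f , ∈-++⁺ʳ (idempotents qs) (∈-map⁺ (E q ℕ.*_) f∈) ,
      (λ {p} pp p∣ → Sum.[ (λ p∣E → subst (ℕ∣._∣ e) (sym (∣E⇒≡ pp pq p∣E)) q∣e) , f⇒e pp ]′ (euclidsLemma (E q) f pp p∣)) ,
      λ { (here refl) _ → ℕ∣.∣m⇒∣m*n f (q∣E q) ; (there p∈) p∣e → ℕ∣.∣n⇒∣m*n (E q) (e⇒f p∈ p∣e) }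

-- Isomorphisms between the graphs of two solutions

abstract
  below-10-table : ∀ (r : Fin 10) → 7 ℕ.≤ toℕ r → toℕ r % 6 ≡ 1 → toℕ r ≡ 7
  below-10-table = from-yes (Finₚ.all? λ (r : Fin 10) → (7 ℕₚ.≤? toℕ r) →-dec ((toℕ r % 6 ℕₚ.≟ 1) →-dec (toℕ r ℕₚ.≟ 7)))

  prime-7 : Prime 7
  prime-7 = from-yes (prime? 7)

≡7⊎10≤ : ∀ {n} → 7 ℕ.≤ n → n % 6 ≡ 1 → n ≡ 7 ⊎ 10 ℕ.≤ n
≡7⊎10≤ {n} 7≤n n%6≡1 with 10 ℕₚ.≤? n
... | yes 10≤n = inj₂ 10≤n
... | no  10≰n = inj₁ (trans (sym r≡) (below-10-table (fromℕ< n<10) (subst (7 ℕ.≤_) (sym r≡) 7≤n) (trans (cong (_% 6) r≡) n%6≡1)))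
  where
    n<10 = ℕₚ.≰⇒> 10≰n
    r≡ = Finₚ.toℕ-fromℕ< n<10

module Isomorphism (n : ℕ) ⦃ nz : NonZero n ⦄ (7≤n : 7 ℕ.≤ n) (n%6≡1 : n % 6 ≡ 1) where
  open Residues n
  open Units n
  open Equivalence

  TLₙ : ℕ → Sub n
  TLₙ a = TL n a (a ℕ.∸ 1) 1

  -- The two equations differ by (α - β)(α + β - 1), and a prime modulus divides one of the factors.
  roots-mod-7 : n ≡ 7 → ∀ {α β} → IsRoot α → IsRoot β → α ≈ β ⊎ α ≈ 1ℤ - β
  roots-mod-7 n≡7 {α} {β} rα rβ = Sum.map ∣⇒≈ (λ d → ∣⇒≈ (subst (λ z → n ℕ∣.∣ ∣ z ∣) (lemma₂ α β) d))
      (euclidsLemma ∣ α - β ∣ ∣ α + β - 1ℤ ∣ (subst Prime (sym n≡7) prime-7)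
        (subst (n ℕ∣.∣_) (trans (cong ∣_∣ (ℤₚ.+-identityʳ ((α - β) * (α + β - 1ℤ)))) (ℤₚ.abs-* (α - β) (α + β - 1ℤ)))
          (≈⇒∣ (comb₂ {x = (α - β) * (α + β - 1ℤ)} {y = 0ℤ} 1ℤ -1ℤ rα rβ (lemma₁ α β)))))
    where
      lemma₁ : ∀ α β → (α - β) * (α + β - 1ℤ) - 0ℤ ≡ 1ℤ * (α * α - α + 1ℤ - 0ℤ) + -1ℤ * (β * β - β + 1ℤ - 0ℤ)
      lemma₁ = solve-∀
      lemma₂ : ∀ α β → α + β - 1ℤ ≡ α - (1ℤ - β)
      lemma₂ = solve-∀

  Iso⇒ : ∀ {a b} → a ℕ.< n → b ℕ.< n → IsSol n a → IsSol n b → Iso n (TLₙ a) (TLₙ b) →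
    + a ≈ + b ⊎ + a ≈ 1ℤ - + b
  Iso⇒ {a} {b} a<n b<n sa sb (f , (f-injective , _) , f-adj) = Sum.[ from-7 , from-10 ]′ (≡7⊎10≤ 7≤n n%6≡1)
    where
      module A = Affine n 7≤n n%6≡1 a a<n sa
      module B = Affine n 7≤n n%6≡1 b b<n sb
      from-7 : n ≡ 7 → + a ≈ + b ⊎ + a ≈ 1ℤ - + b
      from-7 n≡7 = roots-mod-7 n≡7 A.root B.root
      fᶻ : ℤ → ℤ
      fᶻ z = ι (f (ρ z))
      fᶻ-injective : ∀ {y z} → fᶻ y ≈ fᶻ z → y ≈ z
      fᶻ-injective {y} {z} e = ≈-trans (≈-sym (ι-ρ y)) (≈-trans (ι-cong (f-injective (ρ y) (ρ z) (ι-injective e))) (ι-ρ z))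
      fᶻ-edge : ∀ {y z} → Six (+ a) (y - z) → Six (+ b) (fᶻ y - fᶻ z)
      fᶻ-edge {y} {z} s = Six-resp (ι-diff (f (ρ y)) (f (ρ z))) (to B.S⇔Six (to (f-adj (ρ y) (ρ z)) (from A.S⇔Six
        (Six-resp (≈-sym (≈-trans (ι-diff (ρ y) (ρ z)) (+-cong (ι-ρ y) (neg-cong (ι-ρ z))))) s))))
      from-10 : 10 ℕ.≤ n → + a ≈ + b ⊎ + a ≈ 1ℤ - + b
      from-10 10≤n = Rigidity.rigid n 10≤n {+ a} A.root fᶻ (λ e → ι-cong (cong f (ρ-cong e))) fᶻ-injective {+ b} B.root fᶻ-edge

  TL-conjugate : ∀ {a b} → a ℕ.< n → b ℕ.< n → IsSol n a → IsSol n b → + a ≈ 1ℤ - + b → ∀ x → TLₙ b x ⇔ TLₙ a x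
  TL-conjugate {a} {b} a<n b<n sa sb e x = mk⇔
      (λ s → from A.S⇔Six (Six-cong (≈-sym e) (Six-unconjugate (to B.S⇔Six s))))
      (λ s → from B.S⇔Six (Six-conjugate (Six-cong e (to A.S⇔Six s))))
    where
      module A = Affine n 7≤n n%6≡1 a a<n sa
      module B = Affine n 7≤n n%6≡1 b b<n sb

  Iso-respʳ : ∀ {S T T′} → (∀ x → T x ⇔ T′ x) → Iso n S T → Iso n S T′
  Iso-respʳ T⇔T′ (f , bij , adj) = f , bij , λ x y → mk⇔ (to (T⇔T′ _) ∘ to (adj x y)) (from (adj x y) ∘ from (T⇔T′ _))

-- Enumeration of the solutions and of the isomorphism classes

module Enumeration (n : ℕ) ⦃ nz : NonZero n ⦄ (7≤n : 7 ℕ.≤ n) (n%6≡1 : n % 6 ≡ 1)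
  (a : ℕ) (sol : IsSol n a) where
  open Residues n
  open Idempotents n
  open Isomorphism n 7≤n n%6≡1

  -- δ is the difference (1 - α) - α of the conjugate roots. Its square is congruent to -3, so it is
  -- a unit as soon as 3 is.
  α δ : ℤ
  α = + a
  δ = 1ℤ - + 2 * α

  root : IsRoot α
  root = IsSol⇒IsRoot sol

  δ-invertible : ∃[ c ] δ * c ≈ 1ℤ
  δ-invertible = let t , 3t = Invertible12.3-invertible n n%6≡1 in
      - (δ * t) , comb₂ 1ℤ (- (+ 4 * t)) 3t root (lemma α t)
    where
      lemma : ∀ α t → (1ℤ - + 2 * α) * - ((1ℤ - + 2 * α) * t) - 1ℤ
        ≡ 1ℤ * (+ 3 * t - 1ℤ) + - (+ 4 * t) * (α * α - α + 1ℤ - 0ℤ)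
      lemma = solve-∀

  private
    c = proj₁ δ-invertible
    δc : δ * c ≈ 1ℤ
    δc = proj₂ δ-invertible

  -- The roots of x² - x + 1 are the α + e (1 - 2 α) with e idempotent.
  solution : ℕ → ℕ
  solution e = toℕ (ρ (α + + e * δ))

  solution≈ : ∀ e → + solution e ≈ α + + e * δ
  solution≈ e = ι-ρ (α + + e * δ)

  solution<n : ∀ e → solution e ℕ.< n
  solution<n e = Finₚ.toℕ<n (ρ (α + + e * δ))

  solution-sol : ∀ {e} → Idempotent e → IsSol n (solution e)
  solution-sol {e} ee = IsRoot⇒IsSol (IsRoot-resp (≈-sym (solution≈ e)) (comb₂ 1ℤ (δ * δ) root ee (lemma α (+ e))))
    where
      lemma : ∀ α e → (α + e * (1ℤ - + 2 * α)) * (α + e * (1ℤ - + 2 * α)) - (α + e * (1ℤ - + 2 * α)) + 1ℤ - 0ℤ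
        ≡ 1ℤ * (α * α - α + 1ℤ - 0ℤ) + (1ℤ - + 2 * α) * (1ℤ - + 2 * α) * (e * e - e)
      lemma = solve-∀

  -- Put e = (b - α) / δ. At α + e δ the polynomial x² - x + 1 exceeds its value at α by δ² (e² -
  -- e), so being a root amounts to e being idempotent.
  coordinate : ∀ {b} → IsSol n b → ∃[ e ] Idempotent e × + b ≈ α + + e * δ
  coordinate {b} sb = e , idem , b≈
    where
      e = toℕ (ρ ((+ b - α) * c))
      e≈ : + e ≈ (+ b - α) * c
      e≈ = ι-ρ ((+ b - α) * c)
      lemma₁ : ∀ α b e c → b - (α + e * (1ℤ - + 2 * α)) ≡ - (1ℤ - + 2 * α) * (e - (b - α) * c) + - (b - α) * ((1ℤ - + 2 * α) * c - 1ℤ)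
      lemma₁ = solve-∀
      b≈ : + b ≈ α + + e * δ
      b≈ = comb₂ (- δ) (- (+ b - α)) e≈ δc (lemma₁ α (+ b) (+ e) c)
      lemma₂ : ∀ α e → (1ℤ - + 2 * α) * ((1ℤ - + 2 * α) * (e * e)) - (1ℤ - + 2 * α) * ((1ℤ - + 2 * α) * e)
        ≡ 1ℤ * ((α + e * (1ℤ - + 2 * α)) * (α + e * (1ℤ - + 2 * α)) - (α + e * (1ℤ - + 2 * α)) + 1ℤ - 0ℤ)
          + -1ℤ * (α * α - α + 1ℤ - 0ℤ)
      lemma₂ = solve-∀
      idem : + e * + e ≈ + e
      idem = cancel {δ} {c} δc (cancel {δ} {c} δc (comb₂ 1ℤ -1ℤ (IsRoot-resp b≈ (IsSol⇒IsRoot sb)) root (lemma₂ α (+ e))))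

  solution-injective : ∀ e f → + solution e ≈ + solution f → + e ≈ + f
  solution-injective e f p = cancel {δ} {c} δc (comb₁ 1ℤ (≈-trans (≈-sym (solution≈ e)) (≈-trans p (solution≈ f))) (lemma α δ (+ e) (+ f)))
    where
      lemma : ∀ α δ e f → δ * e - δ * f ≡ 1ℤ * (α + e * δ - (α + f * δ))
      lemma = solve-∀

  solution-conjugate : ∀ e f → + solution e ≈ 1ℤ - + solution f → + e + + f ≈ 1ℤ
  solution-conjugate e f p = cancel {δ} {c} δc (comb₁ 1ℤ
      (≈-trans (≈-sym (solution≈ e)) (≈-trans p (+-congˡ 1ℤ (neg-cong (solution≈ f))))) (lemma α (+ e) (+ f)))
    where
      lemma : ∀ α e f → (1ℤ - + 2 * α) * (e + f) - (1ℤ - + 2 * α) * 1ℤ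
        ≡ 1ℤ * (α + e * (1ℤ - + 2 * α) - (1ℤ - (α + f * (1ℤ - + 2 * α))))
      lemma = solve-∀

  -- The solutions of e and 1 - e are conjugate and give the same graph, and p divides
  -- exactly one of e and 1 - e.
  module Representatives {p : ℕ} {qs : List ℕ} (pp : Prime p) (p∣n : p ℕ∣.∣ n) (p∉qs : p ∉ qs)
    (unique : Unique qs) (primes : All Prime qs) (qs∣n : All (ℕ∣._∣ n) qs)
    (all-primes : ∀ q → Prime q → q ℕ∣.∣ n → q ∈ p ∷ qs) where

    p∤ : ∀ {f} → DivisorsIn qs f → ¬ p ℕ∣.∣ f
    p∤ d p∣f = p∉qs (d p pp p∣f)

    graphs : List (Sub n)
    graphs = map (TLₙ ∘ solution) (idempotents qs)

    graphs-length : length graphs ≡ 2 ℕ.^ length qs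
    graphs-length = trans (length-map (TLₙ ∘ solution) (idempotents qs)) (idempotents-length qs)

    graphs-circ : All (FrobCirc n) graphs
    graphs-circ = Allₚ.map⁺ (All.map
      (λ {e} ee → Affine.S-frobCirc n 7≤n n%6≡1 (solution e) (solution<n e) (solution-sol {e} ee)) (idempotents-idempotent qs))

    ≈-∣ : ∀ {r e f} → r ℕ∣.∣ n → + e ≈ + f → r ℕ∣.∣ e → r ℕ∣.∣ f
    ≈-∣ {r} {e} {f} r∣n e≈f r∣e = Rr.≈0⇒∣ (Rr.≈-trans (Rr.≈-sym (coarsen {r} {n} r∣n e≈f)) (Rr.∣⇒≈0 r∣e))
      where
        instance r≢0 : NonZero r
        r≢0 = ℕ.≢-nonZero λ { refl → ℕ.≢-nonZero⁻¹ n (ℕ∣.0∣⇒≡0 r∣n) }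
        module Rr = Residues r

    separated⇒≉ : ∀ {e f} → Separated qs e f → + e ≉ + f
    separated⇒≉ (r , r∈ , inj₁ (r∣e , r∤f)) p = r∤f (≈-∣ (All.lookup qs∣n r∈) p r∣e)
    separated⇒≉ (r , r∈ , inj₂ (r∤e , r∣f)) p = r∤e (≈-∣ (All.lookup qs∣n r∈) (≈-sym p) r∣f)

    -- From e + f ≈ 1 follows e f ≈ e - e² ≈ 0, so the prime p set aside would divide e or f, whose
    -- prime divisors all lie in `qs`.
    ¬sum≈1 : ∀ {e f} → Idempotent e → DivisorsIn qs e → DivisorsIn qs f → + e + + f ≉ 1ℤ
    ¬sum≈1 {e} {f} ee de df p = Sum.[ p∤ de , p∤ df ]′ (euclidsLemma e f pp (ℕ∣.∣-trans p∣n
        (≈0⇒∣ (≈-trans (≡⇒≈ (ℤₚ.pos-* e f)) (comb₂ (+ e) -1ℤ p ee (lemma (+ e) (+ f)))))))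
      where
        lemma : ∀ e f → e * f - 0ℤ ≡ e * (e + f - 1ℤ) + -1ℤ * (e * e - e)
        lemma = solve-∀

    ¬iso : ∀ {e f} → (Idempotent e × DivisorsIn qs e) → (Idempotent f × DivisorsIn qs f) →
      Separated qs e f → ¬ Iso n (TLₙ (solution e)) (TLₙ (solution f))
    ¬iso {e} {f} (ee , de) (ff , df) s iso = Sum.[ separated⇒≉ s ∘ solution-injective e f ,
        ¬sum≈1 {e} {f} ee de df ∘ solution-conjugate e f ]′
      (Iso⇒ {solution e} {solution f} (solution<n e) (solution<n f) (solution-sol {e} ee) (solution-sol {f} ff) iso)

    good : All (λ e → Idempotent e × DivisorsIn qs e) (idempotents qs)
    good = All.zip (idempotents-idempotent qs , idempotents-divisors primes)

    graphs-distinct : AllPairs (λ S T → ¬ Iso n S T) graphs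
    graphs-distinct = AllPairsₚ.map⁺ (restrict good (idempotents-separated unique primes))
      where
        restrict : ∀ {es} → All (λ e → Idempotent e × DivisorsIn qs e) es → AllPairs (Separated qs) es →
          AllPairs (λ e f → ¬ Iso n (TLₙ (solution e)) (TLₙ (solution f))) es
        restrict [] [] = []
        restrict {e ∷ _} (g ∷ gs) (s ∷ ss) = All.zipWith (λ {f} (h , s) → ¬iso {e} {f} g h s) (gs , s) ∷ restrict gs ss

    -- With p excluded, every prime of n dividing e lies in `qs`, so the listed idempotent with the
    -- same primes agrees with e modulo n.
    representative : ∀ {e} → Idempotent e → ¬ p ℕ∣.∣ e → ∃[ f ] f ∈ idempotents qs × + f ≈ + e
    representative {e} ee p∤e =
      let f , f∈ , f⇒e , e⇒f = idempotents-complete primes e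
      in f , f∈ , idempotent-unique {f} {e} (All.lookup (idempotents-idempotent qs) f∈) ee (λ rp _ → f⇒e rp)
           (λ rp r∣n r∣e → e⇒f (∈-tail (all-primes _ rp r∣n) (λ { refl → p∤e r∣e })) r∣e)

    graphs-complete : ∀ {S} → FrobCirc n S → Any (Iso n S) graphs
    graphs-complete {S} circ = by-p (p ℕ∣.∣? e)
      where
        module C = Circulant n 7≤n circ
        e = proj₁ (coordinate {C.a} C.sol)
        ee : Idempotent e
        ee = proj₁ (proj₂ (coordinate {C.a} C.sol))
        a≈ : + C.a ≈ α + + e * δ
        a≈ = proj₂ (proj₂ (coordinate {C.a} C.sol))
        by-p : Dec (p ℕ∣.∣ e) → Any (Iso n S) graphs
        by-p (no p∤e) =
          let f , f∈ , f≈e = representative {e} ee p∤e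
              a≡ : C.a ≡ solution f
              a≡ = small-≈⇒≡ C.a<n (solution<n f) (≈-trans a≈ (≈-sym (≈-trans (solution≈ f) (+-congˡ α (*-congʳ δ f≈e)))))
          in lose (∈-map⁺ (TLₙ ∘ solution) f∈) (subst (λ b → Iso n S (TLₙ b)) a≡ C.isoTL)
        by-p (yes p∣e) =
          let f , f∈ , f≈e′ = representative {e′} ee′ p∤e′
              ff = All.lookup (idempotents-idempotent qs) f∈
          in lose (∈-map⁺ (TLₙ ∘ solution) f∈) (Iso-respʳ {S} (TL-conjugate {solution f} {C.a} (solution<n f) C.a<n (solution-sol {f} ff) C.sol
               (≈-trans (solution≈ f) (comb₃ δ δ 1ℤ f≈e′ e′≈ a≈ (lemma₁ α (+ C.a) (+ f) (+ e′) (+ e))))) C.isoTL)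
          where
            e′ = toℕ (ρ (1ℤ - + e))
            e′≈ : + e′ ≈ 1ℤ - + e
            e′≈ = ι-ρ (1ℤ - + e)
            lemma₁ : ∀ α a f e′ e → α + f * (1ℤ - + 2 * α) - (1ℤ - a)
              ≡ (1ℤ - + 2 * α) * (f - e′) + (1ℤ - + 2 * α) * (e′ - (1ℤ - e)) + 1ℤ * (a - (α + e * (1ℤ - + 2 * α)))
            lemma₁ = solve-∀
            lemma₂ : ∀ e e′ → e′ * e′ - e′ ≡ (e′ - e) * (e′ - (1ℤ - e)) + 1ℤ * (e * e - e)
            lemma₂ = solve-∀
            ee′ : Idempotent e′
            ee′ = comb₂ (+ e′ - + e) 1ℤ e′≈ ee (lemma₂ (+ e) (+ e′))
            p∤e′ : ¬ p ℕ∣.∣ e′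
            p∤e′ p∣e′ = prime∤1 pp
                (≈-∣ {p} {e ℕ.+ e′} {1} p∣n (comb₁ 1ℤ e′≈ (lemma₃ (+ e) (+ e′))) (ℕ∣.∣m∣n⇒∣m+n p∣e p∣e′))
              where
                lemma₃ : ∀ e e′ → e + e′ - 1ℤ ≡ 1ℤ * (e′ - (1ℤ - e))
                lemma₃ = solve-∀

-- Assembly of the conditions

condE : ∀ n ⦃ _ : NonZero n ⦄ → 7 ℕ.≤ n → n % 6 ≡ 1 → ∀ {a} → IsSol n a → CondE n
condE n 7≤n n%6≡1 {a} sol l ([] , _ , _ , _ , all-primes , _) =
  let p , pp , p∣n = prime-divisor n (λ { refl → contradiction 7≤n λ () }) (λ { refl → contradiction 7≤n (ℕₚ.<⇒≱ (s≤s (s≤s z≤n))) })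
  in contradiction (all-primes p pp p∣n) λ ()
-- The head of the list serves as the prime set aside, and l - 1 is the length of the tail.
condE n 7≤n n%6≡1 {a} sol l (p ∷ qs , unique@(_ ∷ u) , pp ∷ pqs , p∣n ∷ qs∣n , all-primes , refl) =
    graphs , graphs-length , graphs-circ , graphs-distinct , (λ S → graphs-complete) ,
    λ S circ → let module C = Circulant n 7≤n circ in C.a , C.a<n , C.sol , C.isoTL
  where
    open Enumeration n 7≤n n%6≡1 a sol
    open Representatives {p} {qs} pp p∣n (unique-head unique) u pqs qs∣n all-primes

theorem2p2 : (n : ℕ) ⦃ nz : NonZero n ⦄ → 7 ≤ n →
    (CondA n ⇔ CondB n) × (CondA n ⊎ CondB n → CondC n × CondD n × CondE n)
theorem2p2 n 7≤n = mk⇔ A⇒B B⇒A , λ c → from-B (Sum.[ A⇒B , id ]′ c)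
  where
    open Residues n
    open Equivalence
    A⇒B : CondA n → CondB n
    A⇒B (a , b , _ , circ) = let module C = Circulant n 7≤n circ in C.n%6≡1 , C.a , C.sol

    -- The solution in (b) may be any natural number, whereas the parameters of the graph have to
    -- lie below n.
    reduce : ∀ x → IsSol n x → IsSol n (x % n)
    reduce x s = IsRoot⇒IsSol (IsRoot-resp (≈-sym (%-≈ x)) (IsSol⇒IsRoot s))

    props : n % 6 ≡ 1 → ∀ a → a ℕ.< n → IsSol n a → SolProps n a
    props n%6≡1 a a<n s = SolutionProps.solProps n 7≤n n%6≡1 a a<n s

    B⇒A : CondB n → CondA n
    B⇒A (n%6≡1 , x , s) = let params , circ , _ = props n%6≡1 (x % n) (ℕD.m%n<n x n) (reduce x s) in
      x % n , x % n ℕ.∸ 1 , params , circ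

    from-B : CondB n → CondC n × CondD n × CondE n
    from-B (n%6≡1 , x , s) = condC , (props n%6≡1 , converse) , condE n 7≤n n%6≡1 {x} s
      where
        condC : CondC n
        condC p pp p∣n = root⇒%6≡1 p {+ x} (coarsen {p} {n} p∣n (IsSol⇒IsRoot s)) (%6≡1⇒3∤ n%6≡1 ∘ λ 3∣p → ℕ∣.∣-trans 3∣p p∣n)
          where instance p≢0 = prime⇒nonZero pp
        converse : ∀ a b → TLParams n a b 1 → FrobCirc n (TL n a b 1) →
          ∃[ a′ ] (a′ ℕ.< n × IsSol n a′ × (_≐_ n (TL n a b 1) (TL n a′ (a′ ℕ.∸ 1) 1)))
        converse a b _ circ = let module C = Circulant n 7≤n circ in
          -- The third parameter places [1] in the connection set, which removes the scaling by s.
          C.a , C.a<n , C.sol , C.S⇔TL (inj₂ (inj₂ (inj₂ (inj₂ (inj₁ refl)))))
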